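{- Let $n$ and $m$ be integers with $n\geq 6$ and $5\leq m\leq 2n-3$. Then $H_{n,m}$ is a $3$-uniformly most reliable two-terminal graph ($3$-UMRTTG) in $T_{n,m}$, and it is the only one (every $3$-UMRTTG in $T_{n,m}$ is isomorphic to $H_{n,m}$ as a two-terminal graph).
   Context: All graphs are finite, simple and undirected. A two-terminal graph is a graph $G$ together with two distinguished vertices $s,t$ (the terminals). Two two-terminal graphs are isomorphic if there is a graph isomorphism between them mapping the set of terminals onto the set of terminals. $T_{n,m}$ denotes the set of all pairwise nonisomorphic two-terminal graphs with $n$ vertices and $m$ edges. For a positive integer $d$, a $d$-pathset of a two-terminal graph $G$ is a spanning subgraph of $G$ containing a path of length (number of edges) at most $d$ joining $s$ and $t$. For $\rho\in[0,1]$, $R_G^d(\rho)$ is the probability that the random spanning subgraph obtained from $G$ by deleting each edge independently with probability $\rho$ is a $d$-pathset. A graph $G\in T_{n,m}$ is a $d$-UMRTTG if $R_G^d(\rho)\geq R_H^d(\rho)$ for every $H\in T_{n,m}$ and every $\rho\in[0,1]$. For integers $k\geq 3$ and $r\in\{0,1,\ldots,k-3\}$, $A_{k,r}$ is the two-terminal graph with vertex set $\{s,t,v_3,\ldots,v_k\}$, terminals $s,t$, and edge set $\{st\}\cup\{sv_i,v_it: 3\leq i\leq k\}\cup\{v_3v_{3+j}: 1\leq j\leq r\}$. For $n\geq 5$ and $5\leq m\leq 2n-3$, $H_{n,m}\in T_{n,m}$ is obtained from $A_{(m+2)/2,1}$ by adding $n-\frac{m+2}{2}$ isolated vertices when $m$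 is even, and from $A_{(m+3)/2,0}$ by adding $n-\frac{m+3}{2}$ isolated vertices when $m$ is odd. -}

module Defs where

import Algebra.Bundles as Algebra
import Algebra.Properties.CommutativeSemigroup as CommutativeSemigroupProperties
open import Data.Fin.Base as Fin using (Fin; toℕ; fromℕ<; inject≤)
import Data.Fin.Properties as Fin
open import Data.Fin.Permutation using (Permutation; _⟨$⟩ʳ_)
open import Data.Fin.Subset using (Subset; inside; outside; _∈_)
open import Data.Fin.Subset.Properties using (_∈?_)
open import Data.List.Base as List
  using (List; []; _∷_; length; allFin; cartesianProduct; filter; foldr; map; _++_)
open import Data.List.Membership.Propositional.Properties using (∈-filter⁻; ∈-lookup)
open import Data.Nat.Base as ℕ using (ℕ; zero; suc; _≤_; z≤n; s≤s; s≤s⁻¹; _∸_)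
open import Data.Nat.Divisibility using (_∣_; _∣?_)
open import Data.Nat.DivMod using (_/_; /-monoˡ-≤; m*n/n≡m)
import Data.Nat.Properties as ℕ
open import Data.Product using (∃; ∃₂; _×_; _,_; proj₁; proj₂)
open import Data.Product.Properties using (≡-dec)
open import Data.Rational.Base as ℚ using (ℚ; 0ℚ; 1ℚ; ½)
import Data.Rational.Properties as ℚ
open import Data.Sum using (_⊎_; inj₁; inj₂; swap)
open import Data.Vec.Base as Vec using (Vec; []; _∷_; head; last)
open import Data.Vec.Relation.Unary.Linked using (Linked; linked?)
open import Data.Vec.Relation.Unary.AllPairs using (allPairs?)
open import Data.Vec.Relation.Unary.Unique.Propositional using (Unique)
open import Function.Base using (_∘_)
open import Function.Bundles using (_⇔_)
open import Level using (0ℓ)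
open import Relation.Binary.Core using (Rel)
open import Relation.Binary.Definitions using (Decidable; Symmetric; Irreflexive)
open import Relation.Binary.PropositionalEquality
  using (_≡_; _≢_; refl; sym; trans; cong; cong₂; subst; module ≡-Reasoning)
open import Relation.Nullary using (Dec; yes; no; contradiction; ¬?)
open import Relation.Nullary.Decidable using (map′; from-no; _×-dec_; _⊎-dec_)

------------------------------------------------------------------------
-- Real numbers, as Cauchy sequences of rationals

record ℝ : Set where
  constructor mkℝ
  field
    seq    : ℕ → ℚ
    cauchy : ∀ ε → 0ℚ ℚ.< ε →
             ∃ λ N → ∀ i j → N ≤ i → N ≤ j → ℚ.∣ seq i ℚ.- seq j ∣ ℚ.≤ ε

open ℝ public

p-q+q : ∀ p q → (p ℚ.- q) ℚ.+ q ≡ p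
p-q+q p q = trans (ℚ.+-assoc p (ℚ.- q) q)
  (trans (cong (p ℚ.+_) (ℚ.+-inverseˡ q)) (ℚ.+-identityʳ p))

telescope : ∀ p q r → p ℚ.- r ≡ (p ℚ.- q) ℚ.+ (q ℚ.- r)
telescope p q r = sym (trans (sym (ℚ.+-assoc (p ℚ.- q) q (ℚ.- r)))
                             (cong (ℚ._- r) (p-q+q p q)))

+-rearrange : ∀ a b c d → (a ℚ.+ b) ℚ.- (c ℚ.+ d) ≡ (a ℚ.- c) ℚ.+ (b ℚ.- d)
+-rearrange a b c d = trans (cong ((a ℚ.+ b) ℚ.+_) (ℚ.neg-distrib-+ c d))
                            (interchange a b (ℚ.- c) (ℚ.- d))
  where
  open CommutativeSemigroupProperties
    (Algebra.CommutativeMonoid.commutativeSemigroup ℚ.+-0-commutativeMonoid)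
    using (interchange)

*-distribˡ-- : ∀ a b c → a ℚ.* (b ℚ.- c) ≡ a ℚ.* b ℚ.- a ℚ.* c
*-distribˡ-- a b c = trans (ℚ.*-distribˡ-+ a b (ℚ.- c))
                           (cong (a ℚ.* b ℚ.+_) (sym (ℚ.neg-distribʳ-* a c)))

*-rearrange : ∀ a b c d →
  (a ℚ.* b) ℚ.- (c ℚ.* d) ≡ (a ℚ.* (b ℚ.- d)) ℚ.+ (d ℚ.* (a ℚ.- c))
*-rearrange a b c d = trans (telescope (a ℚ.* b) (a ℚ.* d) (c ℚ.* d))
  (sym (cong₂ ℚ._+_ (*-distribˡ-- a b d)
    (trans (*-distribˡ-- d a c) (cong₂ ℚ._-_ (ℚ.*-comm d a) (ℚ.*-comm d c)))))

½ε>0 : ∀ {ε} → 0ℚ ℚ.< ε → 0ℚ ℚ.< ½ ℚ.* ε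
½ε>0 {ε} ε>0 = ℚ.positive⁻¹ (½ ℚ.* ε) {{ℚ.pos*pos⇒pos ½ ε {{ℚ.positive ε>0}}}}

½ε+½ε : ∀ ε → ½ ℚ.* ε ℚ.+ ½ ℚ.* ε ≡ ε
½ε+½ε ε = trans (sym (ℚ.*-distribʳ-+ ε ½ ½)) (ℚ.*-identityˡ ε)

triangle : ∀ {p q a b} r → r ≡ p ℚ.+ q →
           ℚ.∣ p ∣ ℚ.≤ a → ℚ.∣ q ∣ ℚ.≤ b → ℚ.∣ r ∣ ℚ.≤ a ℚ.+ b
triangle {p} {q} _ refl p≤a q≤b =
  ℚ.≤-trans (ℚ.∣p+q∣≤∣p∣+∣q∣ p q) (ℚ.+-mono-≤ p≤a q≤b)

∣*∣-mono : ∀ {p q a b} → 0ℚ ℚ.< a → ℚ.∣ p ∣ ℚ.≤ a → ℚ.∣ q ∣ ℚ.≤ b →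
           ℚ.∣ p ℚ.* q ∣ ℚ.≤ a ℚ.* b
∣*∣-mono {p} {q} {a} {b} a>0 p≤a q≤b = begin
  ℚ.∣ p ℚ.* q ∣          ≡⟨ ℚ.∣p*q∣≡∣p∣*∣q∣ p q ⟩
  ℚ.∣ p ∣ ℚ.* ℚ.∣ q ∣    ≤⟨ ℚ.*-monoʳ-≤-nonNeg ℚ.∣ q ∣ {{ℚ.∣-∣-nonNeg q}} p≤a ⟩
  a ℚ.* ℚ.∣ q ∣          ≤⟨ ℚ.*-monoˡ-≤-nonNeg a {{ℚ.nonNegative (ℚ.<⇒≤ a>0)}} q≤b ⟩
  a ℚ.* b                ∎
  where open ℚ.≤-Reasoning

bounded : ∀ x → ∃₂ λ B N → 0ℚ ℚ.< B × (∀ i → N ≤ i → ℚ.∣ seq x i ∣ ℚ.≤ B)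
bounded x with cauchy x 1ℚ (ℚ.positive⁻¹ 1ℚ)
... | N , close = 1ℚ ℚ.+ ℚ.∣ seq x N ∣ , N ,
  ℚ.positive⁻¹ _ {{ℚ.pos+nonNeg⇒pos 1ℚ ℚ.∣ seq x N ∣ {{ℚ.∣-∣-nonNeg (seq x N)}}}} ,
  λ i N≤i → triangle (seq x i) (sym (p-q+q (seq x i) (seq x N)))
              (close i N N≤i ℕ.≤-refl) ℚ.≤-refl

rescale : ∀ {B ε} → 0ℚ ℚ.< B → 0ℚ ℚ.< ε → ∃ λ δ → 0ℚ ℚ.< δ × B ℚ.* δ ≡ ε
rescale {B} {ε} B>0 ε>0 = B⁻¹ ℚ.* ε ,
  ℚ.positive⁻¹ _ {{ℚ.pos*pos⇒pos B⁻¹ {{ℚ.1/pos⇒pos B}} ε {{ℚ.positive ε>0}}}} ,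
  (begin
    B ℚ.* (B⁻¹ ℚ.* ε)  ≡⟨ ℚ.*-assoc B B⁻¹ ε ⟨
    B ℚ.* B⁻¹ ℚ.* ε    ≡⟨ cong (ℚ._* ε) (ℚ.*-inverseʳ B) ⟩
    1ℚ ℚ.* ε           ≡⟨ ℚ.*-identityˡ ε ⟩
    ε                  ∎)
  where
  open ≡-Reasoning
  instance
    B-pos : ℚ.Positive B
    B-pos = ℚ.positive B>0
    B-nonZero : ℚ.NonZero B
    B-nonZero = ℚ.pos⇒nonZero B
  B⁻¹ = ℚ.1/ B

fromℚ : ℚ → ℝ
fromℚ p .seq    _     = p
fromℚ p .cauchy ε ε>0 = 0 , λ _ _ _ _ →
  subst (ℚ._≤ ε) (cong ℚ.∣_∣ (sym (ℚ.+-inverseʳ p))) (ℚ.<⇒≤ ε>0)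

0ℝ 1ℝ : ℝ
0ℝ = fromℚ 0ℚ
1ℝ = fromℚ 1ℚ

infixl 6 _+ℝ_ _-ℝ_
infixl 7 _*ℝ_
infix  8 -ℝ_
infix  4 _≤ℝ_

_+ℝ_ : ℝ → ℝ → ℝ
(x +ℝ y) .seq i = seq x i ℚ.+ seq y i
(x +ℝ y) .cauchy ε ε>0
  with cauchy x (½ ℚ.* ε) (½ε>0 ε>0) | cauchy y (½ ℚ.* ε) (½ε>0 ε>0)
... | M , closeˣ | N , closeʸ = M ℕ.⊔ N , λ i j i≥ j≥ →
  subst (_ ℚ.≤_) (½ε+½ε ε)
    (triangle _ (+-rearrange (seq x i) (seq y i) (seq x j) (seq y j))
      (closeˣ i j (ℕ.m⊔n≤o⇒m≤o M N i≥) (ℕ.m⊔n≤o⇒m≤o M N j≥))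
      (closeʸ i j (ℕ.m⊔n≤o⇒n≤o M N i≥) (ℕ.m⊔n≤o⇒n≤o M N j≥)))

-ℝ_ : ℝ → ℝ
(-ℝ x) .seq i = ℚ.- seq x i
(-ℝ x) .cauchy ε ε>0 with cauchy x ε ε>0
... | N , close = N , λ i j i≥ j≥ →
  subst (ℚ._≤ ε)
    (trans (sym (ℚ.∣-p∣≡∣p∣ (seq x i ℚ.- seq x j)))
           (cong ℚ.∣_∣ (ℚ.neg-distrib-+ (seq x i) (ℚ.- seq x j))))
    (close i j i≥ j≥)

_-ℝ_ : ℝ → ℝ → ℝ
x -ℝ y = x +ℝ (-ℝ y)

_*ℝ_ : ℝ → ℝ → ℝ
(x *ℝ y) .seq i = seq x i ℚ.* seq y i
(x *ℝ y) .cauchy ε ε>0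
  with bounded x | bounded y
... | B , K , B>0 , x≤B | C , L , C>0 , y≤C
  with rescale B>0 (½ε>0 ε>0) | rescale C>0 (½ε>0 ε>0)
... | δ , δ>0 , Bδ≡ | η , η>0 , Cη≡
  with cauchy y δ δ>0 | cauchy x η η>0
... | M , closeʸ | N , closeˣ = (K ℕ.⊔ L) ℕ.⊔ (M ℕ.⊔ N) , λ i j i≥ j≥ →
  subst (_ ℚ.≤_) (trans (cong₂ ℚ._+_ Bδ≡ Cη≡) (½ε+½ε ε))
    (triangle _ (*-rearrange (seq x i) (seq y i) (seq x j) (seq y j))
      (∣*∣-mono B>0 (x≤B i (≥K i≥)) (closeʸ i j (≥M i≥) (≥M j≥)))
      (∣*∣-mono C>0 (y≤C j (≥L j≥)) (closeˣ i j (≥N i≥) (≥N j≥))))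
  where
  ≥K : ∀ {i} → (K ℕ.⊔ L) ℕ.⊔ (M ℕ.⊔ N) ≤ i → K ≤ i
  ≥K = ℕ.m⊔n≤o⇒m≤o K L ∘ ℕ.m⊔n≤o⇒m≤o (K ℕ.⊔ L) (M ℕ.⊔ N)
  ≥L : ∀ {i} → (K ℕ.⊔ L) ℕ.⊔ (M ℕ.⊔ N) ≤ i → L ≤ i
  ≥L = ℕ.m⊔n≤o⇒n≤o K L ∘ ℕ.m⊔n≤o⇒m≤o (K ℕ.⊔ L) (M ℕ.⊔ N)
  ≥M : ∀ {i} → (K ℕ.⊔ L) ℕ.⊔ (M ℕ.⊔ N) ≤ i → M ≤ i
  ≥M = ℕ.m⊔n≤o⇒m≤o M N ∘ ℕ.m⊔n≤o⇒n≤o (K ℕ.⊔ L) (M ℕ.⊔ N)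
  ≥N : ∀ {i} → (K ℕ.⊔ L) ℕ.⊔ (M ℕ.⊔ N) ≤ i → N ≤ i
  ≥N = ℕ.m⊔n≤o⇒n≤o M N ∘ ℕ.m⊔n≤o⇒n≤o (K ℕ.⊔ L) (M ℕ.⊔ N)

-- A comparison of limits: termwise comparison would not respect equality
-- of reals.
_≤ℝ_ : ℝ → ℝ → Set
x ≤ℝ y = ∀ ε → 0ℚ ℚ.< ε → ∃ λ N → ∀ i → N ≤ i → seq x i ℚ.≤ seq y i ℚ.+ ε

sumℝ : List ℝ → ℝ
sumℝ = foldr _+ℝ_ 0ℝ

------------------------------------------------------------------------
-- Graphs

record Graph (n : ℕ) : Set₁ where
  field
    Adj     : Rel (Fin n) 0ℓ
    Adj?    : Decidable Adj
    symm    : Symmetric Adj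
    irrefl  : Irreflexive _≡_ Adj

-- Each edge is listed once, with its smaller endpoint first.
edges : ∀ {n} → Graph n → List (Fin n × Fin n)
edges {n} G =
  filter (λ (u , v) → (u Fin.<? v) ×-dec Graph.Adj? G u v)
         (cartesianProduct (allFin n) (allFin n))

edgeCount : ∀ {n} → Graph n → ℕ
edgeCount G = length (edges G)

-- The spanning subgraph of G whose edges are those with index in S.
module _ {n} (G : Graph n) (S : Subset (edgeCount G)) where

  SubAdj : Rel (Fin n) 0ℓ
  SubAdj u v = ∃ λ i → i ∈ S ×
    (List.lookup (edges G) i ≡ (u , v) ⊎ List.lookup (edges G) i ≡ (v , u))

  _≟ᵉ_ : Decidable {A = Fin n × Fin n} _≡_
  _≟ᵉ_ = ≡-dec Fin._≟_ Fin._≟_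

  loopless : ∀ {u} i → List.lookup (edges G) i ≢ (u , u)
  loopless i eq = Fin.<-irrefl (trans (cong proj₁ eq) (sym (cong proj₂ eq)))
    (proj₁ (proj₂ (∈-filter⁻ (λ (u , v) → (u Fin.<? v) ×-dec Graph.Adj? G u v)
      {xs = cartesianProduct (allFin n) (allFin n)} (∈-lookup {xs = edges G} i))))

  spanning : Graph n
  spanning .Graph.Adj                 = SubAdj
  spanning .Graph.Adj? u v            = Fin.any? λ i →
    (i ∈? S) ×-dec ((List.lookup (edges G) i ≟ᵉ (u , v)) ⊎-dec
                    (List.lookup (edges G) i ≟ᵉ (v , u)))
  spanning .Graph.symm (i , i∈S , eq) = i , i∈S , swap eq
  spanning .Graph.irrefl refl (i , _ , inj₁ eq) = loopless i eq
  spanning .Graph.irrefl refl (i , _ , inj₂ eq) = loopless i eq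

-- A path of length l is given by its l + 1 vertices.
record IsPath {n} (G : Graph n) (u v : Fin n) {l} (p : Vec (Fin n) (suc l)) : Set where
  constructor mkPath
  field
    starts   : head p ≡ u
    ends     : last p ≡ v
    steps    : Linked (Graph.Adj G) p
    distinct : Unique p

isPath? : ∀ {n} (G : Graph n) u v {l} (p : Vec (Fin n) (suc l)) → Dec (IsPath G u v p)
isPath? G u v p = map′ (λ (a , b , c , d) → mkPath a b c d)
                       (λ (mkPath a b c d) → a , b , c , d)
  ((head p Fin.≟ u) ×-dec (last p Fin.≟ v) ×-dec
   linked? (Graph.Adj? G) p ×-dec allPairs? (λ x y → ¬? (x Fin.≟ y)) p)

anyVec? : ∀ {n} l {P : Vec (Fin n) l → Set} → (∀ p → Dec (P p)) → Dec (∃ P)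
anyVec? zero    P? = map′ (λ P[] → [] , P[]) (λ { ([] , P[]) → P[] }) (P? [])
anyVec? (suc l) P? =
  map′ (λ (x , p , Px∷p) → x ∷ p , Px∷p) (λ { (x ∷ p , Px∷p) → x , p , Px∷p })
       (Fin.any? λ x → anyVec? l λ p → P? (x ∷ p))

------------------------------------------------------------------------
-- Two-terminal graphs

record TwoTerminalGraph (n : ℕ) : Set₁ where
  field
    graph : Graph n
    s t   : Fin n
    s≢t   : s ≢ t

  open Graph graph public

  IsTerminal : Fin n → Set
  IsTerminal v = v ≡ s ⊎ v ≡ t

open TwoTerminalGraph using (graph)

record _≅_ {n} (G H : TwoTerminalGraph n) : Set where
  private
    module G = TwoTerminalGraph G
    module H = TwoTerminalGraph H
  field
    bij       : Permutation n n
    adj       : ∀ u v → G.Adj u v ⇔ H.Adj (bij ⟨$⟩ʳ u) (bij ⟨$⟩ʳ v)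
    terminals : ∀ v → G.IsTerminal v ⇔ H.IsTerminal (bij ⟨$⟩ʳ v)

------------------------------------------------------------------------
-- Reliability

module _ (d : ℕ) {n} (G : TwoTerminalGraph n) where
  open TwoTerminalGraph G using (s; t)

  IsPathset : Subset (edgeCount (graph G)) → Set
  IsPathset S = ∃ λ l → l ≤ d × ∃ λ (p : Vec (Fin n) (suc l)) →
    IsPath (spanning (graph G) S) s t p

  isPathset? : ∀ S → Dec (IsPathset S)
  isPathset? S = map′ (λ (l , l<1+d , p) → l , s≤s⁻¹ l<1+d , p)
                      (λ (l , l≤d , p) → l , s≤s l≤d , p)
    (ℕ.anyUpTo? (λ l → anyVec? (suc l) (isPath? (spanning (graph G) S) s t)) (suc d))

allSubsets : ∀ m → List (Subset m)
allSubsets zero    = [] ∷ []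
allSubsets (suc m) = map (inside ∷_) (allSubsets m) ++ map (outside ∷_) (allSubsets m)

-- The probability that S is exactly the set of surviving edges, when each
-- edge is deleted independently with probability ρ.
survival : ℝ → ∀ {m} → Subset m → ℝ
survival ρ []            = 1ℝ
survival ρ (inside  ∷ S) = (1ℝ -ℝ ρ) *ℝ survival ρ S
survival ρ (outside ∷ S) = ρ *ℝ survival ρ S

reliability : ℕ → ∀ {n} → TwoTerminalGraph n → ℝ → ℝ
reliability d G ρ =
  sumℝ (map (survival ρ) (filter (isPathset? d G) (allSubsets (edgeCount (graph G)))))

-- G ranges over all two-terminal graphs on Fin n with m edges rather than
-- over representatives of isomorphism classes.
_∈T[_] : ∀ {n} → TwoTerminalGraph n → ℕ → Set
G ∈T[ m ] = edgeCount (graph G) ≡ m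

IsUMRTTG : (d m : ℕ) → ∀ {n} → TwoTerminalGraph n → Set₁
IsUMRTTG d m {n} G = G ∈T[ m ] ×
  (∀ (H : TwoTerminalGraph n) → H ∈T[ m ] →
   ∀ ρ → 0ℝ ≤ℝ ρ → ρ ≤ℝ 1ℝ → reliability d H ρ ≤ℝ reliability d G ρ)

------------------------------------------------------------------------
-- The graphs A_{k,r} and H_{n,m}

-- Vertices are numbered from 1: s is 1, t is 2, and v_i is i.
AEdge : (r : ℕ) → Rel ℕ 0ℓ
AEdge r a b = (a ≡ 1 × b ≡ 2)
            ⊎ (a ≡ 1 × 3 ≤ b)
            ⊎ (a ≡ 2 × 3 ≤ b)
            ⊎ (a ≡ 3 × 3 ℕ.+ 1 ≤ b × b ≤ 3 ℕ.+ r)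

AEdge? : ∀ r → Decidable (AEdge r)
AEdge? r a b = ((a ℕ.≟ 1) ×-dec (b ℕ.≟ 2))
          ⊎-dec ((a ℕ.≟ 1) ×-dec (3 ℕ.≤? b))
          ⊎-dec ((a ℕ.≟ 2) ×-dec (3 ℕ.≤? b))
          ⊎-dec ((a ℕ.≟ 3) ×-dec (3 ℕ.+ 1 ℕ.≤? b) ×-dec (b ℕ.≤? 3 ℕ.+ r))

AEdge-< : ∀ {r a b} → AEdge r a b → a ℕ.< b
AEdge-< (inj₁ (refl , refl))                    = ℕ.≤-refl
AEdge-< (inj₂ (inj₁ (refl , 3≤b)))              = ℕ.<⇒≤ 3≤b
AEdge-< (inj₂ (inj₂ (inj₁ (refl , 3≤b))))       = 3≤b
AEdge-< (inj₂ (inj₂ (inj₂ (refl , 4≤b , _))))   = 4≤b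

A : (k r : ℕ) → 3 ≤ k → r ≤ k ∸ 3 → TwoTerminalGraph k
A k r 3≤k r≤k-3 = record
  { graph = record
    { Adj    = Adj
    ; Adj?   = λ u v → AEdge? r (label u) (label v) ⊎-dec AEdge? r (label v) (label u)
    ; symm   = swap
    ; irrefl = λ { refl (inj₁ e) → ℕ.<-irrefl refl (AEdge-< e)
                 ; refl (inj₂ e) → ℕ.<-irrefl refl (AEdge-< e) }
    }
  ; s   = fromℕ< 1≤k
  ; t   = fromℕ< 2≤k
  ; s≢t = λ s≡t → contradiction (Fin.fromℕ<-injective 0 1 1≤k 2≤k s≡t) λ ()
  }
  where
  1≤k : 0 ℕ.< k
  1≤k = ℕ.≤-trans (s≤s z≤n) 3≤k
  2≤k : 1 ℕ.< k
  2≤k = ℕ.≤-trans (s≤s (s≤s z≤n)) 3≤k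
  label : Fin k → ℕ
  label u = suc (toℕ u)
  Adj : Rel (Fin k) 0ℓ
  Adj u v = AEdge r (label u) (label v) ⊎ AEdge r (label v) (label u)

addIsolated : ∀ {k n} → k ≤ n → TwoTerminalGraph k → TwoTerminalGraph n
addIsolated {k} {n} k≤n G = record
  { graph = record
    { Adj    = λ u v → ∃₂ λ a b → ι a ≡ u × ι b ≡ v × G.Adj a b
    ; Adj?   = λ u v → Fin.any? λ a → Fin.any? λ b →
                 (ι a Fin.≟ u) ×-dec (ι b Fin.≟ v) ×-dec G.Adj? a b
    ; symm   = λ (a , b , a≡u , b≡v , ab) → b , a , b≡v , a≡u , G.symm ab
    ; irrefl = λ { refl (a , b , a≡u , b≡u , ab) →
                   G.irrefl (ι-injective (trans a≡u (sym b≡u))) ab }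
    }
  ; s   = ι G.s
  ; t   = ι G.t
  ; s≢t = λ s≡t → G.s≢t (ι-injective s≡t)
  }
  where
  module G = TwoTerminalGraph G
  ι : Fin k → Fin n
  ι a = inject≤ a k≤n
  ι-injective : ∀ {a b} → ι a ≡ ι b → a ≡ b
  ι-injective {a} {b} = Fin.inject≤-injective k≤n k≤n a b

module _ (n m : ℕ) (5≤m : 5 ≤ m) (m≤2n-3 : m ≤ 2 ℕ.* n ∸ 3) where

  m+3≤2n : m ℕ.+ 3 ≤ 2 ℕ.* n
  m+3≤2n = subst (m ℕ.+ 3 ≤_) (ℕ.m∸n+n≡m 3≤2n) (ℕ.+-monoˡ-≤ 3 m≤2n-3)
    where
    3≤2n : 3 ≤ 2 ℕ.* n
    3≤2n = ℕ.≤-trans (ℕ.≤-trans (ℕ.m≤m+n 3 2) 5≤m)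
                     (ℕ.≤-trans m≤2n-3 (ℕ.m∸n≤m (2 ℕ.* n) 3))

  even-k≥3 : 3 ≤ (m ℕ.+ 2) / 2
  even-k≥3 = /-monoˡ-≤ {6} 2 (ℕ.≤-trans (ℕ.n≤1+n 6) (ℕ.+-monoˡ-≤ 2 5≤m))

  odd-k≥3 : 3 ≤ (m ℕ.+ 3) / 2
  odd-k≥3 = /-monoˡ-≤ {6} 2 (ℕ.≤-trans (ℕ.m≤m+n 6 2) (ℕ.+-monoˡ-≤ 3 5≤m))

  odd-k≤n : (m ℕ.+ 3) / 2 ≤ n
  odd-k≤n = ℕ.≤-trans (/-monoˡ-≤ 2 m+3≤2n)
    (ℕ.≤-reflexive (trans (cong (_/ 2) (ℕ.*-comm 2 n)) (m*n/n≡m n 2)))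

  even-k≤n : (m ℕ.+ 2) / 2 ≤ n
  even-k≤n = ℕ.≤-trans (/-monoˡ-≤ 2 (ℕ.+-monoʳ-≤ m (ℕ.n≤1+n 2))) odd-k≤n

  even-r≤ : 2 ∣ m → 1 ≤ (m ℕ.+ 2) / 2 ∸ 3
  even-r≤ 2∣m = ℕ.∸-monoˡ-≤ 3 (/-monoˡ-≤ {8} 2 (ℕ.+-monoˡ-≤ 2 6≤m))
    where
    6≤m : 6 ≤ m
    6≤m = ℕ.≤∧≢⇒< 5≤m λ { refl → from-no (2 ∣? 5) 2∣m }

  H : TwoTerminalGraph n
  H with 2 ∣? m
  ... | yes 2∣m = addIsolated even-k≤n (A ((m ℕ.+ 2) / 2) 1 even-k≥3 (even-r≤ 2∣m))
  ... | no  _   = addIsolated odd-k≤n  (A ((m ℕ.+ 3) / 2) 0 odd-k≥3 z≤n)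

{-# OPTIONS --safe #-}

-- Condition on the surviving edges at the terminals: a vertex joined to s only, to
-- t only, or to neither gets the spin src, snk or off, and a vertex joined to both
-- creates a path of length 2. There is then no path of length at most 3 exactly
-- when st fails and no surviving edge joins vertices of opposite spins, so the
-- failure probability is ρ^[st ∈ G] Z, where Z is the partition function of a
-- three-state spin model. For a graph with M edges besides st we have Z ≥ F M: a
-- vertex adjacent to only one terminal can be removed with its d further edges at
-- the cost of a factor ρ + p q^d ≥ F (d + 1); once there is none, src and snk play
-- symmetric roles, and by Griffiths' inequality removing an edge costs at most a
-- factor g, where F (M + 1) ≤ g F M. The graph H attains ρ F (m - 1). For ρ = ½
-- equality forces the edge st, no vertex adjacent to only one terminal, and at most
-- one further edge (strictly, ρ + p q^d > F (d + 1) and q < g²).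

module Submission where

-- The constant `g` comes from two independent vertices joined to both terminals. Given that neither
-- creates a path of length 2, the spins src, snk, off have odds p : p : ρ with total 1 + p, so the
-- two spins are opposite with probability 2p²/(1+p)², and an edge between the vertices must then
-- fail, at the price of a factor ρ = 1 - p. The order of the removals is forced. Griffiths'
-- inequality needs the symmetry between src and snk, and without it `g` is not a lower bound: an
-- edge between a source-only and a sink-only vertex alone multiplies Z by 1 - p³, which is less
-- than `g` once p exceeds √2 - 1. One-sided vertices are therefore removed whole, by an argument
-- that uses no symmetry, only that switching a spin off never decreases a product of links. All
-- inequalities are proved for rational ρ. A real ρ is reached because the reliability is a
-- polynomial in ρ, hence Lipschitz near [0,1]. For uniqueness one value of ρ is enough, and at ρ =
-- ½ the strict base cases are comparisons of explicit rationals.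

open import Algebra.Structures using (IsCommutativeMonoid)
open import Data.Bool.Base using (Bool; true; false; if_then_else_; not; _∧_; _∨_)
import Data.Bool.Properties as Bool
open import Data.Empty using (⊥)
open import Data.Fin.Base as Fin using (Fin; zero; suc; punchIn)
open import Data.Fin.Permutation as Permutation using (Permutation; _⟨$⟩ʳ_)
import Data.Fin.Properties as Fin
open import Data.Fin.Subset using (Subset; inside; outside)
open import Data.List.Base as List
  using (List; []; _∷_; length; foldr; map; filter; _++_; allFin; cartesianProduct)
open import Data.List.Membership.Propositional using (_∈_)
open import Data.List.Membership.Propositional.Properties
  using (∈-lookup; ∈-filter⁺; ∈-filter⁻; ∈-cartesianProduct⁺; ∈-allFin; ∈-++⁺ˡ; ∈-++⁺ʳ; ∈-++⁻; ∈-map⁺; ∈-map⁻)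
open import Data.List.Membership.Propositional.Properties.WithK using (unique∧set⇒bag)
open import Data.List.Relation.Binary.BagAndSetEquality using (∼bag⇒↭)
open import Data.List.Relation.Binary.Permutation.Propositional as ↭ using (_↭_)
open import Data.List.Relation.Unary.All as All using (All; []; _∷_)
open import Data.List.Relation.Unary.All.Properties using (all-filter)
open import Data.List.Relation.Unary.AllPairs using ([]; _∷_)
open import Data.List.Relation.Unary.Any using (here; there; index)
open import Data.List.Relation.Unary.Any.Properties using (lookup-index)
open import Data.List.Relation.Unary.Unique.Propositional using (Unique)
import Data.List.Relation.Unary.Unique.Propositional.Properties as Unique
open import Data.Nat.Base as ℕ using (ℕ; zero; suc)
open import Data.Nat.Divisibility using (_∣_; _∣?_; divides)
open import Data.Nat.DivMod using (_/_; _%_; m≡m%n+[m/n]*n; m*n/n≡m; m%n<n)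
import Data.Nat.Properties as ℕ
open import Algebra.Properties.CommutativeMonoid.Sum ℕ.+-0-commutativeMonoid
  using (sum; sum-remove; sum-cong-≗; ∑-distrib-+)
open import Data.Product.Base using (∃; ∃₂; _×_; _,_; proj₁; proj₂)
open import Data.Rational.Base hiding (_/_)
open import Data.Rational.Properties hiding (_≟_)
import Data.Rational.Properties as ℚ
open import Data.Sum.Base as Sum using (_⊎_; inj₁; inj₂)
open import Data.Vec.Base as Vec using (Vec; []; _∷_; lookup; _[_]≔_; _[_]%=_)
import Data.Vec.Properties as Vec
import Data.Vec.Relation.Unary.All as VecAll
open import Data.Vec.Relation.Unary.AllPairs using ([]; _∷_)
open import Data.Vec.Relation.Unary.Linked using ([-]; _∷_)
open import Function.Base using (_∘_)
open import Function.Bundles using (mk⇔)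
open import Relation.Binary.Definitions using (DecidableEquality; tri<; tri≈; tri>)
open import Relation.Binary.PropositionalEquality hiding (J)
open import Relation.Nullary using (Dec; yes; no; does; ¬_; contradiction)
open import Relation.Nullary.Decidable as Dec
  using (dec⇒maybe; dec-true; dec-false; from-yes; _⊎-dec_; _×-dec_; ¬?)
open import Tactic.RingSolver using (solve-∀)
open import Tactic.RingSolver.Core.AlmostCommutativeRing using (AlmostCommutativeRing; fromCommutativeRing)

open import Defs

-- Inequalities between rational numbers.

ring : AlmostCommutativeRing _ _
ring = fromCommutativeRing +-*-commutativeRing λ x → dec⇒maybe (0ℚ ℚ.≟ x)

2ℚ : ℚ
2ℚ = 1ℚ + 1ℚ

*-exchange : ∀ x y z → x * (y * z) ≡ y * (x * z)
*-exchange = solve-∀ ring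

+-nonneg : ∀ {a b} → 0ℚ ≤ a → 0ℚ ≤ b → 0ℚ ≤ a + b
+-nonneg = +-mono-≤

*-nonneg : ∀ {a b} → 0ℚ ≤ a → 0ℚ ≤ b → 0ℚ ≤ a * b
*-nonneg {a} {b} 0≤a 0≤b =
  subst (_≤ a * b) (*-zeroʳ a) (*-monoˡ-≤-nonNeg a {{nonNegative 0≤a}} 0≤b)

*-pos : ∀ {a b} → 0ℚ < a → 0ℚ < b → 0ℚ < a * b
*-pos {a} {b} 0<a 0<b =
  subst (_< a * b) (*-zeroʳ a) (*-monoʳ-<-pos a {{positive 0<a}} 0<b)

*-mono-≤ : ∀ {a b c d} → 0ℚ ≤ a → 0ℚ ≤ c → a ≤ b → c ≤ d → a * c ≤ b * d
*-mono-≤ {a} {b} {c} {d} 0≤a 0≤c a≤b c≤d = ≤-trans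
  (*-monoˡ-≤-nonNeg a {{nonNegative 0≤a}} c≤d)
  (*-monoʳ-≤-nonNeg d {{nonNegative (≤-trans 0≤c c≤d)}} a≤b)

*-monoˡ : ∀ {a b c} → 0ℚ ≤ c → a ≤ b → c * a ≤ c * b
*-monoˡ {c = c} 0≤c = *-monoˡ-≤-nonNeg c {{nonNegative 0≤c}}

*-monoʳ : ∀ {a b c} → 0ℚ ≤ c → a ≤ b → a * c ≤ b * c
*-monoʳ {c = c} 0≤c = *-monoʳ-≤-nonNeg c {{nonNegative 0≤c}}

≤-of-sum : ∀ {a b} c → 0ℚ ≤ c → b ≡ a + c → a ≤ b
≤-of-sum {a} c 0≤c refl = subst (_≤ a + c) (+-identityʳ a) (+-monoʳ-≤ a 0≤c)

0≤- : ∀ {a b} → a ≤ b → 0ℚ ≤ b - a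
0≤- {a} {b} a≤b = subst (_≤ b - a) (+-inverseʳ a) (+-monoˡ-≤ (- a) a≤b)

≤-of-diff : ∀ {a b} → 0ℚ ≤ b - a → a ≤ b
≤-of-diff {a} {b} h = ≤-of-sum (b - a) h (identity a b)
  where
  identity : ∀ a b → b ≡ a + (b - a)
  identity = solve-∀ ring

-- The relation w₁ ≡ w₂ lets the certificate y be found modulo an equation that
-- the ring solver does not know.
≤-modulo : ∀ {a b c y z w₁ w₂} → 0ℚ < c → w₁ ≡ w₂ → 0ℚ ≤ y →
           c * (b - a) ≡ y + z * (w₁ - w₂) → a ≤ b
≤-modulo {a} {b} {c} {y} {z} {w₁} 0<c refl 0≤y eq = ≤-of-diff
  (*-cancelˡ-≤-pos c {{positive 0<c}} (begin
    c * 0ℚ             ≡⟨ *-zeroʳ c ⟩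
    0ℚ                 ≤⟨ 0≤y ⟩
    y                  ≡⟨ identity y z w₁ ⟩
    y + z * (w₁ - w₁)  ≡⟨ eq ⟨
    c * (b - a)        ∎))
  where
  open ≤-Reasoning
  identity : ∀ y z w → y ≡ y + z * (w - w)
  identity = solve-∀ ring

-- F M is the failure probability, given that st fails, of the extremal graph with
-- M ≥ 4 edges besides st: each path of length 2 contributes q, and a further edge
-- between the middles of two such paths contributes g = 1 - 2p³/(1+p)².
module Bound (ρ : ℚ) (0≤ρ : 0ℚ ≤ ρ) (ρ≤1 : ρ ≤ 1ℚ) where

  p q c η g : ℚ
  p = 1ℚ - ρ
  q = ρ * (1ℚ + p)
  c = (1ℚ + p) * (1ℚ + p)

  0≤p : 0ℚ ≤ p
  0≤p = 0≤- ρ≤1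

  0<1 : 0ℚ < 1ℚ
  0<1 = positive⁻¹ 1ℚ

  0≤1 : 0ℚ ≤ 1ℚ
  0≤1 = <⇒≤ 0<1

  0<1+p : 0ℚ < 1ℚ + p
  0<1+p = +-mono-<-≤ 0<1 0≤p

  0<c : 0ℚ < c
  0<c = *-pos 0<1+p 0<1+p

  instance
    c≢0 : NonZero c
    c≢0 = pos⇒nonZero c {{positive 0<c}}

  η = 2ℚ * p * p * p * 1/ c
  g = 1ℚ - η

  -- The reciprocal enters the later identities only through this equation; the ring solver is given
  -- `η` as a variable.
  cη : c * η ≡ 2ℚ * p * p * p
  cη = begin
    c * (2ℚ * p * p * p * 1/ c)    ≡⟨ rearrange c (1/ c) p ⟩
    (c * 1/ c) * (2ℚ * p * p * p)  ≡⟨ cong (_* (2ℚ * p * p * p)) (*-inverseʳ c) ⟩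
    1ℚ * (2ℚ * p * p * p)          ≡⟨ *-identityˡ _ ⟩
    2ℚ * p * p * p                 ∎
    where
    open ≡-Reasoning
    rearrange : ∀ c r p → c * (2ℚ * p * p * p * r) ≡ (c * r) * (2ℚ * p * p * p)
    rearrange = solve-∀ ring

  0≤q : 0ℚ ≤ q
  0≤q = *-nonneg 0≤ρ (<⇒≤ 0<1+p)

  q≤1 : q ≤ 1ℚ
  q≤1 = ≤-of-sum (p * p) (*-nonneg 0≤p 0≤p) (identity ρ)
    where
    identity : ∀ ρ → 1ℚ ≡ ρ * (1ℚ + (1ℚ - ρ)) + (1ℚ - ρ) * (1ℚ - ρ)
    identity = solve-∀ ring

  g≤1 : g ≤ 1ℚ
  g≤1 = ≤-modulo {z = 1ℚ} 0<c cη
    (*-nonneg (*-nonneg (*-nonneg (<⇒≤ (positive⁻¹ 2ℚ)) 0≤p) 0≤p) 0≤p) (identity p η)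
    where
    identity : ∀ p η → (1ℚ + p) * (1ℚ + p) * (1ℚ - (1ℚ - η)) ≡
               2ℚ * p * p * p + 1ℚ * ((1ℚ + p) * (1ℚ + p) * η - 2ℚ * p * p * p)
    identity = solve-∀ ring

  ρ≤g : ρ ≤ g
  ρ≤g = ≤-modulo {z = - 1ℚ} 0<c cη
    (*-nonneg 0≤p (+-nonneg (+-nonneg 0≤1 (*-nonneg 0≤p (*-nonneg 0≤ρ (<⇒≤ (positive⁻¹ 2ℚ))))) (*-nonneg 0≤p 0≤p)))
    (identity ρ η)
    where
    identity : ∀ ρ η → let p = 1ℚ - ρ in (1ℚ + p) * (1ℚ + p) * ((1ℚ - η) - ρ) ≡
               p * (1ℚ + p * (ρ * 2ℚ) + p * p) + - 1ℚ * ((1ℚ + p) * (1ℚ + p) * η - 2ℚ * p * p * p)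
    identity = solve-∀ ring

  -- Two edges between middle vertices are worth no more than one further path of length 2; this is
  -- why at most one such edge is optimal. As 1 - q = p², multiplying the difference by `c` and
  -- reducing modulo `cη` leaves cη² + (pρ)².
  q≤g*g : q ≤ g * g
  q≤g*g = ≤-modulo {z = - 2ℚ} 0<c cη
    (+-nonneg (*-nonneg (<⇒≤ 0<c) (*-nonneg 0≤η 0≤η)) (*-nonneg (*-nonneg 0≤p 0≤ρ) (*-nonneg 0≤p 0≤ρ)))
    (identity ρ η)
    where
    0≤η : 0ℚ ≤ η
    0≤η = subst (0ℚ ≤_) (double-complement η) (0≤- g≤1)
      where
      double-complement : ∀ x → 1ℚ - (1ℚ - x) ≡ x
      double-complement = solve-∀ ring
    identity : ∀ ρ η → let p = 1ℚ - ρ in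
      (1ℚ + p) * (1ℚ + p) * ((1ℚ - η) * (1ℚ - η) - ρ * (1ℚ + p)) ≡
      (1ℚ + p) * (1ℚ + p) * (η * η) + p * ρ * (p * ρ)
        + - 2ℚ * ((1ℚ + p) * (1ℚ + p) * η - 2ℚ * p * p * p)
    identity = solve-∀ ring

  0≤g : 0ℚ ≤ g
  0≤g = ≤-trans 0≤ρ ρ≤g

  ρ*g≤q : ρ * g ≤ q
  ρ*g≤q = *-monoˡ 0≤ρ (≤-trans g≤1 (≤-of-sum p 0≤p refl))

  F : ℕ → ℚ
  F zero          = 1ℚ
  F (suc zero)    = g
  F (suc (suc n)) = q * F n

  0≤F : ∀ n → 0ℚ ≤ F n
  0≤F zero          = 0≤1
  0≤F (suc zero)    = 0≤g
  0≤F (suc (suc n)) = *-nonneg 0≤q (0≤F n)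

  -- This disposes of graphs without the edge st: they have one more edge of the other kinds, and
  -- exchanging it for st does not increase the bound.
  ρ*F≤F : ∀ n → ρ * F n ≤ F (suc n)
  ρ*F≤F zero          = subst (_≤ g) (sym (*-identityʳ ρ)) ρ≤g
  ρ*F≤F (suc zero)    = subst (ρ * g ≤_) (sym (*-identityʳ q)) ρ*g≤q
  ρ*F≤F (suc (suc n)) = subst (_≤ q * F (suc n)) (*-exchange q ρ (F n)) (*-monoˡ 0≤q (ρ*F≤F n))

  F-suc : ∀ n → F (suc n) ≤ g * F n
  F-suc zero          = ≤-reflexive (sym (*-identityʳ g))
  F-suc (suc zero)    = subst (_≤ g * g) (sym (*-identityʳ q)) q≤g*g
  F-suc (suc (suc n)) = subst (q * F (suc n) ≤_) (*-exchange q g (F n)) (*-monoˡ 0≤q (F-suc n))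

  -- Removing a vertex bounds Z by a product, one factor for its edges and one for the rest; this
  -- returns to the total number of edges. Only two odd arguments lose anything, when two factors
  -- `g` are merged into `q`.
  F-+ : ∀ m n → F (m ℕ.+ n) ≤ F m * F n
  F-+ zero          n = ≤-reflexive (sym (*-identityˡ (F n)))
  F-+ (suc zero)    n = F-suc n
  F-+ (suc (suc m)) n = subst (q * F (m ℕ.+ n) ≤_) (sym (*-assoc q (F m) (F n)))
    (*-monoˡ 0≤q (F-+ m n))

  q^ : ℕ → ℚ
  q^ zero    = 1ℚ
  q^ (suc n) = q * q^ n

  0≤q^ : ∀ n → 0ℚ ≤ q^ n
  0≤q^ zero    = 0≤1
  0≤q^ (suc n) = *-nonneg 0≤q (0≤q^ n)

  q^≤1 : ∀ n → q^ n ≤ 1ℚ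
  q^≤1 zero    = ≤-refl
  q^≤1 (suc n) = *-mono-≤ 0≤q (0≤q^ n) q≤1 (q^≤1 n)

  -- The factor for removing a vertex adjacent to one terminal and with `d` further edges: with
  -- probability ρ its terminal edge fails and the vertex is off, and otherwise each further edge
  -- contributes at least `q`.
  φ : ℕ → ℚ
  φ d = ρ + p * q^ d

  p*q²≤ρ : p * (q * q) ≤ ρ
  p*q²≤ρ = ≤-of-sum {p * (q * q)} {ρ} (ρ * (ρ * ρ * (1ℚ + p) + p * p * (p * p)))
    (*-nonneg 0≤ρ (+-nonneg (*-nonneg (*-nonneg 0≤ρ 0≤ρ) (<⇒≤ 0<1+p))
                            (*-nonneg (*-nonneg 0≤p 0≤p) (*-nonneg 0≤p 0≤p))))
    (identity ρ)
    where
    identity : ∀ ρ → let p = 1ℚ - ρ; q = ρ * (1ℚ + p) in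
      ρ ≡ p * (q * q) + ρ * (ρ * ρ * (1ℚ + p) + p * p * (p * p))
    identity = solve-∀ ring

  -- The recursion of `F` advances by two at the price of `q`, so `φ` must not fall faster. Since 1
  -- - q = p², the difference of the two sides is p² times the amount by which ρ exceeds p times the
  -- power of `q` in the middle.
  q*φ≤φ : ∀ d → q * φ (suc d) ≤ φ (suc (suc (suc d)))
  q*φ≤φ d = ≤-of-sum (p * p * (ρ - p * (q * q) * q^ d))
    (*-nonneg (*-nonneg 0≤p 0≤p) (0≤- (begin
      p * (q * q) * q^ d  ≤⟨ *-mono-≤ (*-nonneg 0≤p (*-nonneg 0≤q 0≤q)) (0≤q^ d) p*q²≤ρ (q^≤1 d) ⟩
      ρ * 1ℚ              ≡⟨ *-identityʳ ρ ⟩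
      ρ                   ∎)))
    (identity ρ (q^ d))
    where
    open ≤-Reasoning
    identity : ∀ ρ x → let p = 1ℚ - ρ; q = ρ * (1ℚ + p) in
      ρ + p * (q * (q * (q * x))) ≡ q * (ρ + p * (q * x)) + p * p * (ρ - p * (q * q) * x)
    identity = solve-∀ ring

  F≤φ : ∀ d → F (suc d) ≤ φ d
  F≤φ zero = subst (g ≤_) (identity ρ) g≤1
    where
    identity : ∀ ρ → 1ℚ ≡ ρ + (1ℚ - ρ) * 1ℚ
    identity = solve-∀ ring
  F≤φ (suc zero) = ≤-of-sum (p * p * ρ) (*-nonneg (*-nonneg 0≤p 0≤p) 0≤ρ) (identity ρ)
    where
    identity : ∀ ρ → let p = 1ℚ - ρ; q = ρ * (1ℚ + p) in
      ρ + p * (q * 1ℚ) ≡ q * 1ℚ + p * p * ρ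
    identity = solve-∀ ring
  -- The step of two cannot start at 0: it would need p q ≤ ρ, which is false for p near 1. Hence a
  -- third base case.
  F≤φ (suc (suc zero)) = ≤-modulo {z = q} 0<c cη
    (*-nonneg (*-nonneg (*-nonneg 0≤ρ 0≤ρ) (<⇒≤ 0<1+p))
      (*-nonneg (*-nonneg 0≤p 0≤p)
        (+-nonneg (+-nonneg 0≤1 (*-nonneg (<⇒≤ (positive⁻¹ (1ℚ + 1ℚ + 1ℚ))) 0≤p)) (*-nonneg 0≤p 0≤p))))
    (identity ρ η)
    where
    identity : ∀ ρ η → let p = 1ℚ - ρ; q = ρ * (1ℚ + p) in
      (1ℚ + p) * (1ℚ + p) * ((ρ + p * (q * (q * 1ℚ))) - q * (1ℚ - η)) ≡
      ρ * ρ * (1ℚ + p) * (p * p * (1ℚ + (1ℚ + 1ℚ + 1ℚ) * p + p * p))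
        + q * ((1ℚ + p) * (1ℚ + p) * η - 2ℚ * p * p * p)
    identity = solve-∀ ring
  F≤φ (suc (suc (suc d))) = ≤-trans (*-monoˡ 0≤q (F≤φ (suc d))) (q*φ≤φ d)

-- Strict inequalities at ρ = ½.

module Half where

  open Bound ½ (from-yes (0ℚ ≤? ½)) (from-yes (½ ≤? 1ℚ)) public

  0<F : ∀ n → 0ℚ < F n
  0<F zero          = 0<1
  0<F (suc zero)    = from-yes (0ℚ <? g)
  0<F (suc (suc n)) = *-pos (from-yes (0ℚ <? q)) (0<F n)

  *-monoʳ-< : ∀ {a b c} → 0ℚ < c → a < b → a * c < b * c
  *-monoʳ-< {c = c} 0<c = *-monoˡ-<-pos c {{positive 0<c}}

  *-monoˡ-< : ∀ {a b c} → 0ℚ < c → a < b → c * a < c * b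
  *-monoˡ-< {c = c} 0<c = *-monoʳ-<-pos c {{positive 0<c}}

  ½*F<F : ∀ n → ½ * F n < F (suc n)
  ½*F<F zero          = from-yes (½ * 1ℚ <? g)
  ½*F<F (suc zero)    = from-yes (½ * g <? q * 1ℚ)
  ½*F<F (suc (suc n)) = subst (_< q * F (suc n)) (*-exchange q ½ (F n))
    (*-monoˡ-< (from-yes (0ℚ <? q)) (½*F<F n))

  F<φ : ∀ d → F (suc d) < φ d
  F<φ zero                = from-yes (g <? φ 0)
  F<φ (suc zero)          = from-yes (F 2 <? φ 1)
  F<φ (suc (suc zero))    = from-yes (F 3 <? φ 2)
  F<φ (suc (suc (suc d))) = <-≤-trans (*-monoˡ-< (from-yes (0ℚ <? q)) (F<φ (suc d))) (q*φ≤φ d)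

  q<g*g : q < g * g
  q<g*g = from-yes (q <? g * g)

  g<1 : g < 1ℚ
  g<1 = from-yes (g <? 1ℚ)

-- The spin model

data Spin : Set where
  src snk off : Spin

Σ₃ : (Spin → ℚ) → ℚ
Σ₃ f = f src + f snk + f off

Σ₃-cong : ∀ {f h : Spin → ℚ} → (∀ a → f a ≡ h a) → Σ₃ f ≡ Σ₃ h
Σ₃-cong f≡h = cong₂ _+_ (cong₂ _+_ (f≡h src) (f≡h snk)) (f≡h off)

Σ₃-mono : ∀ {f h : Spin → ℚ} → (∀ a → f a ≤ h a) → Σ₃ f ≤ Σ₃ h
Σ₃-mono f≤h = +-mono-≤ (+-mono-≤ (f≤h src) (f≤h snk)) (f≤h off)

Σ₃-+ : ∀ (f h : Spin → ℚ) → Σ₃ (λ a → f a + h a) ≡ Σ₃ f + Σ₃ h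
Σ₃-+ f h = lemma (f src) (f snk) (f off) (h src) (h snk) (h off)
  where
  lemma : ∀ a b c x y z → (a + x) + (b + y) + (c + z) ≡ (a + b + c) + (x + y + z)
  lemma = solve-∀ ring

Σ₃-*ˡ : ∀ c (f : Spin → ℚ) → Σ₃ (λ a → c * f a) ≡ c * Σ₃ f
Σ₃-*ˡ c f = lemma c (f src) (f snk) (f off)
  where
  lemma : ∀ c x y z → c * x + c * y + c * z ≡ c * (x + y + z)
  lemma = solve-∀ ring

Σ₃-swap : ∀ (f : Spin → Spin → ℚ) → Σ₃ (λ a → Σ₃ (f a)) ≡ Σ₃ (λ b → Σ₃ (λ a → f a b))
Σ₃-swap f = trans (Σ₃-+ (λ a → f a src + f a snk) (λ a → f a off))
  (cong (_+ Σ₃ (λ a → f a off)) (Σ₃-+ (λ a → f a src) (λ a → f a snk)))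

-- Whether a vertex is adjacent to the source and to the sink.
Type : Set
Type = Bool × Bool

pattern isolated = false , false

toSource toSink : ℚ → ℚ → Bool → Spin → ℚ
toSource p ρ true  src = p
toSource p ρ true  _   = ρ
toSource p ρ false src = 0ℚ
toSource p ρ false _   = 1ℚ
toSink p ρ true  snk = p
toSink p ρ true  _   = ρ
toSink p ρ false snk = 0ℚ
toSink p ρ false _   = 1ℚ

-- Spins record which terminal a vertex is joined to by a surviving edge; a
-- vertex joined to both is left out, as it creates a path of length 2.
weight : ℚ → ℚ → Type → Spin → ℚ
weight p ρ (a , b) σ = toSource p ρ a σ * toSink p ρ b σ

module Configurations (p ρ : ℚ) where

  ∑ : ∀ {n} → Vec Type n → (Vec Spin n → ℚ) → ℚ
  ∑ []       f = f []
  ∑ (t ∷ ts) f = Σ₃ λ a → weight p ρ t a * ∑ ts (λ σ → f (a ∷ σ))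

  ∑-cong : ∀ {n} (ts : Vec Type n) {f h : Vec Spin n → ℚ} →
           (∀ σ → f σ ≡ h σ) → ∑ ts f ≡ ∑ ts h
  ∑-cong []       f≡h = f≡h []
  ∑-cong (t ∷ ts) f≡h = Σ₃-cong λ a → cong (weight p ρ t a *_) (∑-cong ts λ σ → f≡h (a ∷ σ))

  ∑-+ : ∀ {n} (ts : Vec Type n) (f h : Vec Spin n → ℚ) →
        ∑ ts (λ σ → f σ + h σ) ≡ ∑ ts f + ∑ ts h
  ∑-+ []       f h = refl
  ∑-+ (t ∷ ts) f h = trans
    (Σ₃-cong λ a → trans (cong (weight p ρ t a *_) (∑-+ ts (λ σ → f (a ∷ σ)) (λ σ → h (a ∷ σ))))
      (*-distribˡ-+ (weight p ρ t a) (∑ ts λ σ → f (a ∷ σ)) (∑ ts λ σ → h (a ∷ σ))))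
    (Σ₃-+ (λ a → weight p ρ t a * ∑ ts λ σ → f (a ∷ σ)) (λ a → weight p ρ t a * ∑ ts λ σ → h (a ∷ σ)))

  ∑-*ˡ : ∀ {n} (ts : Vec Type n) c (f : Vec Spin n → ℚ) → ∑ ts (λ σ → c * f σ) ≡ c * ∑ ts f
  ∑-*ˡ []       c f = refl
  ∑-*ˡ (t ∷ ts) c f = trans
    (Σ₃-cong λ a → trans (cong (weight p ρ t a *_) (∑-*ˡ ts c λ σ → f (a ∷ σ)))
      (*-exchange (weight p ρ t a) c (∑ ts λ σ → f (a ∷ σ))))
    (Σ₃-*ˡ c λ a → weight p ρ t a * ∑ ts λ σ → f (a ∷ σ))

  -- An isolated vertex has weights 0, 0, 1, so giving `v` the type `isolated` sums over the other
  -- vertices only, and overwriting its spin afterwards makes the value summed there irrelevant.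
  -- Vertices can thus be removed without changing `n`.
  ∑-split : ∀ {n} (ts : Vec Type n) v (f : Vec Spin n → ℚ) →
    ∑ ts f ≡ Σ₃ λ a → weight p ρ (lookup ts v) a * ∑ (ts [ v ]≔ isolated) (λ σ → f (σ [ v ]≔ a))
  ∑-split (t ∷ ts) zero    f = Σ₃-cong λ a → cong (weight p ρ t a *_) (lemma (∑ ts λ σ → f (a ∷ σ)))
    where
    lemma : ∀ x → x ≡ 0ℚ * 1ℚ * x + 1ℚ * 0ℚ * x + 1ℚ * 1ℚ * x
    lemma = solve-∀ ring
  ∑-split (t ∷ ts) (suc v) f = begin
    Σ₃ (λ b → w b * ∑ ts (λ σ → f (b ∷ σ)))
      ≡⟨ (Σ₃-cong λ b → trans (cong (w b *_) (∑-split ts v λ σ → f (b ∷ σ))) (sym (Σ₃-*ˡ (w b) λ a → w′ a * I a b))) ⟩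
    Σ₃ (λ b → Σ₃ λ a → w b * (w′ a * I a b))
      ≡⟨ Σ₃-swap (λ b a → w b * (w′ a * I a b)) ⟩
    Σ₃ (λ a → Σ₃ λ b → w b * (w′ a * I a b))
      ≡⟨ (Σ₃-cong λ a → trans (Σ₃-cong λ b → *-exchange (w b) (w′ a) (I a b)) (Σ₃-*ˡ (w′ a) λ b → w b * I a b)) ⟩
    Σ₃ (λ a → w′ a * Σ₃ (λ b → w b * I a b)) ∎
    where
    open ≡-Reasoning
    w w′ : Spin → ℚ
    w  = weight p ρ t
    w′ = weight p ρ (lookup ts v)
    I : Spin → Spin → ℚ
    I a b = ∑ (ts [ v ]≔ isolated) (λ σ → f (b ∷ (σ [ v ]≔ a)))

-- Vertex types and the numbers of edges.

incident? : ∀ {n} (v : Fin n) (e : Fin n × Fin n) → Dec (proj₁ e ≡ v ⊎ proj₂ e ≡ v)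
incident? v (x , y) = (x Fin.≟ v) ⊎-dec (y Fin.≟ v)

degree : ∀ {n} → Fin n → List (Fin n × Fin n) → ℕ
degree v []      = 0
degree v (e ∷ D) = if does (incident? v e) then suc (degree v D) else degree v D

_∖_ : ∀ {n} → List (Fin n × Fin n) → Fin n → List (Fin n × Fin n)
[]      ∖ v = []
(e ∷ D) ∖ v = if does (incident? v e) then D ∖ v else e ∷ (D ∖ v)

length-∖ : ∀ {n} v (D : List (Fin n × Fin n)) → length D ≡ degree v D ℕ.+ length (D ∖ v)
length-∖ v []      = refl
length-∖ v (e ∷ D) with does (incident? v e)
... | true  = cong suc (length-∖ v D)
... | false = trans (cong suc (length-∖ v D)) (sym (ℕ.+-suc (degree v D) _))

data OneSided : Type → Set where
  source-only : OneSided (true , false)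
  sink-only   : OneSided (false , true)

TwoSided : Type → Set
TwoSided (a , b) = a ≡ b

AllTwoSided : ∀ {n} → Vec Type n → Set
AllTwoSided ts = ∀ v → TwoSided (lookup ts v)

side : Bool → ℕ
side b = if b then 1 else 0

-- The number of edges other than st that meet a terminal, when `ts` holds the types of the vertices
-- of a graph.
cost : ∀ {n} → Vec Type n → ℕ
cost []             = 0
cost ((a , b) ∷ ts) = side a ℕ.+ side b ℕ.+ cost ts

sides : ∀ t → TwoSided t ⊎ OneSided t
sides (true  , true)  = inj₁ refl
sides (true  , false) = inj₂ source-only
sides (false , true)  = inj₂ sink-only
sides (false , false) = inj₁ refl

cost-remove : ∀ {n} (ts : Vec Type n) v → OneSided (lookup ts v) →
              cost ts ≡ suc (cost (ts [ v ]≔ isolated))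
cost-remove ((true  , false) ∷ ts) zero    source-only = refl
cost-remove ((false , true)  ∷ ts) zero    sink-only   = refl
cost-remove ((a , b) ∷ ts)         (suc v) one         =
  trans (cong (side a ℕ.+ side b ℕ.+_) (cost-remove ts v one)) (ℕ.+-suc (side a ℕ.+ side b) _)

pattern joined = true , true

cost-joined : ∀ {n} (ts : Vec Type n) v → lookup ts v ≡ joined →
              cost ts ≡ suc (suc (cost (ts [ v ]≔ isolated)))
cost-joined (joined ∷ ts)  zero    refl = refl
cost-joined ((a , b) ∷ ts) (suc v) eq   = begin
  side a ℕ.+ side b ℕ.+ cost ts                   ≡⟨ cong (side a ℕ.+ side b ℕ.+_) (cost-joined ts v eq) ⟩
  side a ℕ.+ side b ℕ.+ suc (suc (cost ts′))      ≡⟨ ℕ.+-suc (side a ℕ.+ side b) (suc (cost ts′)) ⟩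
  suc (side a ℕ.+ side b ℕ.+ suc (cost ts′))      ≡⟨ cong suc (ℕ.+-suc (side a ℕ.+ side b) (cost ts′)) ⟩
  suc (suc (side a ℕ.+ side b ℕ.+ cost ts′))      ∎
  where
  open ≡-Reasoning
  ts′ = ts [ v ]≔ isolated

-- The ends of the single edge have to be joined to the terminals: an edge at an isolated vertex is
-- on no short path, so it does not reduce Z by the factor `g`.
data Shape {n} (ts : Vec Type n) : List (Fin n × Fin n) → Set where
  no-edge  : Shape ts []
  one-edge : ∀ {x y} → x ≢ y → lookup ts x ≡ joined → lookup ts y ≡ joined →
             Shape ts ((x , y) ∷ [])

-- The partition function and its lower bound.

module Model (ρ : ℚ) (0≤ρ : 0ℚ ≤ ρ) (ρ≤1 : ρ ≤ 1ℚ) where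

  open Bound ρ 0≤ρ ρ≤1
  open Configurations p ρ public

  private
    ω : Type → Spin → ℚ
    ω = weight p ρ

  link : Spin → Spin → ℚ
  link off _   = 1ℚ
  link src src = 1ℚ
  link src snk = ρ
  link src off = 1ℚ
  link snk src = ρ
  link snk snk = 1ℚ
  link snk off = 1ℚ

  link-comm : ∀ a b → link a b ≡ link b a
  link-comm src src = refl
  link-comm src snk = refl
  link-comm src off = refl
  link-comm snk src = refl
  link-comm snk snk = refl
  link-comm snk off = refl
  link-comm off src = refl
  link-comm off snk = refl
  link-comm off off = refl

  link-off : ∀ a → link a off ≡ 1ℚ
  link-off a = link-comm a off

  link-diag : ∀ a → link a a ≡ 1ℚ
  link-diag src = refl
  link-diag snk = refl
  link-diag off = refl

  0≤link : ∀ a b → 0ℚ ≤ link a b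
  0≤link src src = 0≤1
  0≤link src snk = 0≤ρ
  0≤link src off = 0≤1
  0≤link snk src = 0≤ρ
  0≤link snk snk = 0≤1
  0≤link snk off = 0≤1
  0≤link off b   = 0≤1

  link≤1 : ∀ a b → link a b ≤ 1ℚ
  link≤1 src src = ≤-refl
  link≤1 src snk = ρ≤1
  link≤1 src off = ≤-refl
  link≤1 snk src = ρ≤1
  link≤1 snk snk = ≤-refl
  link≤1 snk off = ≤-refl
  link≤1 off b   = ≤-refl

  links : ∀ {n} → List (Fin n × Fin n) → Vec Spin n → ℚ
  links []            σ = 1ℚ
  links ((x , y) ∷ D) σ = link (lookup σ x) (lookup σ y) * links D σ

  Z : ∀ {n} → Vec Type n → List (Fin n × Fin n) → ℚ
  Z ts D = ∑ ts (links D)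

  0≤ω : ∀ t a → 0ℚ ≤ ω t a
  0≤ω (a , b) σ = *-nonneg (0≤toSource a σ) (0≤toSink b σ)
    where
    0≤toSource : ∀ a σ → 0ℚ ≤ toSource p ρ a σ
    0≤toSource true  src = 0≤p
    0≤toSource true  snk = 0≤ρ
    0≤toSource true  off = 0≤ρ
    0≤toSource false src = ≤-refl
    0≤toSource false snk = 0≤1
    0≤toSource false off = 0≤1
    0≤toSink : ∀ a σ → 0ℚ ≤ toSink p ρ a σ
    0≤toSink true  src = 0≤ρ
    0≤toSink true  snk = 0≤p
    0≤toSink true  off = 0≤ρ
    0≤toSink false src = 0≤1
    0≤toSink false snk = ≤-refl
    0≤toSink false off = 0≤1

  ∑-mono : ∀ {n} (ts : Vec Type n) {f h : Vec Spin n → ℚ} → (∀ σ → f σ ≤ h σ) → ∑ ts f ≤ ∑ ts h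
  ∑-mono []       f≤h = f≤h []
  ∑-mono (t ∷ ts) f≤h = Σ₃-mono λ a → *-monoˡ (0≤ω t a) (∑-mono ts λ σ → f≤h (a ∷ σ))

  ∑-0 : ∀ {n} (ts : Vec Type n) → ∑ ts (λ _ → 0ℚ) ≡ 0ℚ
  ∑-0 ts = trans (∑-*ˡ ts 0ℚ (λ _ → 0ℚ)) (*-zeroˡ (∑ ts λ _ → 0ℚ))

  0≤∑ : ∀ {n} (ts : Vec Type n) {f : Vec Spin n → ℚ} → (∀ σ → 0ℚ ≤ f σ) → 0ℚ ≤ ∑ ts f
  0≤∑ ts {f} 0≤f = subst (_≤ ∑ ts f) (∑-0 ts) (∑-mono ts 0≤f)

  -- The only monotonicity available: src and snk are not comparable, but both lie on the same side
  -- of off. All products of links have this property at every vertex.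
  DecreasingAt : ∀ {n} → Fin n → (Vec Spin n → ℚ) → Set
  DecreasingAt x k = ∀ σ → k σ ≤ k (σ [ x ]≔ off)

  -- Summing over the other vertices leaves a function of the spin at `x` that is again nonnegative
  -- and largest at off, so an inequality about three terms is all that has to be checked.
  ∑-local : ∀ {n} (ts : Vec Type n) x (c c′ : Spin → ℚ) →
    (∀ (k : Spin → ℚ) → (∀ a → 0ℚ ≤ k a) → (∀ a → k a ≤ k off) →
      Σ₃ (λ a → ω (lookup ts x) a * (c a * k a)) ≤ Σ₃ (λ a → ω (lookup ts x) a * (c′ a * k a))) →
    {k : Vec Spin n → ℚ} → (∀ σ → 0ℚ ≤ k σ) → DecreasingAt x k →
    ∑ ts (λ σ → c (lookup σ x) * k σ) ≤ ∑ ts (λ σ → c′ (lookup σ x) * k σ)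
  ∑-local ts x c c′ local {k} 0≤k k↓ = subst₂ _≤_ (sym (split c)) (sym (split c′))
    (local I (λ a → 0≤∑ ts′ λ σ → 0≤k _) I↓)
    where
    ts′ = ts [ x ]≔ isolated
    I : Spin → ℚ
    I a = ∑ ts′ (λ σ → k (σ [ x ]≔ a))
    I↓ : ∀ a → I a ≤ I off
    I↓ a = ∑-mono ts′ λ σ → subst (k (σ [ x ]≔ a) ≤_) (cong k (Vec.[]≔-idempotent σ x)) (k↓ _)
    split : ∀ d → ∑ ts (λ σ → d (lookup σ x) * k σ) ≡ Σ₃ (λ a → ω (lookup ts x) a * (d a * I a))
    split d = trans (∑-split ts x λ σ → d (lookup σ x) * k σ) (Σ₃-cong λ a → cong (ω (lookup ts x) a *_)
      (trans (∑-cong ts′ λ σ → cong (λ b → d b * k (σ [ x ]≔ a)) (Vec.lookup∘update x σ a))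
             (∑-*ˡ ts′ (d a) λ σ → k (σ [ x ]≔ a))))

  -- Since spins may be switched off independently, no vertex points to a given
  -- terminal with odds better than p : ρ.
  odds : ∀ t {a} → a ≢ off → ω t a * ρ ≤ p * ω t off
  odds (a , b) {off} a≢off = contradiction refl a≢off
  odds (true  , true)  {src} _ = ≤-reflexive (identity p ρ)
    where
    identity : ∀ p ρ → p * ρ * ρ ≡ p * (ρ * ρ)
    identity = solve-∀ ring
  odds (true  , false) {src} _ = ≤-reflexive (identity p ρ)
    where
    identity : ∀ p ρ → p * 1ℚ * ρ ≡ p * (ρ * 1ℚ)
    identity = solve-∀ ring
  odds (false , true)  {src} _ =
    subst (_≤ p * (1ℚ * ρ)) (identity ρ) (*-nonneg 0≤p (*-nonneg 0≤1 0≤ρ))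
    where
    identity : ∀ ρ → 0ℚ ≡ 0ℚ * ρ * ρ
    identity = solve-∀ ring
  odds (false , false) {src} _ =
    subst (_≤ p * (1ℚ * 1ℚ)) (identity ρ) (*-nonneg 0≤p (*-nonneg 0≤1 0≤1))
    where
    identity : ∀ ρ → 0ℚ ≡ 0ℚ * 1ℚ * ρ
    identity = solve-∀ ring
  odds (true  , true)  {snk} _ = ≤-reflexive (identity p ρ)
    where
    identity : ∀ p ρ → ρ * p * ρ ≡ p * (ρ * ρ)
    identity = solve-∀ ring
  odds (true  , false) {snk} _ =
    subst (_≤ p * (ρ * 1ℚ)) (identity ρ) (*-nonneg 0≤p (*-nonneg 0≤ρ 0≤1))
    where
    identity : ∀ ρ → 0ℚ ≡ ρ * 0ℚ * ρ
    identity = solve-∀ ring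
  odds (false , true)  {snk} _ = ≤-reflexive (identity p ρ)
    where
    identity : ∀ p ρ → 1ℚ * p * ρ ≡ p * (1ℚ * ρ)
    identity = solve-∀ ring
  odds (false , false) {snk} _ =
    subst (_≤ p * (1ℚ * 1ℚ)) (identity ρ) (*-nonneg 0≤p (*-nonneg 0≤1 0≤1))
    where
    identity : ∀ ρ → 0ℚ ≡ 1ℚ * 0ℚ * ρ
    identity = solve-∀ ring

  -- By `odds`, the spin opposite to `a` has odds at most p : ρ against off, hence conditional
  -- probability at most p. Only then must the edge fail, so the mean of the link is at least 1 - p²
  -- = q.
  Σ₃-link : ∀ t {a} → a ≢ off → (k : Spin → ℚ) → (∀ b → 0ℚ ≤ k b) → (∀ b → k b ≤ k off) →
    Σ₃ (λ b → ω t b * (q * k b)) ≤ Σ₃ (λ b → ω t b * (link a b * k b))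
  Σ₃-link t {off} a≢off k 0≤k k↓ = contradiction refl a≢off
  Σ₃-link t {src} _ k 0≤k k↓ = ≤-of-sum
    (p * p * (ω t src * k src) + p * (p * ω t off * k off - ω t snk * ρ * k snk))
    (+-nonneg (*-nonneg (*-nonneg 0≤p 0≤p) (*-nonneg (0≤ω t src) (0≤k src)))
      (*-nonneg 0≤p (0≤- (*-mono-≤ (*-nonneg (0≤ω t snk) 0≤ρ) (0≤k snk)
        (odds t {snk} λ ()) (k↓ snk)))))
    (identity ρ (ω t src) (ω t snk) (ω t off) (k src) (k snk) (k off))
    where
    identity : ∀ ρ u v w x y z → let p = 1ℚ - ρ; q = ρ * (1ℚ + p) in
      u * (1ℚ * x) + v * (ρ * y) + w * (1ℚ * z) ≡
      (u * (q * x) + v * (q * y) + w * (q * z)) +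
      (p * p * (u * x) + p * (p * w * z - v * ρ * y))
    identity = solve-∀ ring
  Σ₃-link t {snk} _ k 0≤k k↓ = ≤-of-sum
    (p * p * (ω t snk * k snk) + p * (p * ω t off * k off - ω t src * ρ * k src))
    (+-nonneg (*-nonneg (*-nonneg 0≤p 0≤p) (*-nonneg (0≤ω t snk) (0≤k snk)))
      (*-nonneg 0≤p (0≤- (*-mono-≤ (*-nonneg (0≤ω t src) 0≤ρ) (0≤k src)
        (odds t {src} λ ()) (k↓ src)))))
    (identity ρ (ω t src) (ω t snk) (ω t off) (k src) (k snk) (k off))
    where
    identity : ∀ ρ u v w x y z → let p = 1ℚ - ρ; q = ρ * (1ℚ + p) in
      u * (ρ * x) + v * (1ℚ * y) + w * (1ℚ * z) ≡
      (u * (q * x) + v * (q * y) + w * (q * z)) +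
      (p * p * (v * y) + p * (p * w * z - u * ρ * x))
    identity = solve-∀ ring

  -- Removing a vertex adjacent to one terminal.

  lookup-off : ∀ {n} (σ : Vec Spin n) x y →
    lookup (σ [ x ]≔ off) y ≡ lookup σ y ⊎ lookup (σ [ x ]≔ off) y ≡ off
  lookup-off σ x y with y Fin.≟ x
  ... | yes refl = inj₂ (Vec.lookup∘update x σ off)
  ... | no  y≢x  = inj₁ (Vec.lookup∘update′ y≢x σ off)

  link-↓ : ∀ a b {a′ b′} → a′ ≡ a ⊎ a′ ≡ off → b′ ≡ b ⊎ b′ ≡ off → link a b ≤ link a′ b′
  link-↓ a b (inj₂ refl) _           = link≤1 a b
  link-↓ a b (inj₁ refl) (inj₂ refl) = subst (link a b ≤_) (sym (link-off a)) (link≤1 a b)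
  link-↓ a b (inj₁ refl) (inj₁ refl) = ≤-refl

  0≤links : ∀ {n} D (σ : Vec Spin n) → 0ℚ ≤ links D σ
  0≤links []            σ = 0≤1
  0≤links ((x , y) ∷ D) σ = *-nonneg (0≤link (lookup σ x) (lookup σ y)) (0≤links D σ)

  links-↓ : ∀ {n} D {σ τ : Vec Spin n} → (∀ x → lookup τ x ≡ lookup σ x ⊎ lookup τ x ≡ off) →
            links D σ ≤ links D τ
  links-↓ []            σ→τ = ≤-refl
  links-↓ ((x , y) ∷ D) {σ} σ→τ = *-mono-≤ (0≤link (lookup σ x) (lookup σ y)) (0≤links D σ)
    (link-↓ (lookup σ x) (lookup σ y) (σ→τ x) (σ→τ y)) (links-↓ D σ→τ)

  update-off : ∀ {n} (σ : Vec Spin n) v a x y →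
    lookup ((σ [ x ]≔ off) [ v ]≔ a) y ≡ lookup (σ [ v ]≔ a) y ⊎
    lookup ((σ [ x ]≔ off) [ v ]≔ a) y ≡ off
  update-off σ v a x y with y Fin.≟ v
  ... | yes refl = inj₁ (trans (Vec.lookup∘update v (σ [ x ]≔ off) a) (sym (Vec.lookup∘update v σ a)))
  ... | no  y≢v  rewrite Vec.lookup∘update′ y≢v (σ [ x ]≔ off) a | Vec.lookup∘update′ y≢v σ a =
    lookup-off σ x y

  -- The step of `peel` for an edge at `v`, common to its three cases. They differ in `ℓ′`, the link
  -- after the spin `a` of `v` has been substituted, and in the reason `step` why it may be replaced
  -- by `q`.
  peel-edge : ∀ {n} (ts : Vec Type n) v a {c} D {k : Vec Spin n → ℚ} (I : ℚ) (ℓ ℓ′ : Vec Spin n → ℚ) →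
    (∀ σ → ℓ σ ≡ ℓ′ σ) →
    (∀ {K : Vec Spin n → ℚ} → (∀ σ → 0ℚ ≤ K σ) → (∀ x → DecreasingAt x K) →
      ∑ ts (λ σ → q * K σ) ≤ ∑ ts (λ σ → ℓ′ σ * K σ)) →
    (∀ σ → 0ℚ ≤ k σ) → (∀ x → DecreasingAt x k) →
    c * I ≤ ∑ ts (λ σ → k σ * links D (σ [ v ]≔ a)) →
    q * c * I ≤ ∑ ts (λ σ → k σ * (ℓ σ * links D (σ [ v ]≔ a)))
  peel-edge ts v a {c} D {k} I ℓ ℓ′ ℓ≡ℓ′ step 0≤k k↓ ih = begin
    q * c * I               ≡⟨ *-assoc q c I ⟩
    q * (c * I)             ≤⟨ *-monoˡ 0≤q ih ⟩
    q * ∑ ts K              ≡⟨ ∑-*ˡ ts q K ⟨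
    ∑ ts (λ σ → q * K σ)    ≤⟨ step 0≤K K↓ ⟩
    ∑ ts (λ σ → ℓ′ σ * K σ)
      ≡⟨ (∑-cong ts λ σ → trans (*-exchange (ℓ′ σ) (k σ) (links D (σ [ v ]≔ a)))
           (cong (λ l → k σ * (l * links D (σ [ v ]≔ a))) (sym (ℓ≡ℓ′ σ)))) ⟩
    ∑ ts (λ σ → k σ * (ℓ σ * links D (σ [ v ]≔ a))) ∎
    where
    open ≤-Reasoning
    K : Vec Spin _ → ℚ
    K σ = k σ * links D (σ [ v ]≔ a)
    0≤K : ∀ σ → 0ℚ ≤ K σ
    0≤K σ = *-nonneg (0≤k σ) (0≤links D (σ [ v ]≔ a))
    K↓ : ∀ x → DecreasingAt x K
    K↓ x σ = *-mono-≤ (0≤k σ) (0≤links D (σ [ v ]≔ a)) (k↓ x σ)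
      (links-↓ D (update-off σ v a x))

  -- The links are not independent, so each edge at `v` has to be bounded in the presence of all
  -- others. An edge away from `v` moves into the accumulator `k`, which stays nonnegative and
  -- decreasing, and this is all that `Σ₃-link` asks of its surroundings.
  peel : ∀ {n} (ts : Vec Type n) v {a} → a ≢ off → ∀ D {k : Vec Spin n → ℚ} →
    (∀ σ → 0ℚ ≤ k σ) → (∀ x → DecreasingAt x k) →
    q^ (degree v D) * ∑ ts (λ σ → k σ * links (D ∖ v) σ) ≤ ∑ ts (λ σ → k σ * links D (σ [ v ]≔ a))
  peel ts v a≢off [] 0≤k k↓ = ≤-reflexive (*-identityˡ _)
  peel ts v {a} a≢off ((x , y) ∷ D) {k} 0≤k k↓ with x Fin.≟ v | y Fin.≟ v
  ... | no x≢v | no y≢v = begin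
    q^ (degree v D) * ∑ ts (λ σ → k σ * (ℓ σ * links (D ∖ v) σ))
      ≡⟨ cong (q^ (degree v D) *_) (∑-cong ts λ σ → sym (*-assoc (k σ) (ℓ σ) (links (D ∖ v) σ))) ⟩
    q^ (degree v D) * ∑ ts (λ σ → (k σ * ℓ σ) * links (D ∖ v) σ)
      ≤⟨ peel ts v a≢off D (λ σ → *-nonneg (0≤k σ) (0≤ℓ σ)) (λ z σ → *-mono-≤ (0≤k σ) (0≤ℓ σ) (k↓ z σ)
           (link-↓ (lookup σ x) (lookup σ y) (lookup-off σ z x) (lookup-off σ z y))) ⟩
    ∑ ts (λ σ → (k σ * ℓ σ) * links D (σ [ v ]≔ a))
      ≡⟨ (∑-cong ts λ σ → trans (*-assoc (k σ) (ℓ σ) (links D (σ [ v ]≔ a)))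
           (cong (λ l → k σ * (l * links D (σ [ v ]≔ a)))
             (sym (cong₂ link (Vec.lookup∘update′ x≢v σ a) (Vec.lookup∘update′ y≢v σ a))))) ⟩
    ∑ ts (λ σ → k σ * (link (lookup (σ [ v ]≔ a) x) (lookup (σ [ v ]≔ a) y) * links D (σ [ v ]≔ a))) ∎
    where
    open ≤-Reasoning
    ℓ : Vec Spin _ → ℚ
    ℓ σ = link (lookup σ x) (lookup σ y)
    0≤ℓ : ∀ σ → 0ℚ ≤ ℓ σ
    0≤ℓ σ = 0≤link (lookup σ x) (lookup σ y)
  -- A loop, possible because `D` is an arbitrary list: it counts towards the degree, but its link
  -- is 1, which is at least `q`.
  ... | yes refl | yes refl = peel-edge ts x a D _
    (λ σ → link (lookup (σ [ x ]≔ a) x) (lookup (σ [ x ]≔ a) x)) (λ _ → 1ℚ)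
    (λ σ → link-diag (lookup (σ [ x ]≔ a) x)) (λ 0≤K _ → ∑-mono ts λ σ → *-monoʳ (0≤K σ) q≤1)
    0≤k k↓ (peel ts x a≢off D 0≤k k↓)
  ... | yes refl | no y≢x = peel-edge ts x a D _
    (λ σ → link (lookup (σ [ x ]≔ a) x) (lookup (σ [ x ]≔ a) y)) (λ σ → link a (lookup σ y))
    (λ σ → cong₂ link (Vec.lookup∘update x σ a) (Vec.lookup∘update′ y≢x σ a))
    (λ 0≤K K↓ → ∑-local ts y (λ _ → q) (link a) (Σ₃-link (lookup ts y) a≢off) 0≤K (K↓ y))
    0≤k k↓ (peel ts x a≢off D 0≤k k↓)
  ... | no x≢y | yes refl = peel-edge ts y a D _
    (λ σ → link (lookup (σ [ y ]≔ a) x) (lookup (σ [ y ]≔ a) y)) (λ σ → link a (lookup σ x))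
    (λ σ → trans (cong₂ link (Vec.lookup∘update′ x≢y σ a) (Vec.lookup∘update y σ a))
                 (link-comm (lookup σ x) a))
    (λ 0≤K K↓ → ∑-local ts x (λ _ → q) (link a) (Σ₃-link (lookup ts x) a≢off) 0≤K (K↓ x))
    0≤k k↓ (peel ts y a≢off D 0≤k k↓)

  links-∖ : ∀ {n} v D (σ : Vec Spin n) → links D (σ [ v ]≔ off) ≡ links (D ∖ v) σ
  links-∖ v []            σ = refl
  links-∖ v ((x , y) ∷ D) σ with x Fin.≟ v | y Fin.≟ v
  ... | no x≢v   | no y≢v   = cong₂ _*_
    (cong₂ link (Vec.lookup∘update′ x≢v σ off) (Vec.lookup∘update′ y≢v σ off)) (links-∖ v D σ)
  ... | yes refl | _        = trans (cong₂ _*_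
    (cong (λ a → link a (lookup (σ [ x ]≔ off) y)) (Vec.lookup∘update x σ off)) (links-∖ x D σ))
    (*-identityˡ (links (D ∖ x) σ))
  ... | no _     | yes refl = trans (cong₂ _*_
    (trans (cong (link (lookup (σ [ y ]≔ off) x)) (Vec.lookup∘update y σ off))
           (link-off (lookup (σ [ y ]≔ off) x))) (links-∖ y D σ))
    (*-identityˡ (links (D ∖ y) σ))

  -- Such a vertex has only two spins of nonzero type: off, with weight ρ, where all its links are
  -- 1, and one active spin, with weight p, where `peel` applies.
  remove-oneSided : ∀ {n} (ts : Vec Type n) v D → OneSided (lookup ts v) →
    φ (degree v D) * Z (ts [ v ]≔ isolated) (D ∖ v) ≤ Z ts D
  remove-oneSided ts v D one-sided = begin
    φ d * Z ts′ (D ∖ v)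
      ≡⟨ distrib p ρ (q^ d) (Z ts′ (D ∖ v)) ⟩
    p * (q^ d * Z ts′ (D ∖ v)) + ρ * Z ts′ (D ∖ v)
      ≤⟨ bound one-sided ⟩
    Σ₃ (λ a → ω (lookup ts v) a * I a)
      ≡⟨ ∑-split ts v (links D) ⟨
    Z ts D ∎
    where
    open ≤-Reasoning
    d = degree v D
    ts′ = ts [ v ]≔ isolated
    I : Spin → ℚ
    I a = ∑ ts′ (λ σ → links D (σ [ v ]≔ a))
    distrib : ∀ p ρ x z → (ρ + p * x) * z ≡ p * (x * z) + ρ * z
    distrib = solve-∀ ring
    I-off : I off ≡ Z ts′ (D ∖ v)
    I-off = ∑-cong ts′ (links-∖ v D)
    I-on : ∀ {a} → a ≢ off → q^ d * Z ts′ (D ∖ v) ≤ I a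
    I-on {a} a≢off = subst₂ _≤_
      (cong (q^ d *_) (∑-cong ts′ λ σ → *-identityˡ (links (D ∖ v) σ)))
      (∑-cong ts′ λ σ → *-identityˡ (links D (σ [ v ]≔ a)))
      (peel ts′ v a≢off D {λ _ → 1ℚ} (λ _ → 0≤1) (λ _ _ → ≤-refl))
    bound : ∀ {t} → OneSided t →
      p * (q^ d * Z ts′ (D ∖ v)) + ρ * Z ts′ (D ∖ v) ≤ Σ₃ (λ a → ω t a * I a)
    bound source-only = subst (p * (q^ d * Z ts′ (D ∖ v)) + ρ * Z ts′ (D ∖ v) ≤_)
      (identity p ρ (I src) (I snk) (I off))
      (+-mono-≤ (*-monoˡ 0≤p (I-on λ ())) (≤-reflexive (cong (ρ *_) (sym I-off))))
      where
      identity : ∀ p ρ x y z → p * x + ρ * z ≡ p * 1ℚ * x + ρ * 0ℚ * y + ρ * 1ℚ * z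
      identity = solve-∀ ring
    bound sink-only = subst (p * (q^ d * Z ts′ (D ∖ v)) + ρ * Z ts′ (D ∖ v) ≤_)
      (identity p ρ (I src) (I snk) (I off))
      (+-mono-≤ (*-monoˡ 0≤p (I-on λ ())) (≤-reflexive (cong (ρ *_) (sym I-off))))
      where
      identity : ∀ p ρ x y z → p * y + ρ * z ≡ 0ℚ * ρ * x + 1ℚ * p * y + 1ℚ * ρ * z
      identity = solve-∀ ring

  -- Positive correlation of signs and the removal of an edge.

  sign active : Spin → ℚ
  sign src = 1ℚ
  sign snk = - 1ℚ
  sign off = 0ℚ
  active src = 1ℚ
  active snk = 1ℚ
  active off = 0ℚ

  0≤active : ∀ a → 0ℚ ≤ active a
  0≤active src = 0≤1
  0≤active snk = 0≤1
  0≤active off = ≤-refl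

  sign^ : ℕ → Spin → ℚ
  sign^ zero    a = 1ℚ
  sign^ (suc k) a = sign a * sign^ k a

  -- A monomial in the signs. The exponents cannot be reduced modulo 2, because the square of `sign`
  -- is `active` and not 1.
  character : ∀ {n} → Vec ℕ n → Vec Spin n → ℚ
  character []       []      = 1ℚ
  character (k ∷ ks) (a ∷ σ) = sign^ k a * character ks σ

  character-suc : ∀ {n} (ks : Vec ℕ n) x σ →
    character (ks [ x ]%= suc) σ ≡ sign (lookup σ x) * character ks σ
  character-suc (k ∷ ks) zero    (a ∷ σ) = *-assoc (sign a) (sign^ k a) (character ks σ)
  character-suc (k ∷ ks) (suc x) (a ∷ σ) = trans
    (cong (sign^ k a *_) (character-suc ks x σ))
    (*-exchange (sign^ k a) (sign (lookup σ x)) (character ks σ))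

  sign^-src : ∀ k → sign^ k src ≡ 1ℚ
  sign^-src zero    = refl
  sign^-src (suc k) = cong (1ℚ *_) (sign^-src k)

  sign^-snk : ∀ k → sign^ k snk ≡ 1ℚ ⊎ sign^ k snk ≡ - 1ℚ
  sign^-snk zero = inj₁ refl
  sign^-snk (suc k) with sign^-snk k
  ... | inj₁ eq = inj₂ (cong (- 1ℚ *_) eq)
  ... | inj₂ eq = inj₁ (cong (- 1ℚ *_) eq)

  0≤sign^-off : ∀ k → 0ℚ ≤ sign^ k off
  0≤sign^-off zero    = 0≤1
  0≤sign^-off (suc k) = ≤-reflexive (sym (*-zeroˡ (sign^ k off)))

  -- Invariance under exchanging src and snk at each vertex separately, not merely at all vertices
  -- at once; this allows the signs to be summed one vertex at a time.
  Even : ∀ {n} → (Vec Spin n → ℚ) → Set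
  Even f = ∀ σ τ → Vec.map active σ ≡ Vec.map active τ → f σ ≡ f τ

  ω-balanced : ∀ t → TwoSided t → ω t src ≡ ω t snk
  ω-balanced (true  , true)  _ = *-comm p ρ
  ω-balanced (false , false) _ = refl

  -- Once the set of active vertices is fixed, the signs are independent and symmetric: the terms
  -- for src and snk cancel if the exponent is odd and add up if it is even.
  0≤∑-character : ∀ {n} (ts : Vec Type n) → AllTwoSided ts → ∀ ks {f} →
    Even f → (∀ σ → 0ℚ ≤ f σ) → 0ℚ ≤ ∑ ts (λ σ → f σ * character ks σ)
  0≤∑-character []       two []       even 0≤f = *-nonneg (0≤f []) 0≤1
  0≤∑-character (t ∷ ts) two (k ∷ ks) {f} even 0≤f = subst (0ℚ ≤_) (sym total)
    (+-nonneg (pair (sign^-snk k)) (*-nonneg (0≤ω t off) (*-nonneg (0≤sign^-off k) (0≤J off))))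
    where
    J : Spin → ℚ
    J a = ∑ ts (λ σ → f (a ∷ σ) * character ks σ)
    0≤J : ∀ a → 0ℚ ≤ J a
    0≤J a = 0≤∑-character ts (λ v → two (suc v)) ks
      (λ σ τ eq → even (a ∷ σ) (a ∷ τ) (cong (active a ∷_) eq)) (λ σ → 0≤f (a ∷ σ))
    J-balanced : J snk ≡ J src
    J-balanced = ∑-cong ts λ σ → cong (_* character ks σ) (even (snk ∷ σ) (src ∷ σ) refl)
    term : ∀ a → ∑ ts (λ σ → f (a ∷ σ) * (sign^ k a * character ks σ)) ≡ sign^ k a * J a
    term a = trans (∑-cong ts λ σ → *-exchange (f (a ∷ σ)) (sign^ k a) (character ks σ))
                   (∑-*ˡ ts (sign^ k a) λ σ → f (a ∷ σ) * character ks σ)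
    total : Σ₃ (λ a → ω t a * ∑ ts (λ σ → f (a ∷ σ) * (sign^ k a * character ks σ))) ≡
            ω t src * (J src + sign^ k snk * J src) + ω t off * (sign^ k off * J off)
    total = trans (Σ₃-cong λ a → cong (ω t a *_) (term a)) (trans
      (cong (_+ ω t off * (sign^ k off * J off)) (cong₂ _+_
        (cong (λ s → ω t src * (s * J src)) (sign^-src k))
        (cong₂ (λ w j → w * (sign^ k snk * j)) (sym (ω-balanced t (two zero))) J-balanced)))
      (identity (ω t src) (J src) (sign^ k snk) (ω t off * (sign^ k off * J off))))
      where
      identity : ∀ w j s z → w * (1ℚ * j) + w * (s * j) + z ≡ w * (j + s * j) + z
      identity = solve-∀ ring
    pair : sign^ k snk ≡ 1ℚ ⊎ sign^ k snk ≡ - 1ℚ →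
           0ℚ ≤ ω t src * (J src + sign^ k snk * J src)
    pair (inj₁ eq) = subst (λ s → 0ℚ ≤ ω t src * (J src + s * J src)) (sym eq)
      (*-nonneg (0≤ω t src) (+-nonneg (0≤J src) (*-nonneg 0≤1 (0≤J src))))
    pair (inj₂ eq) = subst (λ s → 0ℚ ≤ ω t src * (J src + s * J src)) (sym eq)
      (≤-reflexive (identity (ω t src) (J src)))
      where
      identity : ∀ w j → 0ℚ ≡ w * (j + - 1ℚ * j)
      identity = solve-∀ ring

  -- Both coefficients are nonnegative, so the interaction is ferromagnetic.
  link-expand : ∀ a b →
    link a b ≡ (1ℚ - ½ * p * (active a * active b)) + ½ * p * (sign a * sign b)
  link-expand off b = identity ρ (active b) (sign b)
    where
    identity : ∀ ρ x y → 1ℚ ≡ (1ℚ - ½ * (1ℚ - ρ) * (0ℚ * x)) + ½ * (1ℚ - ρ) * (0ℚ * y)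
    identity = solve-∀ ring
  link-expand src off = identity ρ
    where
    identity : ∀ ρ → 1ℚ ≡ (1ℚ - ½ * (1ℚ - ρ) * (1ℚ * 0ℚ)) + ½ * (1ℚ - ρ) * (1ℚ * 0ℚ)
    identity = solve-∀ ring
  link-expand snk off = identity ρ
    where
    identity : ∀ ρ → 1ℚ ≡ (1ℚ - ½ * (1ℚ - ρ) * (1ℚ * 0ℚ)) + ½ * (1ℚ - ρ) * (- 1ℚ * 0ℚ)
    identity = solve-∀ ring
  link-expand src src = identity ρ
    where
    identity : ∀ ρ → 1ℚ ≡ (1ℚ - ½ * (1ℚ - ρ) * (1ℚ * 1ℚ)) + ½ * (1ℚ - ρ) * (1ℚ * 1ℚ)
    identity = solve-∀ ring
  link-expand snk snk = identity ρ
    where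
    identity : ∀ ρ → 1ℚ ≡ (1ℚ - ½ * (1ℚ - ρ) * (1ℚ * 1ℚ)) + ½ * (1ℚ - ρ) * (- 1ℚ * - 1ℚ)
    identity = solve-∀ ring
  link-expand src snk = identity ρ
    where
    identity : ∀ ρ → ρ ≡ (1ℚ - ½ * (1ℚ - ρ) * (1ℚ * 1ℚ)) + ½ * (1ℚ - ρ) * (1ℚ * - 1ℚ)
    identity = solve-∀ ring
  link-expand snk src = identity ρ
    where
    identity : ∀ ρ → ρ ≡ (1ℚ - ½ * (1ℚ - ρ) * (1ℚ * 1ℚ)) + ½ * (1ℚ - ρ) * (- 1ℚ * 1ℚ)
    identity = solve-∀ ring

  0≤½p : 0ℚ ≤ ½ * p
  0≤½p = *-nonneg (<⇒≤ (positive⁻¹ ½)) 0≤p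

  0≤1-½p*active : ∀ a b → 0ℚ ≤ 1ℚ - ½ * p * (active a * active b)
  0≤1-½p*active a b = 0≤- (*-mono-≤ {b = 1ℚ} {d = 1ℚ} 0≤½p (*-nonneg (0≤active a) (0≤active b)) ½p≤1
    (*-mono-≤ {b = 1ℚ} {d = 1ℚ} (0≤active a) (0≤active b) (active≤1 a) (active≤1 b)))
    where
    active≤1 : ∀ a → active a ≤ 1ℚ
    active≤1 src = ≤-refl
    active≤1 snk = ≤-refl
    active≤1 off = 0≤1
    ½p≤1 : ½ * p ≤ 1ℚ
    ½p≤1 = ≤-of-sum (½ + ½ * ρ) (+-nonneg (<⇒≤ (positive⁻¹ ½)) (*-nonneg (<⇒≤ (positive⁻¹ ½)) 0≤ρ)) (identity ρ)
      where
      identity : ∀ ρ → 1ℚ ≡ ½ * (1ℚ - ρ) + (½ + ½ * ρ)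
      identity = solve-∀ ring

  -- Griffiths' first inequality: expanding the links leaves characters only, and
  -- these have nonnegative sums because src and snk have equal weights.
  griffiths : ∀ {n} (ts : Vec Type n) → AllTwoSided ts → ∀ D ks {f} →
    Even f → (∀ σ → 0ℚ ≤ f σ) → 0ℚ ≤ ∑ ts (λ σ → f σ * character ks σ * links D σ)
  griffiths ts two [] ks {f} even 0≤f = subst (0ℚ ≤_)
    (∑-cong ts λ σ → sym (*-identityʳ (f σ * character ks σ))) (0≤∑-character ts two ks even 0≤f)
  griffiths ts two ((x , y) ∷ D) ks {f} even 0≤f = subst (0ℚ ≤_) (sym expand) (+-nonneg
    (griffiths ts two D ks
      (λ σ τ eq → cong₂ _*_ (even σ τ eq) (cong (λ z → 1ℚ - ½ * p * z)
        (cong₂ _*_ (active-at x eq) (active-at y eq))))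
      (λ σ → *-nonneg (0≤f σ) (0≤1-½p*active (lookup σ x) (lookup σ y))))
    (griffiths ts two D ks′
      (λ σ τ eq → cong (_* (½ * p)) (even σ τ eq))
      (λ σ → *-nonneg (0≤f σ) 0≤½p)))
    where
    ks′ = (ks [ y ]%= suc) [ x ]%= suc
    active-at : ∀ x {σ τ} → Vec.map active σ ≡ Vec.map active τ →
                active (lookup σ x) ≡ active (lookup τ x)
    active-at x {σ} {τ} eq = trans (sym (Vec.lookup-map x active σ))
      (trans (cong (λ v → lookup v x) eq) (Vec.lookup-map x active τ))
    even-part odd-part : Vec Spin _ → ℚ
    even-part σ = f σ * (1ℚ - ½ * p * (active (lookup σ x) * active (lookup σ y)))
      * character ks σ * links D σ
    odd-part σ = f σ * (½ * p) * character ks′ σ * links D σ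
    expand : ∑ ts (λ σ → f σ * character ks σ * links ((x , y) ∷ D) σ) ≡
             ∑ ts even-part + ∑ ts odd-part
    expand = trans (∑-cong ts λ σ → begin
      f σ * character ks σ * (link (lookup σ x) (lookup σ y) * links D σ)
        ≡⟨ cong (λ l → f σ * character ks σ * (l * links D σ)) (link-expand (lookup σ x) (lookup σ y)) ⟩
      f σ * character ks σ * (((1ℚ - ½ * p * (active (lookup σ x) * active (lookup σ y)))
        + ½ * p * (sign (lookup σ x) * sign (lookup σ y))) * links D σ)
        ≡⟨ identity (f σ) (character ks σ) (links D σ) (½ * p)
             (1ℚ - ½ * p * (active (lookup σ x) * active (lookup σ y)))
             (sign (lookup σ x)) (sign (lookup σ y)) ⟩
      even-part σ + f σ * (½ * p) * (sign (lookup σ x) * (sign (lookup σ y) * character ks σ)) * links D σ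
        ≡⟨ cong (λ h → even-part σ + f σ * (½ * p) * h * links D σ)
             (trans (character-suc (ks [ y ]%= suc) x σ)
                    (cong (sign (lookup σ x) *_) (character-suc ks y σ))) ⟨
      even-part σ + odd-part σ ∎)
      (∑-+ ts even-part odd-part)
      where
      open ≡-Reasoning
      identity : ∀ f h l u e s r → f * h * ((e + u * (s * r)) * l) ≡
                 f * e * h * l + f * u * (s * (r * h)) * l
      identity = solve-∀ ring

  -- Each of the two active spins has odds at most p : ρ against off, so a vertex is active with
  -- probability at most 2p/(2p + ρ) = 2p/(1 + p), also in the presence of a decreasing factor `k`.
  Σ₃-active : ∀ t (k : Spin → ℚ) → (∀ a → 0ℚ ≤ k a) → (∀ a → k a ≤ k off) →
    Σ₃ (λ a → ω t a * ((1ℚ + p) * active a * k a)) ≤ Σ₃ (λ a → ω t a * (2ℚ * p * k a))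
  Σ₃-active t k 0≤k k↓ = ≤-of-sum
    ((p * ω t off * k off - ω t src * ρ * k src) + (p * ω t off * k off - ω t snk * ρ * k snk))
    (+-nonneg (gap {src} λ ()) (gap {snk} λ ()))
    (identity ρ (ω t src) (ω t snk) (ω t off) (k src) (k snk) (k off))
    where
    gap : ∀ {a} → a ≢ off → 0ℚ ≤ p * ω t off * k off - ω t a * ρ * k a
    gap {a} a≢off = 0≤- (*-mono-≤ (*-nonneg (0≤ω t a) 0≤ρ) (0≤k a) (odds t a≢off) (k↓ a))
    identity : ∀ ρ u v w x y z → let p = 1ℚ - ρ in
      u * (2ℚ * p * x) + v * (2ℚ * p * y) + w * (2ℚ * p * z) ≡
      (u * ((1ℚ + p) * 1ℚ * x) + v * ((1ℚ + p) * 1ℚ * y) + w * ((1ℚ + p) * 0ℚ * z)) +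
      ((p * w * z - u * ρ * x) + (p * w * z - v * ρ * y))
    identity = solve-∀ ring

  ∑-active : ∀ {n} (ts : Vec Type n) x {k : Vec Spin n → ℚ} → (∀ σ → 0ℚ ≤ k σ) → DecreasingAt x k →
    (1ℚ + p) * ∑ ts (λ σ → active (lookup σ x) * k σ) ≤ 2ℚ * p * ∑ ts k
  ∑-active ts x {k} 0≤k k↓ = subst₂ _≤_
    (trans (∑-cong ts λ σ → *-assoc (1ℚ + p) (active (lookup σ x)) (k σ))
           (∑-*ˡ ts (1ℚ + p) λ σ → active (lookup σ x) * k σ))
    (∑-*ˡ ts (2ℚ * p) k)
    (∑-local ts x (λ a → (1ℚ + p) * active a) (λ _ → 2ℚ * p) (Σ₃-active (lookup ts x)) 0≤k k↓)

  -- The bounds for the two ends multiply although the ends are dependent: switching `x` off leaves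
  -- the factor of `y` unchanged, so that factor may belong to the decreasing function in the bound
  -- for `x`.
  ∑-active₂ : ∀ {n} (ts : Vec Type n) {x y} → x ≢ y → ∀ D →
    c * ∑ ts (λ σ → active (lookup σ x) * (active (lookup σ y) * links D σ)) ≤
    2ℚ * p * (2ℚ * p) * Z ts D
  ∑-active₂ ts {x} {y} x≢y D = begin
    c * ∑ ts (λ σ → active (lookup σ x) * K σ)
      ≡⟨ *-assoc (1ℚ + p) (1ℚ + p) (∑ ts λ σ → active (lookup σ x) * K σ) ⟩
    (1ℚ + p) * ((1ℚ + p) * ∑ ts (λ σ → active (lookup σ x) * K σ))
      ≤⟨ *-monoˡ (<⇒≤ 0<1+p) (∑-active ts x 0≤K K↓) ⟩
    (1ℚ + p) * (2ℚ * p * ∑ ts K)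
      ≡⟨ *-exchange (1ℚ + p) (2ℚ * p) (∑ ts K) ⟩
    2ℚ * p * ((1ℚ + p) * ∑ ts K)
      ≤⟨ *-monoˡ (*-nonneg (<⇒≤ (positive⁻¹ 2ℚ)) 0≤p)
           (∑-active ts y (0≤links D) λ σ → links-↓ D (lookup-off σ y)) ⟩
    2ℚ * p * (2ℚ * p * Z ts D)
      ≡⟨ *-assoc (2ℚ * p) (2ℚ * p) (Z ts D) ⟨
    2ℚ * p * (2ℚ * p) * Z ts D ∎
    where
    open ≤-Reasoning
    K : Vec Spin _ → ℚ
    K σ = active (lookup σ y) * links D σ
    0≤K : ∀ σ → 0ℚ ≤ K σ
    0≤K σ = *-nonneg (0≤active (lookup σ y)) (0≤links D σ)
    K↓ : DecreasingAt x K
    K↓ σ = *-mono-≤ (0≤active (lookup σ y)) (0≤links D σ)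
      (≤-reflexive (cong active (sym (Vec.lookup∘update′ (x≢y ∘ sym) σ off))))
      (links-↓ D (lookup-off σ x))

  -- By `link-expand` the edge lowers Z by ½p(α - β), where α sums the configurations with both ends
  -- active and β weighs them with the product of the signs. Here β ≥ 0 by Griffiths and (1+p)²α ≤
  -- 4p² Z, so the loss is at most 2p³/(1+p)² = η times Z.
  remove-edge : ∀ {n} (ts : Vec Type n) → AllTwoSided ts → ∀ e D → g * Z ts D ≤ Z ts (e ∷ D)
  remove-edge ts two (x , y) D with x Fin.≟ y
  ... | yes refl = subst (g * Z ts D ≤_)
    (trans (sym (∑-*ˡ ts 1ℚ (links D)))
           (∑-cong ts λ σ → cong (_* links D σ) (sym (link-diag (lookup σ x)))))
    (*-monoʳ (0≤∑ ts (0≤links D)) g≤1)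
  ... | no  x≢y  = ≤-modulo {z = Z ts D} 0<c cη
    (+-nonneg (*-nonneg 0≤½p (0≤- (∑-active₂ ts x≢y D))) (*-nonneg (*-nonneg (<⇒≤ 0<c) 0≤½p) 0≤β))
    (trans (cong (λ z → c * (z - g * Z ts D)) expand) (identity p η (Z ts D) α β))
    where
    α β : ℚ
    α = ∑ ts (λ σ → active (lookup σ x) * (active (lookup σ y) * links D σ))
    β = ∑ ts (λ σ → sign (lookup σ x) * (sign (lookup σ y) * links D σ))
    0≤β : 0ℚ ≤ β
    0≤β = subst (0ℚ ≤_) (∑-cong ts λ σ → begin
      1ℚ * character ((zeros [ y ]%= suc) [ x ]%= suc) σ * links D σ
        ≡⟨ cong (λ h → 1ℚ * h * links D σ) (trans (character-suc (zeros [ y ]%= suc) x σ)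
             (cong (sign (lookup σ x) *_) (trans (character-suc zeros y σ)
               (cong (sign (lookup σ y) *_) (character-0 σ))))) ⟩
      1ℚ * (sign (lookup σ x) * (sign (lookup σ y) * 1ℚ)) * links D σ
        ≡⟨ unit (sign (lookup σ x)) (sign (lookup σ y)) (links D σ) ⟩
      sign (lookup σ x) * (sign (lookup σ y) * links D σ) ∎)
      (griffiths ts two D ((zeros [ y ]%= suc) [ x ]%= suc) {λ _ → 1ℚ} (λ _ _ _ → refl) (λ _ → 0≤1))
      where
      open ≡-Reasoning
      zeros : ∀ {n} → Vec ℕ n
      zeros = Vec.replicate _ 0
      character-0 : ∀ {n} (σ : Vec Spin n) → character zeros σ ≡ 1ℚ
      character-0 []      = refl
      character-0 (a ∷ σ) = trans (*-identityˡ (character zeros σ)) (character-0 σ)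
      unit : ∀ a b l → 1ℚ * (a * (b * 1ℚ)) * l ≡ a * (b * l)
      unit = solve-∀ ring
    expand : Z ts ((x , y) ∷ D) ≡ Z ts D + (- (½ * p) * α + ½ * p * β)
    expand = begin
      Z ts ((x , y) ∷ D)
        ≡⟨ (∑-cong ts λ σ → trans (cong (_* links D σ) (link-expand (lookup σ x) (lookup σ y)))
             (distrib (½ * p) (active (lookup σ x)) (active (lookup σ y))
                      (sign (lookup σ x)) (sign (lookup σ y)) (links D σ))) ⟩
      ∑ ts (λ σ → links D σ + (f σ + h σ))
        ≡⟨ ∑-+ ts (links D) (λ σ → f σ + h σ) ⟩
      Z ts D + ∑ ts (λ σ → f σ + h σ)
        ≡⟨ cong (Z ts D +_) (trans (∑-+ ts f h) (cong₂ _+_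
             (∑-*ˡ ts (- (½ * p)) λ σ → active (lookup σ x) * (active (lookup σ y) * links D σ))
             (∑-*ˡ ts (½ * p) λ σ → sign (lookup σ x) * (sign (lookup σ y) * links D σ)))) ⟩
      Z ts D + (- (½ * p) * α + ½ * p * β) ∎
      where
      open ≡-Reasoning
      f h : Vec Spin _ → ℚ
      f σ = - (½ * p) * (active (lookup σ x) * (active (lookup σ y) * links D σ))
      h σ = ½ * p * (sign (lookup σ x) * (sign (lookup σ y) * links D σ))
      distrib : ∀ u a b s r l →
        ((1ℚ - u * (a * b)) + u * (s * r)) * l ≡ l + (- u * (a * (b * l)) + u * (s * (r * l)))
      distrib = solve-∀ ring
    identity : ∀ p η z α β → let c = (1ℚ + p) * (1ℚ + p) in
      c * ((z + (- (½ * p) * α + ½ * p * β)) - (1ℚ - η) * z) ≡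
      (½ * p * (2ℚ * p * (2ℚ * p) * z - c * α) + c * (½ * p) * β) + z * (c * η - 2ℚ * p * p * p)
    identity = solve-∀ ring

  Z-edgeless : ∀ {n} (ts : Vec Type n) → AllTwoSided ts → Z ts [] ≡ F (cost ts)
  Z-edgeless []                     two = refl
  Z-edgeless ((true  , true)  ∷ ts) two = trans (identity ρ (Z ts []))
    (cong (q *_) (Z-edgeless ts λ v → two (suc v)))
    where
    identity : ∀ ρ z → let p = 1ℚ - ρ; q = ρ * (1ℚ + p) in
      p * ρ * z + ρ * p * z + ρ * ρ * z ≡ q * z
    identity = solve-∀ ring
  Z-edgeless ((true  , false) ∷ ts) two = contradiction (two zero) λ ()
  Z-edgeless ((false , true)  ∷ ts) two = contradiction (two zero) λ ()
  Z-edgeless ((false , false) ∷ ts) two = trans (identity (Z ts []))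
    (Z-edgeless ts λ v → two (suc v))
    where
    identity : ∀ z → 0ℚ * 1ℚ * z + 1ℚ * 0ℚ * z + 1ℚ * 1ℚ * z ≡ z
    identity = solve-∀ ring

  -- The lower bound and the configurations that attain it.

  F≤Z-twoSided : ∀ {n} (ts : Vec Type n) → AllTwoSided ts → ∀ D → F (length D ℕ.+ cost ts) ≤ Z ts D
  F≤Z-twoSided ts two []      = ≤-reflexive (sym (Z-edgeless ts two))
  F≤Z-twoSided ts two (e ∷ D) = begin
    F (suc (length D ℕ.+ cost ts))  ≤⟨ F-suc (length D ℕ.+ cost ts) ⟩
    g * F (length D ℕ.+ cost ts)    ≤⟨ *-monoˡ 0≤g (F≤Z-twoSided ts two D) ⟩
    g * Z ts D                      ≤⟨ remove-edge ts two e D ⟩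
    Z ts (e ∷ D)                    ∎
    where open ≤-Reasoning

  remove-count : ∀ {n} (ts : Vec Type n) v D → OneSided (lookup ts v) →
    length D ℕ.+ cost ts ≡
    suc (degree v D) ℕ.+ (length (D ∖ v) ℕ.+ cost (ts [ v ]≔ isolated))
  remove-count ts v D one = begin
    length D ℕ.+ cost ts                          ≡⟨ cong₂ ℕ._+_ (length-∖ v D) (cost-remove ts v one) ⟩
    degree v D ℕ.+ length (D ∖ v) ℕ.+ suc (cost ts′)  ≡⟨ ℕ.+-suc _ (cost ts′) ⟩
    suc (degree v D ℕ.+ length (D ∖ v) ℕ.+ cost ts′)  ≡⟨ cong suc (ℕ.+-assoc (degree v D) _ _) ⟩
    suc (degree v D) ℕ.+ (length (D ∖ v) ℕ.+ cost ts′) ∎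
    where
    open ≡-Reasoning
    ts′ = ts [ v ]≔ isolated

  -- The list `vs` contains every vertex that may still be one-sided and makes the recursion
  -- structural, as `n` stays fixed when a vertex is isolated. Isolating a vertex makes it two-sided
  -- and changes no other type, so `vs` only shrinks.
  F≤Z-except : ∀ {n} vs (ts : Vec Type n) → (∀ v → v ∈ vs ⊎ TwoSided (lookup ts v)) → ∀ D →
               F (length D ℕ.+ cost ts) ≤ Z ts D
  F≤Z-except [] ts two D = F≤Z-twoSided ts (λ v → two′ v (two v)) D
    where
    two′ : ∀ v → v ∈ [] ⊎ TwoSided (lookup ts v) → TwoSided (lookup ts v)
    two′ v (inj₂ eq) = eq
  F≤Z-except (w ∷ vs) ts two D with sides (lookup ts w)
  ... | inj₁ w-two = F≤Z-except vs ts (λ v → skip v (two v)) D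
    where
    skip : ∀ v → v ∈ w ∷ vs ⊎ TwoSided (lookup ts v) → v ∈ vs ⊎ TwoSided (lookup ts v)
    skip v (inj₁ (here refl)) = inj₂ w-two
    skip v (inj₁ (there v∈))  = inj₁ v∈
    skip v (inj₂ eq)          = inj₂ eq
  ... | inj₂ w-one = begin
    F (length D ℕ.+ cost ts)                       ≡⟨ cong F (remove-count ts w D w-one) ⟩
    F (suc (degree w D) ℕ.+ (length (D ∖ w) ℕ.+ cost ts′))
      ≤⟨ F-+ (suc (degree w D)) (length (D ∖ w) ℕ.+ cost ts′) ⟩
    F (suc (degree w D)) * F (length (D ∖ w) ℕ.+ cost ts′)
      ≤⟨ *-mono-≤ (0≤F (suc (degree w D))) (0≤F (length (D ∖ w) ℕ.+ cost ts′))
           (F≤φ (degree w D)) (F≤Z-except vs ts′ two′ (D ∖ w)) ⟩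
    φ (degree w D) * Z ts′ (D ∖ w)                 ≤⟨ remove-oneSided ts w D w-one ⟩
    Z ts D                                         ∎
    where
    open ≤-Reasoning
    ts′ = ts [ w ]≔ isolated
    two′ : ∀ v → v ∈ vs ⊎ TwoSided (lookup ts′ v)
    two′ v with v Fin.≟ w | two v
    ... | yes refl | _ = inj₂ (subst TwoSided (sym (Vec.lookup∘update v ts isolated)) refl)
    ... | no  v≢w  | inj₁ (here v≡w)  = contradiction v≡w v≢w
    ... | no  v≢w  | inj₁ (there v∈)  = inj₁ v∈
    ... | no  v≢w  | inj₂ eq = inj₂ (subst TwoSided (sym (Vec.lookup∘update′ v≢w ts isolated)) eq)

  F≤Z : ∀ {n} (ts : Vec Type n) D → F (length D ℕ.+ cost ts) ≤ Z ts D
  F≤Z ts = F≤Z-except (List.allFin _) ts (λ v → inj₁ (∈-allFin v))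

  -- `F-suc` is an equality at even arguments, and two-sided types have an even `cost`.
  F-suc-cost : ∀ {n} (ts : Vec Type n) → AllTwoSided ts → F (suc (cost ts)) ≡ g * F (cost ts)
  F-suc-cost []                      two = sym (*-identityʳ g)
  F-suc-cost (joined ∷ ts)           two =
    trans (cong (q *_) (F-suc-cost ts λ v → two (suc v))) (*-exchange q g (F (cost ts)))
  F-suc-cost (isolated ∷ ts)         two = F-suc-cost ts λ v → two (suc v)
  F-suc-cost ((true  , false) ∷ ts)  two = contradiction (two zero) λ ()
  F-suc-cost ((false , true)  ∷ ts)  two = contradiction (two zero) λ ()

  twoSided-update : ∀ {n} (ts : Vec Type n) v → AllTwoSided ts → AllTwoSided (ts [ v ]≔ isolated)
  twoSided-update ts v two w with w Fin.≟ v
  ... | yes refl = subst TwoSided (sym (Vec.lookup∘update w ts isolated)) refl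
  ... | no  w≢v  = subst TwoSided (sym (Vec.lookup∘update′ w≢v ts isolated)) (two w)

  Z-one-edge : ∀ {n} (ts : Vec Type n) {x y} → AllTwoSided ts → x ≢ y →
    lookup ts x ≡ joined → lookup ts y ≡ joined → Z ts ((x , y) ∷ []) ≡ F (suc (cost ts))
  Z-one-edge ts {x} {y} two x≢y tx ty = begin
    Z ts ((x , y) ∷ [])
      ≡⟨ ∑-split ts x (links ((x , y) ∷ [])) ⟩
    Σ₃ (λ a → ω (lookup ts x) a * ∑ ts₁ (λ σ → ℓ (σ [ x ]≔ a)))
      ≡⟨ Σ₃-cong (λ a → cong₂ (λ t z → ω t a * z) tx (trans (∑-split ts₁ y λ σ → ℓ (σ [ x ]≔ a))
           (Σ₃-cong λ b → cong₂ (λ t z → ω t b * z) ty₁ (constant a b)))) ⟩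
    Σ₃ (λ a → ω joined a * Σ₃ (λ b → ω joined b * (link a b * Z₀)))
      -- The solver does not know the value of `η`; the last summand is the multiple of the equation
      -- `cη` by which the two sides differ as polynomials.
      ≡⟨ identity ρ η Z₀ ⟩
    q * (q * (g * Z₀)) + ρ * ρ * Z₀ * (c * η - 2ℚ * p * p * p)
      ≡⟨ cong (λ z → q * (q * (g * Z₀)) + ρ * ρ * Z₀ * (z - 2ℚ * p * p * p)) cη ⟩
    q * (q * (g * Z₀)) + ρ * ρ * Z₀ * (2ℚ * p * p * p - 2ℚ * p * p * p)
      ≡⟨ vanish (q * (q * (g * Z₀))) (ρ * ρ * Z₀) (2ℚ * p * p * p) ⟩
    q * (q * (g * Z₀))
      ≡⟨ cong (λ z → q * (q * (g * z))) (Z-edgeless ts₂ two₂) ⟩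
    q * (q * (g * F (cost ts₂)))
      ≡⟨ cong (λ z → q * (q * z)) (F-suc-cost ts₂ two₂) ⟨
    F (suc (suc (suc (suc (suc (cost ts₂))))))
      ≡⟨ cong F (cong suc (trans (cost-joined ts x tx) (cong (λ k → suc (suc k)) (cost-joined ts₁ y ty₁)))) ⟨
    F (suc (cost ts)) ∎
    where
    open ≡-Reasoning
    ts₁ = ts [ x ]≔ isolated
    ts₂ = ts₁ [ y ]≔ isolated
    Z₀ = Z ts₂ []
    ℓ : Vec Spin _ → ℚ
    ℓ = links ((x , y) ∷ [])
    ty₁ : lookup ts₁ y ≡ joined
    ty₁ = trans (Vec.lookup∘update′ (x≢y ∘ sym) ts isolated) ty
    two₂ : AllTwoSided ts₂
    two₂ = twoSided-update ts₁ y (twoSided-update ts x two)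
    constant : ∀ a b → ∑ ts₂ (λ σ → ℓ ((σ [ y ]≔ b) [ x ]≔ a)) ≡ link a b * Z₀
    constant a b = trans
      (∑-cong ts₂ λ σ → cong (λ l → l * 1ℚ) (cong₂ link
        (Vec.lookup∘update x (σ [ y ]≔ b) a)
        (trans (Vec.lookup∘update′ (x≢y ∘ sym) (σ [ y ]≔ b) a) (Vec.lookup∘update y σ b))))
      (∑-*ˡ ts₂ (link a b) λ _ → 1ℚ)
    vanish : ∀ u v w → u + v * (w - w) ≡ u
    vanish = solve-∀ ring
    identity : ∀ ρ η z → let p = 1ℚ - ρ; q = ρ * (1ℚ + p) in
        p * ρ * (p * ρ * (1ℚ * z) + ρ * p * (ρ * z) + ρ * ρ * (1ℚ * z))
      + ρ * p * (p * ρ * (ρ * z) + ρ * p * (1ℚ * z) + ρ * ρ * (1ℚ * z))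
      + ρ * ρ * (p * ρ * (1ℚ * z) + ρ * p * (1ℚ * z) + ρ * ρ * (1ℚ * z))
      ≡ q * (q * ((1ℚ - η) * z)) + ρ * ρ * z * ((1ℚ + p) * (1ℚ + p) * η - 2ℚ * p * p * p)
    identity = solve-∀ ring

  Z-shape : ∀ {n} (ts : Vec Type n) {D} → AllTwoSided ts → Shape ts D →
            Z ts D ≡ F (length D ℕ.+ cost ts)
  Z-shape ts two no-edge               = Z-edgeless ts two
  Z-shape ts two (one-edge x≢y tx ty)  = Z-one-edge ts two x≢y tx ty

  Z-isolated : ∀ {n} (ts : Vec Type n) v D → lookup ts v ≡ isolated → Z ts D ≡ Z ts (D ∖ v)
  Z-isolated ts v D tv = begin
    Z ts D                                           ≡⟨ only-off (links D) ⟩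
    ∑ ts′ (λ σ → links D (σ [ v ]≔ off))             ≡⟨ ∑-cong ts′ (links-∖ v D) ⟩
    Z ts′ (D ∖ v)                                    ≡⟨ cong (λ ts → Z ts (D ∖ v)) ts′≡ts ⟩
    Z ts (D ∖ v)                                     ∎
    where
    open ≡-Reasoning
    ts′ = ts [ v ]≔ isolated
    ts′≡ts : ts′ ≡ ts
    ts′≡ts = trans (cong (ts [ v ]≔_) (sym tv)) (Vec.[]≔-lookup ts v)
    only-off : ∀ f → ∑ ts f ≡ ∑ ts′ (λ σ → f (σ [ v ]≔ off))
    only-off f = trans (∑-split ts v f) (trans
      (Σ₃-cong λ a → cong (λ t → ω t a * ∑ ts′ (λ σ → f (σ [ v ]≔ a))) tv)
      (identity (∑ ts′ (λ σ → f (σ [ v ]≔ src))) (∑ ts′ (λ σ → f (σ [ v ]≔ snk)))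
                (∑ ts′ (λ σ → f (σ [ v ]≔ off)))))
      where
      identity : ∀ x y z → 0ℚ * 1ℚ * x + 1ℚ * 0ℚ * y + 1ℚ * 1ℚ * z ≡ z
      identity = solve-∀ ring

0≤½ : 0ℚ ≤ ½
0≤½ = from-yes (0ℚ ≤? ½)

½≤1 : ½ ≤ 1ℚ
½≤1 = from-yes (½ ≤? 1ℚ)

-- The case of equality at ρ = ½.

module Strict where
  open Half
  open Model ½ 0≤½ ½≤1

  F<Z-oneSided : ∀ {n} (ts : Vec Type n) v D → OneSided (lookup ts v) →
                 F (length D ℕ.+ cost ts) < Z ts D
  F<Z-oneSided ts v D one = begin-strict
    F (length D ℕ.+ cost ts)              ≡⟨ cong F (remove-count ts v D one) ⟩
    F (suc d ℕ.+ M)                       ≤⟨ F-+ (suc d) M ⟩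
    F (suc d) * F M                       <⟨ *-monoʳ-< (0<F M) (F<φ d) ⟩
    φ d * F M                             ≤⟨ *-monoˡ (≤-trans (0≤F (suc d)) (F≤φ d)) (F≤Z ts′ (D ∖ v)) ⟩
    φ d * Z ts′ (D ∖ v)                   ≤⟨ remove-oneSided ts v D one ⟩
    Z ts D                                ∎
    where
    open ≤-Reasoning
    ts′ = ts [ v ]≔ isolated
    d = degree v D
    M = length (D ∖ v) ℕ.+ cost ts′

  F<Z-two-edges : ∀ {n} (ts : Vec Type n) → AllTwoSided ts → ∀ e e′ D →
                  F (suc (suc (length D ℕ.+ cost ts))) < Z ts (e ∷ e′ ∷ D)
  F<Z-two-edges ts two e e′ D = begin-strict
    q * F M                 <⟨ *-monoʳ-< (0<F M) q<g*g ⟩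
    g * g * F M             ≡⟨ *-assoc g g (F M) ⟩
    g * (g * F M)           ≤⟨ *-monoˡ 0≤g (*-monoˡ 0≤g (F≤Z-twoSided ts two D)) ⟩
    g * (g * Z ts D)        ≤⟨ *-monoˡ 0≤g (remove-edge ts two e′ D) ⟩
    g * Z ts (e′ ∷ D)       ≤⟨ remove-edge ts two e (e′ ∷ D) ⟩
    Z ts (e ∷ e′ ∷ D)       ∎
    where
    open ≤-Reasoning
    M = length D ℕ.+ cost ts

  -- The equation for `∖` says that `e` meets `v`. An isolated vertex is always off, so the link of
  -- `e` is 1 and Z does not drop at all, whereas the bound drops by the factor g < 1.
  F<Z-isolated : ∀ {n} (ts : Vec Type n) → AllTwoSided ts → ∀ v e →
    (e ∷ []) ∖ v ≡ [] → lookup ts v ≡ isolated → F (suc (cost ts)) < Z ts (e ∷ [])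
  F<Z-isolated ts two v e e∖v tv = begin-strict
    F (suc (cost ts))    ≤⟨ F-suc (cost ts) ⟩
    g * F (cost ts)      <⟨ *-monoʳ-< (0<F (cost ts)) g<1 ⟩
    1ℚ * F (cost ts)     ≡⟨ *-identityˡ (F (cost ts)) ⟩
    F (cost ts)          ≡⟨ Z-edgeless ts two ⟨
    Z ts []              ≡⟨ trans (Z-isolated ts v (e ∷ []) tv) (cong (Z ts) e∖v) ⟨
    Z ts (e ∷ [])        ∎
    where open ≤-Reasoning

  twoSided-joined : ∀ t → TwoSided t → t ≢ isolated → t ≡ joined
  twoSided-joined (true  , true)  _ _   = refl
  twoSided-joined (false , false) _ ≢is = contradiction refl ≢is

  tight-twoSided : ∀ {n} (ts : Vec Type n) D → Z ts D ≤ F (length D ℕ.+ cost ts) → AllTwoSided ts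
  tight-twoSided ts D Z≤F v with sides (lookup ts v)
  ... | inj₁ two = two
  ... | inj₂ one = contradiction (<-≤-trans (F<Z-oneSided ts v D one) Z≤F) (<-irrefl refl)

  tight-shape : ∀ {n} (ts : Vec Type n) D → (∀ {x y} → D ≡ (x , y) ∷ [] → x ≢ y) →
                Z ts D ≤ F (length D ℕ.+ cost ts) → Shape ts D
  tight-shape ts []            loopless Z≤F = no-edge
  tight-shape ts ((x , y) ∷ []) loopless Z≤F = one-edge (loopless refl)
    (twoSided-joined (lookup ts x) (two x) λ tx → <-irrefl refl
      (<-≤-trans (F<Z-isolated ts two x (x , y) ∖x tx) Z≤F))
    (twoSided-joined (lookup ts y) (two y) λ ty → <-irrefl refl
      (<-≤-trans (F<Z-isolated ts two y (x , y) ∖y ty) Z≤F))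
    where
    two = tight-twoSided ts ((x , y) ∷ []) Z≤F
    ∖x : ((x , y) ∷ []) ∖ x ≡ []
    ∖x with x Fin.≟ x
    ... | yes _   = refl
    ... | no  x≢x = contradiction refl x≢x
    ∖y : ((x , y) ∷ []) ∖ y ≡ []
    ∖y with x Fin.≟ y | y Fin.≟ y
    ... | yes _ | _       = refl
    ... | no  _ | yes _   = refl
    ... | no  _ | no  y≢y = contradiction refl y≢y
  tight-shape ts (e ∷ e′ ∷ D)  loopless Z≤F =
    contradiction (<-≤-trans (F<Z-two-edges ts (tight-twoSided ts (e ∷ e′ ∷ D) Z≤F) e e′ D) Z≤F)
                  (<-irrefl refl)

-- Spanning subgraphs and spins

⟦_⟧ : Bool → ℚ
⟦ true ⟧  = 1ℚ
⟦ false ⟧ = 0ℚ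

⟦∧⟧ : ∀ a b → ⟦ a ∧ b ⟧ ≡ ⟦ a ⟧ * ⟦ b ⟧
⟦∧⟧ true  b = sym (*-identityˡ ⟦ b ⟧)
⟦∧⟧ false b = sym (*-zeroˡ ⟦ b ⟧)

listProd : ∀ {A : Set} → (A → ℚ) → List A → ℚ
listProd f xs = foldr (λ x r → f x * r) 1ℚ xs

listSum : ∀ {A : Set} → (A → ℚ) → List A → ℚ
listSum f xs = foldr (λ x r → f x + r) 0ℚ xs

listSum-++ : ∀ {A : Set} (f : A → ℚ) xs ys → listSum f (xs ++ ys) ≡ listSum f xs + listSum f ys
listSum-++ f []       ys = sym (+-identityˡ (listSum f ys))
listSum-++ f (x ∷ xs) ys =
  trans (cong (f x +_) (listSum-++ f xs ys)) (sym (+-assoc (f x) (listSum f xs) (listSum f ys)))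

listSum-map : ∀ {A B : Set} (f : B → ℚ) (h : A → B) xs → listSum f (map h xs) ≡ listSum (λ x → f (h x)) xs
listSum-map f h []       = refl
listSum-map f h (x ∷ xs) = cong (f (h x) +_) (listSum-map f h xs)

listSum-*ˡ : ∀ {A : Set} {f h : A → ℚ} c → (∀ x → f x ≡ c * h x) → ∀ xs →
             listSum f xs ≡ c * listSum h xs
listSum-*ˡ         c f≡ch []       = sym (*-zeroʳ c)
listSum-*ˡ {h = h} c f≡ch (x ∷ xs) =
  trans (cong₂ _+_ (f≡ch x) (listSum-*ˡ c f≡ch xs)) (sym (*-distribˡ-+ c (h x) (listSum h xs)))

compatible : ∀ {A : Set} → (A → Bool → Bool) → ∀ xs → Subset (length {A = A} xs) → Bool
compatible φ []       []      = true
compatible φ (x ∷ xs) (b ∷ S) = φ x b ∧ compatible φ xs S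

compatible⁺ : ∀ {A : Set} (φ : A → Bool → Bool) xs S →
  (∀ i → φ (List.lookup xs i) (lookup S i) ≡ true) → compatible φ xs S ≡ true
compatible⁺ φ []       []      h = refl
compatible⁺ φ (x ∷ xs) (b ∷ S) h rewrite h zero = compatible⁺ φ xs S (λ i → h (suc i))

compatible⁻ : ∀ {A : Set} (φ : A → Bool → Bool) xs S i →
  φ (List.lookup xs i) (lookup S i) ≡ false → compatible φ xs S ≡ false
compatible⁻ φ (x ∷ xs) (b ∷ S) zero    eq rewrite eq = refl
compatible⁻ φ (x ∷ xs) (b ∷ S) (suc i) eq with φ x b
... | true  = compatible⁻ φ xs S i eq
... | false = refl

survivalℚ : ℚ → ∀ {m} → Subset m → ℚ
survivalℚ ρ []            = 1ℚ
survivalℚ ρ (inside  ∷ S) = (1ℚ - ρ) * survivalℚ ρ S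
survivalℚ ρ (outside ∷ S) = ρ * survivalℚ ρ S

module Expectation (ρ : ℚ) where

  private
    p = 1ℚ - ρ

  𝔼 : ∀ m → (Subset m → ℚ) → ℚ
  𝔼 zero    f = f []
  𝔼 (suc m) f = p * 𝔼 m (λ S → f (inside ∷ S)) + ρ * 𝔼 m (λ S → f (outside ∷ S))

  𝔼-cong : ∀ m {f h : Subset m → ℚ} → (∀ S → f S ≡ h S) → 𝔼 m f ≡ 𝔼 m h
  𝔼-cong zero    f≡h = f≡h []
  𝔼-cong (suc m) f≡h = cong₂ (λ x y → p * x + ρ * y)
    (𝔼-cong m λ S → f≡h (inside ∷ S)) (𝔼-cong m λ S → f≡h (outside ∷ S))

  𝔼-+ : ∀ m (f h : Subset m → ℚ) → 𝔼 m (λ S → f S + h S) ≡ 𝔼 m f + 𝔼 m h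
  𝔼-+ zero    f h = refl
  𝔼-+ (suc m) f h = trans (cong₂ (λ x y → p * x + ρ * y)
      (𝔼-+ m (λ S → f (inside ∷ S)) (λ S → h (inside ∷ S)))
      (𝔼-+ m (λ S → f (outside ∷ S)) (λ S → h (outside ∷ S))))
    (identity p ρ (𝔼 m λ S → f (inside ∷ S)) (𝔼 m λ S → h (inside ∷ S))
                  (𝔼 m λ S → f (outside ∷ S)) (𝔼 m λ S → h (outside ∷ S)))
    where
    identity : ∀ p r a b c d → p * (a + b) + r * (c + d) ≡ (p * a + r * c) + (p * b + r * d)
    identity = solve-∀ ring

  𝔼-*ˡ : ∀ m c (f : Subset m → ℚ) → 𝔼 m (λ S → c * f S) ≡ c * 𝔼 m f
  𝔼-*ˡ zero    c f = refl
  𝔼-*ˡ (suc m) c f = trans (cong₂ (λ x y → p * x + ρ * y)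
      (𝔼-*ˡ m c (λ S → f (inside ∷ S))) (𝔼-*ˡ m c (λ S → f (outside ∷ S))))
    (identity p ρ c (𝔼 m λ S → f (inside ∷ S)) (𝔼 m λ S → f (outside ∷ S)))
    where
    identity : ∀ p r c a b → p * (c * a) + r * (c * b) ≡ c * (p * a + r * b)
    identity = solve-∀ ring

  𝔼-1 : ∀ m → 𝔼 m (λ _ → 1ℚ) ≡ 1ℚ
  𝔼-1 zero    = refl
  𝔼-1 (suc m) = trans (cong (λ x → p * x + ρ * x) (𝔼-1 m)) (identity ρ)
    where
    identity : ∀ ρ → (1ℚ - ρ) * 1ℚ + ρ * 1ℚ ≡ 1ℚ
    identity = solve-∀ ring

  -- Edges survive independently, so a conjunction of conditions on single edges has a product as
  -- its expectation. This is why spins are introduced: the existence of a short path is no such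
  -- conjunction, but compatibility with given spins is.
  𝔼-compatible : ∀ {A : Set} (φ : A → Bool → Bool) xs →
    𝔼 (length xs) (λ S → ⟦ compatible φ xs S ⟧) ≡
    listProd (λ x → p * ⟦ φ x true ⟧ + ρ * ⟦ φ x false ⟧) xs
  𝔼-compatible φ []       = refl
  𝔼-compatible φ (x ∷ xs) = trans (cong₂ (λ y z → p * y + ρ * z) (factor true) (factor false))
    (trans (identity p ρ ⟦ φ x true ⟧ ⟦ φ x false ⟧ (𝔼 (length xs) λ S → ⟦ compatible φ xs S ⟧))
           (cong ((p * ⟦ φ x true ⟧ + ρ * ⟦ φ x false ⟧) *_) (𝔼-compatible φ xs)))
    where
    factor : ∀ b → 𝔼 (length xs) (λ S → ⟦ φ x b ∧ compatible φ xs S ⟧) ≡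
                   ⟦ φ x b ⟧ * 𝔼 (length xs) (λ S → ⟦ compatible φ xs S ⟧)
    factor b = trans (𝔼-cong (length xs) λ S → ⟦∧⟧ (φ x b) (compatible φ xs S))
                     (𝔼-*ˡ (length xs) ⟦ φ x b ⟧ λ S → ⟦ compatible φ xs S ⟧)
    identity : ∀ p r a b z → p * (a * z) + r * (b * z) ≡ (p * a + r * b) * z
    identity = solve-∀ ring

  𝔼-listSum : ∀ m (f : Subset m → ℚ) →
              listSum (λ S → f S * survivalℚ ρ S) (allSubsets m) ≡ 𝔼 m f
  𝔼-listSum zero    f = trans (+-identityʳ (f [] * 1ℚ)) (*-identityʳ (f []))
  𝔼-listSum (suc m) f = trans
    (listSum-++ (λ S → f S * survivalℚ ρ S) (map (inside ∷_) (allSubsets m)) (map (outside ∷_) (allSubsets m)))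
    (cong₂ _+_ (half inside p λ S → *-exchange (f (inside ∷ S)) p (survivalℚ ρ S))
               (half outside ρ λ S → *-exchange (f (outside ∷ S)) ρ (survivalℚ ρ S)))
    where
    half : ∀ b c → (∀ S → f (b ∷ S) * survivalℚ ρ (b ∷ S) ≡ c * (f (b ∷ S) * survivalℚ ρ S)) →
      listSum (λ S → f S * survivalℚ ρ S) (map (b ∷_) (allSubsets m)) ≡ c * 𝔼 m (λ S → f (b ∷ S))
    half b c eq = trans (listSum-map (λ S → f S * survivalℚ ρ S) (b ∷_) (allSubsets m))
      (trans (listSum-*ˡ c eq (allSubsets m)) (cong (c *_) (𝔼-listSum m λ S → f (b ∷ S))))

  module _ (p′ ρ′ : ℚ) where
    open Configurations p′ ρ′

    𝔼-∑ : ∀ m {n} (ts : Vec Type n) (f : Subset m → Vec Spin n → ℚ) →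
          𝔼 m (λ S → ∑ ts (f S)) ≡ ∑ ts (λ σ → 𝔼 m (λ S → f S σ))
    𝔼-∑ m []       f = refl
    𝔼-∑ m (t ∷ ts) f = trans (𝔼-Σ₃ λ S a → weight p′ ρ′ t a * ∑ ts (λ σ → f S (a ∷ σ)))
      (Σ₃-cong λ a → trans (𝔼-*ˡ m (weight p′ ρ′ t a) λ S → ∑ ts (λ σ → f S (a ∷ σ)))
        (cong (weight p′ ρ′ t a *_) (𝔼-∑ m ts λ S σ → f S (a ∷ σ))))
      where
      𝔼-Σ₃ : ∀ (h : Subset m → Spin → ℚ) → 𝔼 m (λ S → Σ₃ (h S)) ≡ Σ₃ (λ a → 𝔼 m (λ S → h S a))
      𝔼-Σ₃ h = trans (𝔼-+ m (λ S → h S src + h S snk) (λ S → h S off))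
        (cong (_+ 𝔼 m (λ S → h S off)) (𝔼-+ m (λ S → h S src) (λ S → h S snk)))

-- With p = ρ = 1 the weights become the indicator of the admissible spins.
module Indicator = Configurations 1ℚ 1ℚ

admissible : Type → Spin → Bool
admissible (a , b) src = a
admissible (a , b) snk = b
admissible (a , b) off = true

weight-indicator : ∀ t a → weight 1ℚ 1ℚ t a ≡ ⟦ admissible t a ⟧
weight-indicator (true  , true)  src = refl
weight-indicator (true  , false) src = refl
weight-indicator (false , true)  src = refl
weight-indicator (false , false) src = refl
weight-indicator (true  , true)  snk = refl
weight-indicator (true  , false) snk = refl
weight-indicator (false , true)  snk = refl
weight-indicator (false , false) snk = refl
weight-indicator (true  , true)  off = refl
weight-indicator (true  , false) off = refl
weight-indicator (false , true)  off = refl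
weight-indicator (false , false) off = refl

Admissible : ∀ {n} → Vec Type n → Vec Spin n → Set
Admissible ts σ = ∀ v → admissible (lookup ts v) (lookup σ v) ≡ true

∷-admissible : ∀ {n t a} {ts : Vec Type n} {σ} → admissible t a ≡ true → Admissible ts σ →
               Admissible (t ∷ ts) (a ∷ σ)
∷-admissible ta tsσ zero    = ta
∷-admissible ta tsσ (suc v) = tsσ v

open Indicator using () renaming (∑ to ∑₁)

∑₁-vanish : ∀ {n} (ts : Vec Type n) f → (∀ σ → Admissible ts σ → f σ ≡ 0ℚ) → ∑₁ ts f ≡ 0ℚ
∑₁-vanish []       f f≡0 = f≡0 [] λ ()
∑₁-vanish (t ∷ ts) f f≡0 = Σ₃-cong {h = λ _ → 0ℚ} λ a →
  trans (cong (_* ∑₁ ts (λ σ → f (a ∷ σ))) (weight-indicator t a)) (term a)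
  where
  term : ∀ a → ⟦ admissible t a ⟧ * ∑₁ ts (λ σ → f (a ∷ σ)) ≡ 0ℚ
  term a with admissible t a in eq
  ... | false = *-zeroˡ (∑₁ ts λ σ → f (a ∷ σ))
  ... | true  = trans (*-identityˡ (∑₁ ts λ σ → f (a ∷ σ)))
    (∑₁-vanish ts _ λ σ ok → f≡0 (a ∷ σ) (∷-admissible {ts = ts} eq ok))

_≟ₛ_ : ∀ (a b : Spin) → Dec (a ≡ b)
src ≟ₛ src = yes refl
src ≟ₛ snk = no λ ()
src ≟ₛ off = no λ ()
snk ≟ₛ src = no λ ()
snk ≟ₛ snk = yes refl
snk ≟ₛ off = no λ ()
off ≟ₛ src = no λ ()
off ≟ₛ snk = no λ ()
off ≟ₛ off = yes refl

Σ₃-point : ∀ (f : Spin → ℚ) a → (∀ b → b ≢ a → f b ≡ 0ℚ) → Σ₃ f ≡ f a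
Σ₃-point f src f≡0 = trans (cong₂ (λ x y → f src + x + y) (f≡0 snk λ ()) (f≡0 off λ ()))
  (trans (+-identityʳ (f src + 0ℚ)) (+-identityʳ (f src)))
Σ₃-point f snk f≡0 = trans (cong₂ (λ x y → x + f snk + y) (f≡0 src λ ()) (f≡0 off λ ()))
  (trans (+-identityʳ (0ℚ + f snk)) (+-identityˡ (f snk)))
Σ₃-point f off f≡0 = trans (cong₂ (λ x y → x + y + f off) (f≡0 src λ ()) (f≡0 snk λ ()))
  (+-identityˡ (f off))

∑₁-point : ∀ {n} (ts : Vec Type n) f σ → Admissible ts σ → f σ ≡ 1ℚ →
           (∀ τ → Admissible ts τ → τ ≢ σ → f τ ≡ 0ℚ) → ∑₁ ts f ≡ 1ℚ
∑₁-point []       f []      ok fσ≡1 f≡0 = fσ≡1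
∑₁-point (t ∷ ts) f (a ∷ σ) ok fσ≡1 f≡0 = trans (Σ₃-point _ a others) (trans
  (cong₂ _*_ (trans (weight-indicator t a) (cong ⟦_⟧ (ok zero)))
    (∑₁-point ts (λ σ → f (a ∷ σ)) σ (λ v → ok (suc v)) fσ≡1
      λ τ τ-ok τ≢σ → f≡0 (a ∷ τ) (∷-admissible {ts = ts} (ok zero) τ-ok) λ { refl → τ≢σ refl }))
  refl)
  where
  others : ∀ b → b ≢ a → weight 1ℚ 1ℚ t b * ∑₁ ts (λ σ → f (b ∷ σ)) ≡ 0ℚ
  others b b≢a with admissible t b in eq
  ... | false = trans (cong (_* ∑₁ ts (λ σ → f (b ∷ σ))) (trans (weight-indicator t b) (cong ⟦_⟧ eq)))
                      (*-zeroˡ (∑₁ ts λ σ → f (b ∷ σ)))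
  ... | true  = trans (cong (weight 1ℚ 1ℚ t b *_) (∑₁-vanish ts (λ σ → f (b ∷ σ)) λ τ τ-ok →
                        f≡0 (b ∷ τ) (∷-admissible {ts = ts} eq τ-ok) λ { refl → b≢a refl }))
                      (*-zeroʳ (weight 1ℚ 1ℚ t b))

starSource starSink : ℚ → ℚ → Spin → ℚ
starSource p ρ src = p
starSource p ρ _   = ρ
starSink p ρ snk = p
starSink p ρ _   = ρ

-- What the edges to the terminals contribute to the expectation at a given spin. A missing edge
-- contributes 1 whatever the spin; excluding the spins that would need this edge is left to the
-- indicator weights.
star : ℚ → ℚ → Type → Spin → ℚ
star p ρ (a , b) σ = (if a then starSource p ρ σ else 1ℚ) * (if b then starSink p ρ σ else 1ℚ)

stars : ∀ p ρ {n} → Vec Type n → Vec Spin n → ℚ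
stars p ρ []       []      = 1ℚ
stars p ρ (t ∷ ts) (a ∷ σ) = star p ρ t a * stars p ρ ts σ

weight-star : ∀ p ρ t a → weight 1ℚ 1ℚ t a * star p ρ t a ≡ weight p ρ t a
weight-star p ρ (a , b) σ = trans
  (interchange (toSource 1ℚ 1ℚ a σ) (toSink 1ℚ 1ℚ b σ)
    (if a then starSource p ρ σ else 1ℚ) (if b then starSink p ρ σ else 1ℚ))
  (cong₂ _*_ (source a σ) (sink b σ))
  where
  interchange : ∀ x y z w → x * y * (z * w) ≡ (x * z) * (y * w)
  interchange = solve-∀ ring
  source : ∀ a σ → toSource 1ℚ 1ℚ a σ * (if a then starSource p ρ σ else 1ℚ) ≡ toSource p ρ a σ
  source true  src = *-identityˡ p
  source true  snk = *-identityˡ ρ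
  source true  off = *-identityˡ ρ
  source false src = refl
  source false snk = refl
  source false off = refl
  sink : ∀ b σ → toSink 1ℚ 1ℚ b σ * (if b then starSink p ρ σ else 1ℚ) ≡ toSink p ρ b σ
  sink true  src = *-identityˡ ρ
  sink true  snk = *-identityˡ p
  sink true  off = *-identityˡ ρ
  sink false src = refl
  sink false snk = refl
  sink false off = refl

∑-stars : ∀ p ρ {n} (ts : Vec Type n) (f : Vec Spin n → ℚ) →
  ∑₁ ts (λ σ → stars p ρ ts σ * f σ) ≡ Configurations.∑ p ρ ts f
∑-stars p ρ []       f = *-identityˡ (f [])
∑-stars p ρ (t ∷ ts) f = Σ₃-cong λ a → begin
  weight 1ℚ 1ℚ t a * ∑₁ ts (λ σ → star p ρ t a * stars p ρ ts σ * f (a ∷ σ))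
    ≡⟨ cong (weight 1ℚ 1ℚ t a *_) (trans
         (Indicator.∑-cong ts λ σ → *-assoc (star p ρ t a) (stars p ρ ts σ) (f (a ∷ σ)))
         (Indicator.∑-*ˡ ts (star p ρ t a) λ σ → stars p ρ ts σ * f (a ∷ σ))) ⟩
  weight 1ℚ 1ℚ t a * (star p ρ t a * ∑₁ ts (λ σ → stars p ρ ts σ * f (a ∷ σ)))
    ≡⟨ *-assoc (weight 1ℚ 1ℚ t a) (star p ρ t a) (∑₁ ts λ σ → stars p ρ ts σ * f (a ∷ σ)) ⟨
  weight 1ℚ 1ℚ t a * star p ρ t a * ∑₁ ts (λ σ → stars p ρ ts σ * f (a ∷ σ))
    ≡⟨ cong₂ _*_ (weight-star p ρ t a) (∑-stars p ρ ts λ σ → f (a ∷ σ)) ⟩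
  weight p ρ t a * Configurations.∑ p ρ ts (λ σ → f (a ∷ σ)) ∎
  where open ≡-Reasoning

-- Folds in a commutative monoid.

module Fold {A : Set} {_∙_ : A → A → A} {ε : A} (isCM : IsCommutativeMonoid _≡_ _∙_ ε) where

  open IsCommutativeMonoid isCM using (assoc; comm; identityˡ)

  fold : ∀ {B : Set} → (B → A) → List B → A
  fold f xs = foldr (λ x r → f x ∙ r) ε xs

  finFold : ∀ n → (Fin n → A) → A
  finFold zero    f = ε
  finFold (suc n) f = f zero ∙ finFold n (λ v → f (suc v))

  fold-↭ : ∀ {B : Set} (f : B → A) {xs ys} → xs ↭ ys → fold f xs ≡ fold f ys
  fold-↭ f ↭.refl          = refl
  fold-↭ f (↭.prep x p)    = cong (f x ∙_) (fold-↭ f p)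
  fold-↭ f (↭.swap {ys = ys} x y p) = begin
    f x ∙ (f y ∙ _)  ≡⟨ cong (λ r → f x ∙ (f y ∙ r)) (fold-↭ f p) ⟩
    f x ∙ (f y ∙ r)  ≡⟨ assoc (f x) (f y) r ⟨
    (f x ∙ f y) ∙ r  ≡⟨ cong (_∙ r) (comm (f x) (f y)) ⟩
    (f y ∙ f x) ∙ r  ≡⟨ assoc (f y) (f x) r ⟩
    f y ∙ (f x ∙ r)  ∎
    where
    open ≡-Reasoning
    r = fold f ys
  fold-↭ f (↭.trans p q)   = trans (fold-↭ f p) (fold-↭ f q)

  fold-++ : ∀ {B : Set} (f : B → A) xs ys → fold f (xs ++ ys) ≡ fold f xs ∙ fold f ys
  fold-++ f []       ys = sym (identityˡ (fold f ys))
  fold-++ f (x ∷ xs) ys = trans (cong (f x ∙_) (fold-++ f xs ys)) (sym (assoc (f x) (fold f xs) (fold f ys)))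

  fold-map-filter-tabulate : ∀ {B C : Set} (f : C → A) (h : B → C) {P : B → Set}
    (P? : ∀ x → Dec (P x)) {n} (g : Fin n → B) →
    fold f (map h (filter P? (List.tabulate g))) ≡
    finFold n (λ v → if does (P? (g v)) then f (h (g v)) else ε)
  fold-map-filter-tabulate f h P? {zero}  g = refl
  fold-map-filter-tabulate f h P? {suc n} g with does (P? (g zero))
  ... | true  = cong (f (h (g zero)) ∙_) (fold-map-filter-tabulate f h P? (λ v → g (suc v)))
  ... | false = trans (fold-map-filter-tabulate f h P? (λ v → g (suc v))) (sym (identityˡ _))

  finFold-cong : ∀ n {f h : Fin n → A} → (∀ v → f v ≡ h v) → finFold n f ≡ finFold n h
  finFold-cong zero    f≡h = refl
  finFold-cong (suc n) f≡h = cong₂ _∙_ (f≡h zero) (finFold-cong n λ v → f≡h (suc v))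

  finFold-∙ : ∀ n (f h : Fin n → A) → finFold n (λ v → f v ∙ h v) ≡ finFold n f ∙ finFold n h
  finFold-∙ zero    f h = sym (identityˡ ε)
  finFold-∙ (suc n) f h = begin
    (f zero ∙ h zero) ∙ finFold n _  ≡⟨ cong ((f zero ∙ h zero) ∙_) (finFold-∙ n (λ v → f (suc v)) (λ v → h (suc v))) ⟩
    (f zero ∙ h zero) ∙ (F ∙ F′)      ≡⟨ assoc (f zero) (h zero) (F ∙ F′) ⟩
    f zero ∙ (h zero ∙ (F ∙ F′))      ≡⟨ cong (f zero ∙_) (assoc (h zero) F F′) ⟨
    f zero ∙ ((h zero ∙ F) ∙ F′)      ≡⟨ cong (λ x → f zero ∙ (x ∙ F′)) (comm (h zero) F) ⟩
    f zero ∙ ((F ∙ h zero) ∙ F′)      ≡⟨ cong (f zero ∙_) (assoc F (h zero) F′) ⟩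
    f zero ∙ (F ∙ (h zero ∙ F′))      ≡⟨ assoc (f zero) F (h zero ∙ F′) ⟨
    (f zero ∙ F) ∙ (h zero ∙ F′)      ∎
    where
    open ≡-Reasoning
    F = finFold n (λ v → f (suc v))
    F′ = finFold n (λ v → h (suc v))

-- The edges sorted by the terminals that they meet.

edge : ∀ {n} → Fin n → Fin n → Fin n × Fin n
edge u v with u Fin.<? v
... | yes _ = u , v
... | no  _ = v , u

edge-< : ∀ {n} {u v : Fin n} → u Fin.< v → edge u v ≡ (u , v)
edge-< {u = u} {v} u<v with u Fin.<? v
... | yes _   = refl
... | no  u≮v = contradiction u<v u≮v

edge-> : ∀ {n} {u v : Fin n} → v Fin.< u → edge u v ≡ (v , u)
edge-> {u = u} {v} v<u with u Fin.<? v
... | yes u<v = contradiction v<u (ℕ.<-asym u<v)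
... | no  _   = refl

edge-ends : ∀ {n} (u v : Fin n) → edge u v ≡ (u , v) ⊎ edge u v ≡ (v , u)
edge-ends u v with u Fin.<? v
... | yes _ = inj₁ refl
... | no  _ = inj₂ refl

SameEnds : ∀ {n} (u v u′ v′ : Fin n) → Set
SameEnds u v u′ v′ = (u ≡ u′ × v ≡ v′) ⊎ (u ≡ v′ × v ≡ u′)

edge-injective : ∀ {n} (u v u′ v′ : Fin n) → edge u v ≡ edge u′ v′ → SameEnds u v u′ v′
edge-injective u v u′ v′ with u Fin.<? v | u′ Fin.<? v′
... | yes _ | yes _ = λ { refl → inj₁ (refl , refl) }
... | yes _ | no  _ = λ { refl → inj₂ (refl , refl) }
... | no  _ | yes _ = λ { refl → inj₂ (refl , refl) }
... | no  _ | no  _ = λ { refl → inj₁ (refl , refl) }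

module Structure {n} (G : TwoTerminalGraph n) where

  open TwoTerminalGraph G

  es : List (Fin n × Fin n)
  es = edges graph

  isEdge? : (e : Fin n × Fin n) → Dec (proj₁ e Fin.< proj₂ e × Adj (proj₁ e) (proj₂ e))
  isEdge? (u , v) = (u Fin.<? v) ×-dec Adj? u v

  ∈-edges⁻ : ∀ {u v} → (u , v) ∈ es → u Fin.< v × Adj u v
  ∈-edges⁻ e∈ = proj₂ (∈-filter⁻ isEdge? {xs = cartesianProduct (allFin n) (allFin n)} e∈)

  ∈-edges⁺ : ∀ {u v} → u Fin.< v → Adj u v → (u , v) ∈ es
  ∈-edges⁺ {u} {v} u<v uv =
    ∈-filter⁺ isEdge? (∈-cartesianProduct⁺ (∈-allFin u) (∈-allFin v)) (u<v , uv)

  edge-∈ : ∀ {u v} → Adj u v → edge u v ∈ es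
  edge-∈ {u} {v} uv with Fin.<-cmp u v
  ... | tri< u<v _ _ = subst (_∈ es) (sym (edge-< u<v)) (∈-edges⁺ u<v uv)
  ... | tri≈ _ u≡v _ = contradiction uv (irrefl u≡v)
  ... | tri> _ _ v<u = subst (_∈ es) (sym (edge-> v<u)) (∈-edges⁺ v<u (symm uv))

  Source Sink : Fin n → Set
  Source v = Adj s v × v ≢ t
  Sink   v = Adj t v × v ≢ s

  source? : ∀ v → Dec (Source v)
  source? v = Adj? s v ×-dec ¬? (v Fin.≟ t)

  sink? : ∀ v → Dec (Sink v)
  sink? v = Adj? t v ×-dec ¬? (v Fin.≟ s)

  Inner : Fin n → Set
  Inner v = v ≢ s × v ≢ t

  Middle : Fin n × Fin n → Set
  Middle (x , y) = Inner x × Inner y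

  inner? : ∀ v → Dec (Inner v)
  inner? v = ¬? (v Fin.≟ s) ×-dec ¬? (v Fin.≟ t)

  middle? : ∀ e → Dec (Middle e)
  middle? (x , y) = inner? x ×-dec inner? y

  types : Vec Type n
  types = Vec.tabulate λ v → does (source? v) , does (sink? v)

  direct sources sinks middle : List (Fin n × Fin n)
  direct  = if does (Adj? s t) then edge s t ∷ [] else []
  sources = map (edge s) (filter source? (allFin n))
  sinks   = map (edge t) (filter sink? (allFin n))
  middle  = filter middle? es

  blocks : List (Fin n × Fin n)
  blocks = direct ++ (sources ++ (sinks ++ middle))

  ∈-direct⁻ : ∀ {e} → e ∈ direct → e ≡ edge s t × Adj s t
  ∈-direct⁻ with Adj? s t
  ... | yes st = λ { (here eq) → eq , st }
  ... | no  _  = λ ()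

  ∈-direct⁺ : Adj s t → edge s t ∈ direct
  ∈-direct⁺ st with Adj? s t
  ... | yes _   = here refl
  ... | no  ¬st = contradiction st ¬st

  ∈-star⁻ : ∀ {u} {P : Fin n → Set} (P? : ∀ v → Dec (P v)) {e} →
            e ∈ map (edge u) (filter P? (allFin n)) → Data.Product.Base.∃ λ v → e ≡ edge u v × P v
  ∈-star⁻ {u} P? e∈ with ∈-map⁻ (edge u) e∈
  ... | v , v∈ , eq = v , eq , proj₂ (∈-filter⁻ P? {xs = allFin n} v∈)

  ∈-star⁺ : ∀ u {P : Fin n → Set} (P? : ∀ v → Dec (P v)) {v} →
            P v → edge u v ∈ map (edge u) (filter P? (allFin n))
  ∈-star⁺ u P? {v} Pv = ∈-map⁺ (edge u) (∈-filter⁺ P? (∈-allFin v) Pv)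

  ∈-middle⁻ : ∀ {e} → e ∈ middle → e ∈ es × Middle e
  ∈-middle⁻ e∈ = ∈-filter⁻ middle? {xs = es} e∈

  middle-edge : ∀ u v → Middle (edge u v) → Inner u × Inner v
  middle-edge u v with u Fin.<? v
  ... | yes _ = λ (x , y) → x , y
  ... | no  _ = λ (y , x) → x , y

  unique-edges : Unique es
  unique-edges = Unique.filter⁺ isEdge? (Unique.cartesianProduct⁺ (Unique.allFin⁺ n) (Unique.allFin⁺ n))

  unique-star : ∀ u {P : Fin n → Set} (P? : ∀ v → Dec (P v)) →
                Unique (map (edge u) (filter P? (allFin n)))
  unique-star u P? = Unique.map⁺ (λ {v} {w} eq → injective v w (edge-injective u v u w eq))
    (Unique.filter⁺ P? (Unique.allFin⁺ n))
    where
    injective : ∀ v w → SameEnds u v u w → v ≡ w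
    injective v w (inj₁ (_ , v≡w))   = v≡w
    injective v w (inj₂ (u≡w , v≡u)) = trans v≡u u≡w

  unique-blocks : Unique blocks
  unique-blocks = Unique.++⁺ unique-direct
    (Unique.++⁺ (unique-star s source?)
      (Unique.++⁺ (unique-star t sink?) (Unique.filter⁺ middle? unique-edges) sinks#middle)
      sources#rest)
    direct#rest
    where
    unique-direct : Unique direct
    unique-direct with does (Adj? s t)
    ... | true  = [] ∷ []
    ... | false = []
    sinks#middle : ∀ {e} → e ∈ sinks × e ∈ middle → ⊥
    sinks#middle (e∈ , e∈′) with ∈-star⁻ sink? e∈
    ... | v , refl , _ = proj₂ (proj₁ (middle-edge t v (proj₂ (∈-middle⁻ e∈′)))) refl
    sources#sinks : ∀ {v w} → Sink w → SameEnds s v t w → ⊥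
    sources#sinks _         (inj₁ (s≡t , _)) = s≢t s≡t
    sources#sinks (_ , w≢s) (inj₂ (s≡w , _)) = w≢s (sym s≡w)
    sources#rest : ∀ {e} → e ∈ sources × e ∈ sinks ++ middle → ⊥
    sources#rest (e∈ , e∈′) with ∈-star⁻ source? e∈ | ∈-++⁻ sinks e∈′
    ... | v , refl , _ | inj₂ e∈″ = proj₁ (proj₁ (middle-edge s v (proj₂ (∈-middle⁻ e∈″)))) refl
    ... | v , refl , _ | inj₁ e∈″ with ∈-star⁻ sink? e∈″
    ... | w , eq , sink = sources#sinks sink (edge-injective s v t w eq)
    direct#sources : ∀ {w} → Source w → SameEnds s t s w → ⊥
    direct#sources (_ , w≢t) (inj₁ (_ , t≡w)) = w≢t (sym t≡w)
    direct#sources _         (inj₂ (_ , t≡s)) = s≢t (sym t≡s)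
    direct#rest : ∀ {e} → e ∈ direct × e ∈ sources ++ (sinks ++ middle) → ⊥
    direct#rest (e∈ , e∈′) with ∈-direct⁻ e∈ | ∈-++⁻ sources e∈′
    ... | refl , _ | inj₁ e∈″ = let w , eq , source = ∈-star⁻ source? e∈″ in
      direct#sources source (edge-injective s t s w eq)
    ... | refl , _ | inj₂ e∈″ with ∈-++⁻ sinks e∈″
    ... | inj₁ e∈‴ = let w , eq , sink = ∈-star⁻ sink? e∈‴ in
      sources#sinks sink (edge-injective s t t w eq)
    ... | inj₂ e∈‴ = proj₁ (proj₁ (middle-edge s t (proj₂ (∈-middle⁻ e∈‴)))) refl

  ∈-sources : ∀ {e v} → Adj s v → v ≢ t → edge s v ≡ e → e ∈ blocks
  ∈-sources sv v≢t refl = ∈-++⁺ʳ direct (∈-++⁺ˡ (∈-star⁺ s source? (sv , v≢t)))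

  ∈-sinks : ∀ {e v} → Adj t v → v ≢ s → edge t v ≡ e → e ∈ blocks
  ∈-sinks tv v≢s refl = ∈-++⁺ʳ direct (∈-++⁺ʳ sources (∈-++⁺ˡ (∈-star⁺ t sink? (tv , v≢s))))

  edges⊆blocks : ∀ {x y} → (x , y) ∈ es → (x , y) ∈ blocks
  edges⊆blocks {x} {y} e∈ with ∈-edges⁻ e∈
  ... | x<y , xy with x Fin.≟ s | x Fin.≟ t | y Fin.≟ s | y Fin.≟ t
  ... | yes refl | _ | _ | yes refl = ∈-++⁺ˡ (subst (_∈ direct) (edge-< x<y) (∈-direct⁺ xy))
  ... | yes refl | _ | _ | no  y≢t  = ∈-sources xy y≢t (edge-< x<y)
  ... | no _ | yes refl | yes refl | _ = ∈-++⁺ˡ (subst (_∈ direct) (edge-> x<y) (∈-direct⁺ (symm xy)))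
  ... | no _ | yes refl | no y≢s   | _ = ∈-sinks xy y≢s (edge-< x<y)
  ... | no _   | no x≢t | yes refl | _ = ∈-sources (symm xy) x≢t (edge-> x<y)
  ... | no x≢s | no _   | no _     | yes refl = ∈-sinks (symm xy) x≢s (edge-> x<y)
  ... | no x≢s | no x≢t | no y≢s   | no y≢t = ∈-++⁺ʳ direct (∈-++⁺ʳ sources (∈-++⁺ʳ sinks
    (∈-filter⁺ middle? e∈ ((x≢s , x≢t) , (y≢s , y≢t)))))

  blocks⊆edges : ∀ {e} → e ∈ blocks → e ∈ es
  blocks⊆edges e∈ with ∈-++⁻ direct e∈
  ... | inj₁ e∈′ with refl , st ← ∈-direct⁻ e∈′ = edge-∈ st
  ... | inj₂ e∈′ with ∈-++⁻ sources e∈′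
  ... | inj₁ e∈″ with _ , refl , sv , _ ← ∈-star⁻ source? e∈″ = edge-∈ sv
  ... | inj₂ e∈″ with ∈-++⁻ sinks e∈″
  ... | inj₁ e∈‴ with _ , refl , tv , _ ← ∈-star⁻ sink? e∈‴ = edge-∈ tv
  ... | inj₂ e∈‴ = proj₁ (∈-middle⁻ e∈‴)

  -- The order in which `edges` lists the pairs need not be analysed: both lists are free of
  -- repetitions and have the same members.
  edges↭blocks : es ↭ blocks
  edges↭blocks = ∼bag⇒↭ (unique∧set⇒bag unique-edges unique-blocks (mk⇔ edges⊆blocks blocks⊆edges))

  module _ {A : Set} {_∙_ : A → A → A} {ε : A} (isCM : IsCommutativeMonoid _≡_ _∙_ ε) where
    open IsCommutativeMonoid isCM using (assoc; identityʳ)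
    open Fold isCM

    -- Needed in two monoids: addition in ℕ counts the edges, multiplication in ℚ factorises the
    -- expectation. Symmetry of `f` absorbs the orientation in which an edge is listed.
    fold-edges : (f : Fin n × Fin n → A) → (∀ u v → f (u , v) ≡ f (v , u)) →
      fold f es ≡ (if does (Adj? s t) then f (s , t) else ε) ∙
        (finFold n (λ v → (if does (source? v) then f (s , v) else ε) ∙
                          (if does (sink? v) then f (t , v) else ε)) ∙ fold f middle)
    fold-edges f f-sym = begin
      fold f es
        ≡⟨ fold-↭ f edges↭blocks ⟩
      fold f blocks
        ≡⟨ fold-++ f direct (sources ++ (sinks ++ middle)) ⟩
      fold f direct ∙ fold f (sources ++ (sinks ++ middle))
        ≡⟨ cong (fold f direct ∙_) (trans (fold-++ f sources (sinks ++ middle))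
             (cong (fold f sources ∙_) (fold-++ f sinks middle))) ⟩
      fold f direct ∙ (fold f sources ∙ (fold f sinks ∙ fold f middle))
        ≡⟨ cong₂ _∙_ fold-direct (sym (assoc (fold f sources) (fold f sinks) (fold f middle))) ⟩
      f-direct ∙ ((fold f sources ∙ fold f sinks) ∙ fold f middle)
        ≡⟨ cong (λ z → f-direct ∙ (z ∙ fold f middle)) (cong₂ _∙_ (fold-star s source?) (fold-star t sink?)) ⟩
      f-direct ∙ ((finFold n f-source ∙ finFold n f-sink) ∙ fold f middle)
        ≡⟨ cong (λ z → f-direct ∙ (z ∙ fold f middle)) (finFold-∙ n f-source f-sink) ⟨
      f-direct ∙ (finFold n (λ v → f-source v ∙ f-sink v) ∙ fold f middle) ∎
      where
      open ≡-Reasoning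
      f-edge : ∀ u v → f (edge u v) ≡ f (u , v)
      f-edge u v with u Fin.<? v
      ... | yes _ = refl
      ... | no  _ = f-sym v u
      f-direct : A
      f-direct = if does (Adj? s t) then f (s , t) else ε
      f-source f-sink : Fin n → A
      f-source v = if does (source? v) then f (s , v) else ε
      f-sink v   = if does (sink? v) then f (t , v) else ε
      fold-direct : fold f direct ≡ f-direct
      fold-direct with does (Adj? s t)
      ... | true  = trans (identityʳ (f (edge s t))) (f-edge s t)
      ... | false = refl
      fold-star : ∀ u {P : Fin n → Set} (P? : ∀ v → Dec (P v)) →
        fold f (map (edge u) (filter P? (allFin n))) ≡ finFold n (λ v → if does (P? v) then f (u , v) else ε)
      fold-star u P? = trans (fold-map-filter-tabulate f (edge u) P? (λ v → v))
        (finFold-cong n λ v → cong (λ z → if does (P? v) then z else ε) (f-edge u v))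

  edgeCount-split : edgeCount graph ≡ side (does (Adj? s t)) ℕ.+ (length middle ℕ.+ cost types)
  edgeCount-split = begin
    length es
      ≡⟨ length-fold es ⟩
    fold (λ _ → 1) es
      ≡⟨ fold-edges ℕ.+-0-isCommutativeMonoid (λ _ → 1) (λ _ _ → refl) ⟩
    side (does (Adj? s t)) ℕ.+ (finFold n (λ v → side (does (source? v)) ℕ.+ side (does (sink? v)))
                                ℕ.+ fold (λ _ → 1) middle)
      ≡⟨ cong (side (does (Adj? s t)) ℕ.+_) (trans
           (cong₂ ℕ._+_ (finFold-cost n (λ v → does (source? v)) (λ v → does (sink? v))) (sym (length-fold middle)))
           (ℕ.+-comm (cost types) (length middle))) ⟩
    side (does (Adj? s t)) ℕ.+ (length middle ℕ.+ cost types) ∎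
    where
    open ≡-Reasoning
    open Fold ℕ.+-0-isCommutativeMonoid
    length-fold : ∀ {B : Set} (xs : List B) → length xs ≡ fold (λ _ → 1) xs
    length-fold []       = refl
    length-fold (x ∷ xs) = cong suc (length-fold xs)
    finFold-cost : ∀ k (a b : Fin k → Bool) →
      finFold k (λ v → side (a v) ℕ.+ side (b v)) ≡ cost (Vec.tabulate λ v → a v , b v)
    finFold-cost zero    a b = refl
    finFold-cost (suc k) a b = cong (side (a zero) ℕ.+ side (b zero) ℕ.+_)
      (finFold-cost k (λ v → a (suc v)) (λ v → b (suc v)))

-- Short paths and compatible spins.

lookup-injective : ∀ {A : Set} {xs : List A} → Unique xs →
                   ∀ i j → List.lookup xs i ≡ List.lookup xs j → i ≡ j
lookup-injective {xs = x ∷ xs} u        zero    zero    eq = refl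
lookup-injective {xs = x ∷ xs} (x∉ ∷ u) zero    (suc j) eq = contradiction eq (All.lookup x∉ (∈-lookup j))
lookup-injective {xs = x ∷ xs} (x∉ ∷ u) (suc i) zero    eq = contradiction (sym eq) (All.lookup x∉ (∈-lookup i))
lookup-injective {xs = x ∷ xs} (x∉ ∷ u) (suc i) (suc j) eq = cong suc (lookup-injective u i j eq)

data End : Set where
  source sink : End
  inner       : Spin → End

pointsTo : Spin → Spin → Bool
pointsTo a b = does (a ≟ₛ b)

opposite : Spin → Spin → Bool
opposite a b = (pointsTo a src ∧ pointsTo b snk) ∨ (pointsTo a snk ∧ pointsTo b src)

-- Whether an edge between two such ends may be present (true) or absent (false)
-- in a graph without short paths whose spins are as given.
agree : End → End → Bool → Bool
agree source    sink      b = not b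
agree sink      source    b = not b
agree source    (inner a) b = does (pointsTo a src Bool.≟ b)
agree (inner a) source    b = does (pointsTo a src Bool.≟ b)
agree sink      (inner a) b = does (pointsTo a snk Bool.≟ b)
agree (inner a) sink      b = does (pointsTo a snk Bool.≟ b)
agree (inner a) (inner c) b = not (b ∧ opposite a c)
agree _         _         b = true

agree-comm : ∀ x y b → agree x y b ≡ agree y x b
agree-comm source    source    b = refl
agree-comm source    sink      b = refl
agree-comm sink      source    b = refl
agree-comm sink      sink      b = refl
agree-comm source    (inner a) b = refl
agree-comm sink      (inner a) b = refl
agree-comm (inner a) source    b = refl
agree-comm (inner a) sink      b = refl
agree-comm (inner a) (inner c) b = cong (λ o → not (b ∧ o)) (trans
  (Bool.∨-comm (pointsTo a src ∧ pointsTo c snk) _)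
  (cong₂ _∨_ (Bool.∧-comm (pointsTo a snk) _) (Bool.∧-comm (pointsTo a src) _)))

module Failure {n} (G : TwoTerminalGraph n) where

  open TwoTerminalGraph G
  open Structure G

  end : Vec Spin n → Fin n → End
  end σ v with v Fin.≟ s | v Fin.≟ t
  ... | yes _ | _     = source
  ... | no  _ | yes _ = sink
  ... | no  _ | no  _ = inner (lookup σ v)

  end-s : ∀ σ → end σ s ≡ source
  end-s σ with s Fin.≟ s
  ... | yes _   = refl
  ... | no  s≢s = contradiction refl s≢s

  end-t : ∀ σ → end σ t ≡ sink
  end-t σ with t Fin.≟ s | t Fin.≟ t
  ... | yes t≡s | _       = contradiction (sym t≡s) s≢t
  ... | no  _   | yes _   = refl
  ... | no  _   | no  t≢t = contradiction refl t≢t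

  end-inner : ∀ σ {v} → Inner v → end σ v ≡ inner (lookup σ v)
  end-inner σ {v} (v≢s , v≢t) with v Fin.≟ s | v Fin.≟ t
  ... | yes v≡s | _       = contradiction v≡s v≢s
  ... | no  _   | yes v≡t = contradiction v≡t v≢t
  ... | no  _   | no  _   = refl

  rule : Vec Spin n → Fin n × Fin n → Bool → Bool
  rule σ (u , v) = agree (end σ u) (end σ v)

  -- Of the distinctness of the vertices of a path, only the two inequalities in `three` and s ≢ t
  -- do not follow from the irreflexivity of adjacency. They also make `x` and `y` inner, so that
  -- both carry a spin.
  data Connected (_~_ : Fin n → Fin n → Set) : Set where
    one   : s ~ t → Connected _~_
    two   : ∀ {v} → s ~ v → v ~ t → Connected _~_
    three : ∀ {x y} → x ≢ t → y ≢ s → s ~ x → x ~ y → y ~ t → Connected _~_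

  module _ (S : Subset (edgeCount graph)) where

    open Graph (spanning graph S) using () renaming (symm to sub-symm; irrefl to sub-irrefl; Adj? to sub?)

    _~_ : Fin n → Fin n → Set
    _~_ = SubAdj graph S

    pathset⇒connected : IsPathset 3 G S → Connected _~_
    pathset⇒connected (0 , _ , x ∷ [] , mkPath refl x≡t _ _) = contradiction x≡t s≢t
    pathset⇒connected (1 , _ , x ∷ y ∷ [] , mkPath refl refl (xy ∷ _) _) = one xy
    pathset⇒connected (2 , _ , x ∷ v ∷ y ∷ [] , mkPath refl refl (xv ∷ vy ∷ _) _) = two xv vy
    pathset⇒connected (3 , _ , w ∷ x ∷ y ∷ z ∷ [] , mkPath refl refl (wx ∷ xy ∷ yz ∷ _)
      ((_ VecAll.∷ w≢y VecAll.∷ _) ∷ (_ VecAll.∷ x≢z VecAll.∷ _) ∷ _)) = three x≢z (w≢y ∘ sym) wx xy yz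
    pathset⇒connected (suc (suc (suc (suc _))) , ℕ.s≤s (ℕ.s≤s (ℕ.s≤s ())) , _)

    connected⇒pathset : Connected _~_ → IsPathset 3 G S
    connected⇒pathset (one st) = 1 , ℕ.s≤s ℕ.z≤n , s ∷ t ∷ [] ,
      mkPath refl refl (st ∷ [-]) ((s≢t VecAll.∷ VecAll.[]) ∷ VecAll.[] ∷ [])
    connected⇒pathset (two {v} sv vt) = 2 , ℕ.s≤s (ℕ.s≤s ℕ.z≤n) , s ∷ v ∷ t ∷ [] ,
      mkPath refl refl (sv ∷ vt ∷ [-])
        ((sv-irr VecAll.∷ s≢t VecAll.∷ VecAll.[]) ∷ ((λ v≡t → sub-irrefl v≡t vt) VecAll.∷ VecAll.[]) ∷ VecAll.[] ∷ [])
      where sv-irr = λ s≡v → sub-irrefl s≡v sv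
    connected⇒pathset (three {x} {y} x≢t y≢s sx xy yt) = 3 , ℕ.s≤s (ℕ.s≤s (ℕ.s≤s ℕ.z≤n)) ,
      s ∷ x ∷ y ∷ t ∷ [] , mkPath refl refl (sx ∷ xy ∷ yt ∷ [-])
        (((λ s≡x → sub-irrefl s≡x sx) VecAll.∷ (y≢s ∘ sym) VecAll.∷ s≢t VecAll.∷ VecAll.[]) ∷
         ((λ x≡y → sub-irrefl x≡y xy) VecAll.∷ x≢t VecAll.∷ VecAll.[]) ∷
         ((λ y≡t → sub-irrefl y≡t yt) VecAll.∷ VecAll.[]) ∷ VecAll.[] ∷ [])

    allowed : Vec Spin n → Bool
    allowed σ = compatible (rule σ) es S

    SubAdj⇒Adj : ∀ {u v} → u ~ v → Adj u v
    SubAdj⇒Adj (i , _ , inj₁ eq) = proj₂ (∈-edges⁻ (subst (_∈ es) eq (∈-lookup i)))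
    SubAdj⇒Adj (i , _ , inj₂ eq) = symm (proj₂ (∈-edges⁻ (subst (_∈ es) eq (∈-lookup i))))

    violated : ∀ σ {u v} → u ~ v → agree (end σ u) (end σ v) true ≡ false → allowed σ ≡ false
    violated σ {u} {v} (i , i∈S , ends) eq = compatible⁻ (rule σ) es S i (trans
      (cong (rule σ (List.lookup es i)) (Vec.[]=⇒lookup i∈S)) (at ends))
      where
      at : List.lookup es i ≡ (u , v) ⊎ List.lookup es i ≡ (v , u) → rule σ (List.lookup es i) true ≡ false
      at (inj₁ e) = trans (cong (λ e → rule σ e true) e) eq
      at (inj₂ e) = trans (cong (λ e → rule σ e true) e) (trans (agree-comm (end σ v) (end σ u) true) eq)

    ~⇒inner : ∀ {v} → s ~ v → v ~ t → Inner v
    ~⇒inner sv vt = (λ v≡s → sub-irrefl (sym v≡s) sv) , (λ v≡t → sub-irrefl v≡t vt)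

    source-violated : ∀ σ {v a} → Inner v → s ~ v → lookup σ v ≡ a → pointsTo a src ≡ false → allowed σ ≡ false
    source-violated σ iv sv refl ≢src = violated σ sv (trans
      (cong₂ (λ x y → agree x y true) (end-s σ) (end-inner σ iv)) (cong (λ b → does (b Bool.≟ true)) ≢src))

    sink-violated : ∀ σ {v a} → Inner v → v ~ t → lookup σ v ≡ a → pointsTo a snk ≡ false → allowed σ ≡ false
    sink-violated σ iv vt refl ≢snk = violated σ vt (trans
      (cong₂ (λ x y → agree x y true) (end-inner σ iv) (end-t σ)) (cong (λ b → does (b Bool.≟ true)) ≢snk))

    -- The inner vertex of a path of length 2 would have to be src and snk at once, and a path of
    -- length 3 would contain an edge from src to snk.
    connected-disallowed : Connected _~_ → ∀ σ → allowed σ ≡ false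
    connected-disallowed (one st) σ = violated σ st (cong₂ (λ x y → agree x y true) (end-s σ) (end-t σ))
    connected-disallowed (two {v} sv vt) σ with lookup σ v in eq
    ... | src = sink-violated σ (~⇒inner sv vt) vt eq refl
    ... | snk = source-violated σ (~⇒inner sv vt) sv eq refl
    ... | off = source-violated σ (~⇒inner sv vt) sv eq refl
    connected-disallowed (three {x} {y} x≢t y≢s sx xy yt) σ = cases (lookup σ x) (lookup σ y) refl refl
      where
      ix : Inner x
      ix = (λ x≡s → sub-irrefl (sym x≡s) sx) , x≢t
      iy : Inner y
      iy = y≢s , (λ y≡t → sub-irrefl y≡t yt)
      cases : ∀ a b → lookup σ x ≡ a → lookup σ y ≡ b → allowed σ ≡ false
      cases snk b   eqx eqy = source-violated σ ix sx eqx refl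
      cases off b   eqx eqy = source-violated σ ix sx eqx refl
      cases src src eqx eqy = sink-violated σ iy yt eqy refl
      cases src off eqx eqy = sink-violated σ iy yt eqy refl
      cases src snk eqx eqy = violated σ xy (cong₂ (λ u v → agree u v true)
        (trans (end-inner σ ix) (cong inner eqx)) (trans (end-inner σ iy) (cong inner eqy)))

module Unreliability {n} (G : TwoTerminalGraph n) where

  open TwoTerminalGraph G
  open Structure G
  open Failure G hiding (_~_)

  lookup-types : ∀ v → lookup types v ≡ (does (source? v) , does (sink? v))
  lookup-types v = Vec.lookup∘tabulate (λ v → does (source? v) , does (sink? v)) v

  does-true : ∀ {A : Set} (A? : Dec A) → does A? ≡ true → A
  does-true (yes a) _ = a

  data Place : Fin n → Set where
    at-s  : Place s
    at-t  : Place t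
    mid   : ∀ {v} → Inner v → Place v

  place : ∀ v → Place v
  place v with v Fin.≟ s | v Fin.≟ t
  ... | yes refl | _        = at-s
  ... | no  _    | yes refl = at-t
  ... | no v≢s   | no v≢t   = mid (v≢s , v≢t)

  module _ (S : Subset (edgeCount graph)) (disconnected : ¬ Connected (SubAdj graph S)) where

    open Graph (spanning graph S) using () renaming (symm to sub-symm; irrefl to sub-irrefl; Adj? to sub?)

    private
      _~_ : Fin n → Fin n → Set
      _~_ = SubAdj graph S

    -- The terminals also have entries in the spin vector. They receive the dummy value off, the
    -- only admissible one, because no terminal satisfies `Source` or `Sink` and so their type is
    -- `isolated`.
    data Forced (v : Fin n) : Spin → Set where
      terminal  : ¬ Inner v → Forced v off
      to-source : Inner v → s ~ v → Forced v src
      to-sink   : Inner v → t ~ v → Forced v snk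
      free      : Inner v → ¬ s ~ v → ¬ t ~ v → Forced v off

    forced : ∀ v → ∃ (Forced v)
    forced v with inner? v | sub? s v | sub? t v
    ... | no ¬iv | _      | _      = off , terminal ¬iv
    ... | yes iv | yes sv | _      = src , to-source iv sv
    ... | yes iv | no _   | yes tv = snk , to-sink iv tv
    ... | yes iv | no ¬sv | no ¬tv = off , free iv ¬sv ¬tv

    spin : Fin n → Spin
    spin v = proj₁ (forced v)

    spins : Vec Spin n
    spins = Vec.tabulate spin

    end-spins : ∀ {v} → Inner v → end spins v ≡ inner (spin v)
    end-spins {v} iv = trans (end-inner spins iv) (cong inner (Vec.lookup∘tabulate spin v))

    opened : ∀ {x y} → Place x → Place y → x ~ y → agree (end spins x) (end spins y) true ≡ true
    opened at-s     at-s     xy = contradiction xy (sub-irrefl refl)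
    opened at-s     at-t     xy = contradiction (one xy) disconnected
    opened at-t     at-s     xy = contradiction (one (sub-symm xy)) disconnected
    opened at-t     at-t     xy = contradiction xy (sub-irrefl refl)
    opened {y = y} at-s (mid iy) xy rewrite end-s spins | end-spins iy with spin y | proj₂ (forced y)
    ... | _ | terminal ¬iy    = contradiction iy ¬iy
    ... | _ | to-source _ _   = refl
    ... | _ | to-sink _ ty    = contradiction (two xy (sub-symm ty)) disconnected
    ... | _ | free _ ¬sy _    = contradiction xy ¬sy
    opened {y = y} at-t (mid iy) xy rewrite end-t spins | end-spins iy with spin y | proj₂ (forced y)
    ... | _ | terminal ¬iy    = contradiction iy ¬iy
    ... | _ | to-source _ sy  = contradiction (two sy (sub-symm xy)) disconnected
    ... | _ | to-sink _ _     = refl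
    ... | _ | free _ _ ¬ty    = contradiction xy ¬ty
    opened (mid ix) at-s xy = trans (agree-comm (end spins _) (end spins s) true) (opened at-s (mid ix) (sub-symm xy))
    opened (mid ix) at-t xy = trans (agree-comm (end spins _) (end spins t) true) (opened at-t (mid ix) (sub-symm xy))
    opened {x} {y} (mid ix) (mid iy) xy rewrite end-spins ix | end-spins iy
      with spin x | proj₂ (forced x) | spin y | proj₂ (forced y)
    ... | _ | terminal ¬ix   | _ | _              = contradiction ix ¬ix
    ... | _ | _              | _ | terminal ¬iy   = contradiction iy ¬iy
    ... | _ | free _ _ _     | _ | _              = refl
    ... | _ | to-source _ _  | _ | to-source _ _  = refl
    ... | _ | to-source _ sx | _ | to-sink _ ty   =
      contradiction (three (proj₂ ix) (proj₁ iy) sx xy (sub-symm ty)) disconnected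
    ... | _ | to-source _ _  | _ | free _ _ _     = refl
    ... | _ | to-sink _ tx   | _ | to-source _ sy =
      contradiction (three (proj₂ iy) (proj₁ ix) sy (sub-symm xy) (sub-symm tx)) disconnected
    ... | _ | to-sink _ _    | _ | to-sink _ _    = refl
    ... | _ | to-sink _ _    | _ | free _ _ _     = refl

    closed : ∀ {x y} → Place x → Place y → Adj x y → ¬ x ~ y → agree (end spins x) (end spins y) false ≡ true
    closed at-s     at-s     xy ¬xy = contradiction xy (irrefl refl)
    closed at-s     at-t     xy ¬xy rewrite end-s spins | end-t spins = refl
    closed at-t     at-s     xy ¬xy rewrite end-s spins | end-t spins = refl
    closed at-t     at-t     xy ¬xy = contradiction xy (irrefl refl)
    closed {y = y} at-s (mid iy) xy ¬xy rewrite end-s spins | end-spins iy with spin y | proj₂ (forced y)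
    ... | _ | terminal _      = refl
    ... | _ | to-source _ sy  = contradiction sy ¬xy
    ... | _ | to-sink _ _     = refl
    ... | _ | free _ _ _      = refl
    closed {y = y} at-t (mid iy) xy ¬xy rewrite end-t spins | end-spins iy with spin y | proj₂ (forced y)
    ... | _ | terminal _      = refl
    ... | _ | to-source _ _   = refl
    ... | _ | to-sink _ ty    = contradiction ty ¬xy
    ... | _ | free _ _ _      = refl
    closed (mid ix) at-s xy ¬xy = trans (agree-comm (end spins _) (end spins s) false)
      (closed at-s (mid ix) (symm xy) (λ yx → ¬xy (sub-symm yx)))
    closed (mid ix) at-t xy ¬xy = trans (agree-comm (end spins _) (end spins t) false)
      (closed at-t (mid ix) (symm xy) (λ yx → ¬xy (sub-symm yx)))
    closed (mid ix) (mid iy) xy ¬xy rewrite end-spins ix | end-spins iy = refl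

    -- The adjacency brings its own index `j`. Since `edges` has no repetitions, `j` is `i`, and a
    -- listing as (y , x) would contradict the order of the endpoints.
    ~-index : ∀ i {x y} → List.lookup es i ≡ (x , y) → x ~ y → lookup S i ≡ true
    ~-index i {x} {y} eq (j , j∈S , inj₁ eq′)
      with refl ← lookup-injective unique-edges i j (trans eq (sym eq′)) = Vec.[]=⇒lookup j∈S
    ~-index i {x} {y} eq (j , j∈S , inj₂ eq′) = contradiction
      (proj₁ (∈-edges⁻ (subst (_∈ es) eq (∈-lookup i))))
      (ℕ.<-asym (proj₁ (∈-edges⁻ (subst (_∈ es) eq′ (∈-lookup j)))))

    spins-allowed : allowed S spins ≡ true
    spins-allowed = compatible⁺ (rule spins) es S λ i → obey i (List.lookup es i) refl (lookup S i) refl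
      where
      obey : ∀ i e → List.lookup es i ≡ e → ∀ b → lookup S i ≡ b → rule spins e b ≡ true
      obey i (x , y) eq true  Si = opened (place x) (place y) (i , Vec.lookup⇒[]= i S Si , inj₁ eq)
      obey i (x , y) eq false Si = closed (place x) (place y)
        (proj₂ (∈-edges⁻ (subst (_∈ es) eq (∈-lookup i))))
        (λ xy → contradiction (trans (sym (~-index i eq xy)) Si) λ ())

    spins-admissible : Admissible types spins
    spins-admissible v rewrite lookup-types v | Vec.lookup∘tabulate spin v with spin v | proj₂ (forced v)
    ... | _ | terminal _       = refl
    ... | _ | to-source iv sv  = dec-true (source? v) (SubAdj⇒Adj S sv , proj₂ iv)
    ... | _ | to-sink iv tv    = dec-true (sink? v) (SubAdj⇒Adj S tv , proj₁ iv)
    ... | _ | free _ _ _       = refl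

    closed-violated : ∀ τ {u v} → Adj u v → ¬ u ~ v → agree (end τ u) (end τ v) false ≡ false → allowed S τ ≡ false
    closed-violated τ {u} {v} uv ¬uv eq = compatible⁻ (rule τ) es S i
      (trans (cong (rule τ (List.lookup es i)) Si≡false) at)
      where
      i = index (edge-∈ uv)
      ends : List.lookup es i ≡ (u , v) ⊎ List.lookup es i ≡ (v , u)
      ends = Sum.map (trans at-index) (trans at-index) (edge-ends u v)
        where
        at-index : List.lookup es i ≡ edge u v
        at-index = sym (lookup-index (edge-∈ uv))
      at : rule τ (List.lookup es i) false ≡ false
      at with ends
      ... | inj₁ e = trans (cong (λ e → rule τ e false) e) eq
      ... | inj₂ e = trans (cong (λ e → rule τ e false) e) (trans (agree-comm (end τ v) (end τ u) false) eq)
      Si≡false : lookup S i ≡ false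
      Si≡false with lookup S i in Si
      ... | true  = contradiction (i , Vec.lookup⇒[]= i S Si , ends) ¬uv
      ... | false = refl

    -- A surviving edge to a terminal forces the spin by the rule for present edges. At other inner
    -- vertices, admissibility provides an edge of the graph behind each spin src or snk, and the
    -- rule for absent edges excludes it.
    unique-spins : ∀ τ → Admissible types τ → allowed S τ ≡ true → τ ≡ spins
    unique-spins τ ok allowed-τ = trans (sym (Vec.tabulate∘lookup τ)) (Vec.tabulate-cong λ v → at v (lookup τ v) refl)
      where
      clash : ∀ {A : Set} → allowed S τ ≡ false → A
      clash eq = contradiction (trans (sym allowed-τ) eq) λ ()
      is-source : ∀ v → lookup τ v ≡ src → Source v
      is-source v eq = does-true (source? v) (trans
        (sym (cong₂ admissible (lookup-types v) eq)) (ok v))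
      is-sink : ∀ v → lookup τ v ≡ snk → Sink v
      is-sink v eq = does-true (sink? v) (trans
        (sym (cong₂ admissible (lookup-types v) eq)) (ok v))
      source-inner : ∀ {v} → Source v → Inner v
      source-inner (sv , v≢t) = (λ v≡s → irrefl (sym v≡s) sv) , v≢t
      sink-inner : ∀ {v} → Sink v → Inner v
      sink-inner (tv , v≢s) = v≢s , (λ v≡t → irrefl (sym v≡t) tv)
      at : ∀ v a → lookup τ v ≡ a → lookup τ v ≡ spin v
      at v a eq with spin v | proj₂ (forced v)
      at v src eq | _ | to-source _ _   = eq
      at v snk eq | _ | to-source iv sv = clash (source-violated S τ iv sv eq refl)
      at v off eq | _ | to-source iv sv = clash (source-violated S τ iv sv eq refl)
      at v src eq | _ | to-sink iv tv   = clash (sink-violated S τ iv (sub-symm tv) eq refl)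
      at v snk eq | _ | to-sink _ _     = eq
      at v off eq | _ | to-sink iv tv   = clash (sink-violated S τ iv (sub-symm tv) eq refl)
      at v src eq | _ | terminal ¬iv    = contradiction (source-inner (is-source v eq)) ¬iv
      at v snk eq | _ | terminal ¬iv    = contradiction (sink-inner (is-sink v eq)) ¬iv
      at v off eq | _ | terminal _      = eq
      at v src eq | _ | free iv ¬sv _   = clash (closed-violated τ (proj₁ (is-source v eq)) ¬sv
        (cong₂ (λ x y → agree x y false) (end-s τ) (trans (end-inner τ iv) (cong inner eq))))
      at v snk eq | _ | free iv _ ¬tv   = clash (closed-violated τ (proj₁ (is-sink v eq)) ¬tv
        (cong₂ (λ x y → agree x y false) (end-t τ) (trans (end-inner τ iv) (cong inner eq))))
      at v off eq | _ | free _ _ _      = eq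

  -- The sum counts the admissible spins compatible with `S`: none if there is a short path, exactly
  -- one if there is none. Failure thereby becomes a sum over spins, and for fixed spins the edges
  -- are independent.
  failure-indicator : ∀ S (pathset? : Dec (IsPathset 3 G S)) →
    ⟦ does pathset? ⟧ + ∑₁ types (λ σ → ⟦ allowed S σ ⟧) ≡ 1ℚ
  failure-indicator S (yes pathset) = cong (1ℚ +_) (∑₁-vanish types (λ σ → ⟦ allowed S σ ⟧) λ σ _ →
          cong ⟦_⟧ (connected-disallowed S (pathset⇒connected S pathset) σ))
  failure-indicator S (no ¬pathset) = cong (0ℚ +_) (∑₁-point types (λ σ → ⟦ allowed S σ ⟧) (spins S disconnected)
          (spins-admissible S disconnected) (cong ⟦_⟧ (spins-allowed S disconnected)) others)
    where
    disconnected : ¬ Connected (SubAdj graph S)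
    disconnected c = ¬pathset (connected⇒pathset S c)
    others : ∀ τ → Admissible types τ → τ ≢ spins S disconnected → ⟦ allowed S τ ⟧ ≡ 0ℚ
    others τ ok τ≢ with allowed S τ in eq
    ... | true  = contradiction (unique-spins S disconnected τ ok eq) τ≢
    ... | false = refl

  -- The failure probability as a partition function.

  module _ (ρ : ℚ) (0≤ρ : 0ℚ ≤ ρ) (ρ≤1 : ρ ≤ 1ℚ) where

    open Bound ρ 0≤ρ ρ≤1 using (p)
    open Model ρ 0≤ρ ρ≤1 using (link; links; Z)
    open Expectation ρ

    directFactor : ℚ
    directFactor = if does (Adj? s t) then ρ else 1ℚ

    average : Vec Spin n → Fin n × Fin n → ℚ
    average σ e = p * ⟦ rule σ e true ⟧ + ρ * ⟦ rule σ e false ⟧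

    average-agree : End → End → ℚ
    average-agree x y = p * ⟦ agree x y true ⟧ + ρ * ⟦ agree x y false ⟧

    pick-closed : ∀ p ρ → p * 0ℚ + ρ * 1ℚ ≡ ρ
    pick-closed = solve-∀ ring

    pick-open : ∀ p ρ → p * 1ℚ + ρ * 0ℚ ≡ p
    pick-open = solve-∀ ring

    average-source : ∀ a → average-agree source (inner a) ≡ starSource p ρ a
    average-source src = pick-open p ρ
    average-source snk = pick-closed p ρ
    average-source off = pick-closed p ρ

    average-sink : ∀ a → average-agree sink (inner a) ≡ starSink p ρ a
    average-sink src = pick-closed p ρ
    average-sink snk = pick-open p ρ
    average-sink off = pick-closed p ρ

    average-inner : ∀ a b → average-agree (inner a) (inner b) ≡ link a b
    average-inner = λ where
        src src → either
        src snk → pick-closed p ρ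
        src off → either
        snk src → pick-closed p ρ
        snk snk → either
        snk off → either
        off src → either
        off snk → either
        off off → either
      where
      identity : ∀ ρ → (1ℚ - ρ) * 1ℚ + ρ * 1ℚ ≡ 1ℚ
      identity = solve-∀ ring
      either : p * 1ℚ + ρ * 1ℚ ≡ 1ℚ
      either = identity ρ

    private
      *-isCM = *-1-isCommutativeMonoid
      module P = Fold *-isCM

    finFold-stars : ∀ k (a b : Fin k → Bool) σ →
      P.finFold k (λ v → (if a v then starSource p ρ (lookup σ v) else 1ℚ)
                       * (if b v then starSink p ρ (lookup σ v) else 1ℚ))
      ≡ stars p ρ (Vec.tabulate λ v → a v , b v) σ
    finFold-stars zero    a b []      = refl
    finFold-stars (suc k) a b (x ∷ σ) = cong (star p ρ (a zero , b zero) x *_)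
      (finFold-stars k (λ v → a (suc v)) (λ v → b (suc v)) σ)

    fold-middle : ∀ σ {D} → All Middle D → P.fold (average σ) D ≡ links D σ
    fold-middle σ []                    = refl
    fold-middle σ {(x , y) ∷ D} ((ix , iy) ∷ m) = cong₂ _*_
      (trans (cong₂ average-agree (end-inner σ ix) (end-inner σ iy))
             (average-inner (lookup σ x) (lookup σ y)))
      (fold-middle σ m)

    expected-allowed : ∀ σ → 𝔼 (edgeCount graph) (λ S → ⟦ allowed S σ ⟧) ≡
                       directFactor * (stars p ρ types σ * links middle σ)
    expected-allowed σ = begin
      𝔼 (edgeCount graph) (λ S → ⟦ allowed S σ ⟧)
        ≡⟨ 𝔼-compatible (rule σ) es ⟩
      P.fold (average σ) es
        ≡⟨ fold-edges *-isCM (average σ) (λ u v → cong₂ (λ x y → p * ⟦ x ⟧ + ρ * ⟦ y ⟧)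
             (agree-comm (end σ u) (end σ v) true) (agree-comm (end σ u) (end σ v) false)) ⟩
      (if does (Adj? s t) then average σ (s , t) else 1ℚ) *
        (P.finFold n (λ v → (if does (source? v) then average σ (s , v) else 1ℚ) *
                            (if does (sink? v) then average σ (t , v) else 1ℚ)) * P.fold (average σ) middle)
        ≡⟨ cong₂ _*_ (cong (λ z → if does (Adj? s t) then z else 1ℚ) at-st)
             (cong₂ _*_ (trans (P.finFold-cong n λ v → cong₂ _*_ (at-source v) (at-sink v))
                               (finFold-stars n (λ v → does (source? v)) (λ v → does (sink? v)) σ))
                        (fold-middle σ (all-filter middle? es))) ⟩
      directFactor * (stars p ρ types σ * links middle σ) ∎
      where
      open ≡-Reasoning
      if-cong : ∀ {A : Set} {x y z : ℚ} (d : Dec A) → (A → x ≡ y) →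
                (if does d then x else z) ≡ (if does d then y else z)
      if-cong (yes a) x≡y = x≡y a
      if-cong (no _)  x≡y = refl
      at-st : average σ (s , t) ≡ ρ
      at-st = trans (cong₂ average-agree (end-s σ) (end-t σ)) (pick-closed p ρ)
      at-source : ∀ v → (if does (source? v) then average σ (s , v) else 1ℚ) ≡
                        (if does (source? v) then starSource p ρ (lookup σ v) else 1ℚ)
      at-source v = if-cong (source? v) λ (sv , v≢t) → trans
        (cong₂ average-agree (end-s σ) (end-inner σ ((λ v≡s → irrefl (sym v≡s) sv) , v≢t)))
        (average-source (lookup σ v))
      at-sink : ∀ v → (if does (sink? v) then average σ (t , v) else 1ℚ) ≡
                      (if does (sink? v) then starSink p ρ (lookup σ v) else 1ℚ)
      at-sink v = if-cong (sink? v) λ (tv , v≢s) → trans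
        (cong₂ average-agree (end-t σ) (end-inner σ (v≢s , (λ v≡t → irrefl (sym v≡t) tv))))
        (average-sink (lookup σ v))

    reliability+failure : 𝔼 (edgeCount graph) (λ S → ⟦ does (isPathset? 3 G S) ⟧) + directFactor * Z types middle ≡ 1ℚ
    reliability+failure = begin
      𝔼 m pathset + directFactor * Z types middle
        ≡⟨ cong (λ z → 𝔼 m pathset + z) (begin
             directFactor * Z types middle
               ≡⟨ cong (directFactor *_) (∑-stars p ρ types (links middle)) ⟨
             directFactor * ∑₁ types (λ σ → stars p ρ types σ * links middle σ)
               ≡⟨ Indicator.∑-*ˡ types directFactor (λ σ → stars p ρ types σ * links middle σ) ⟨
             ∑₁ types (λ σ → directFactor * (stars p ρ types σ * links middle σ))
               ≡⟨ Indicator.∑-cong types expected-allowed ⟨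
             ∑₁ types (λ σ → 𝔼 m (λ S → ⟦ allowed S σ ⟧))
               ≡⟨ 𝔼-∑ 1ℚ 1ℚ m types (λ S σ → ⟦ allowed S σ ⟧) ⟨
             𝔼 m (λ S → ∑₁ types (λ σ → ⟦ allowed S σ ⟧)) ∎) ⟩
      𝔼 m pathset + 𝔼 m (λ S → ∑₁ types (λ σ → ⟦ allowed S σ ⟧))
        ≡⟨ 𝔼-+ m pathset (λ S → ∑₁ types (λ σ → ⟦ allowed S σ ⟧)) ⟨
      𝔼 m (λ S → pathset S + ∑₁ types (λ σ → ⟦ allowed S σ ⟧))
        ≡⟨ 𝔼-cong m (λ S → failure-indicator S (isPathset? 3 G S)) ⟩
      𝔼 m (λ _ → 1ℚ)
        ≡⟨ 𝔼-1 m ⟩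
      1ℚ ∎
      where
      open ≡-Reasoning
      m = edgeCount graph
      pathset : Subset m → ℚ
      pathset S = ⟦ does (isPathset? 3 G S) ⟧

-- Real parameters

reliabilityℚ : ℚ → ∀ {n} → TwoTerminalGraph n → ℚ
reliabilityℚ ρ G = Expectation.𝔼 ρ (edgeCount (TwoTerminalGraph.graph G)) λ S → ⟦ does (isPathset? 3 G S) ⟧

seq-survival : ∀ ρ i {m} (S : Subset m) → seq (survival ρ S) i ≡ survivalℚ (seq ρ i) S
seq-survival ρ i []            = refl
seq-survival ρ i (inside  ∷ S) = cong ((1ℚ - seq ρ i) *_) (seq-survival ρ i S)
seq-survival ρ i (outside ∷ S) = cong (seq ρ i *_) (seq-survival ρ i S)

seq-sum-filter : ∀ ρ i {m} {P : Subset m → Set} (P? : ∀ S → Dec (P S)) Ss →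
  seq (sumℝ (map (survival ρ) (filter P? Ss))) i ≡
  listSum (λ S → ⟦ does (P? S) ⟧ * survivalℚ (seq ρ i) S) Ss
seq-sum-filter ρ i P? []       = refl
seq-sum-filter ρ i P? (S ∷ Ss) with does (P? S)
... | true  = cong₂ _+_ (trans (seq-survival ρ i S) (sym (*-identityˡ (survivalℚ (seq ρ i) S))))
                        (seq-sum-filter ρ i P? Ss)
... | false = trans (seq-sum-filter ρ i P? Ss) (trans (sym (+-identityˡ _))
  (cong (_+ listSum (λ S → ⟦ does (P? S) ⟧ * survivalℚ (seq ρ i) S) Ss)
        (sym (*-zeroˡ (survivalℚ (seq ρ i) S)))))

-- Arithmetic on Cauchy sequences is termwise, so the relation to the rational polynomial is an
-- equality at each index and not only in the limit.
seq-reliability : ∀ {n} (G : TwoTerminalGraph n) ρ i →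
                  seq (reliability 3 G ρ) i ≡ reliabilityℚ (seq ρ i) G
seq-reliability G ρ i = trans
  (seq-sum-filter ρ i (isPathset? 3 G) (allSubsets (edgeCount (TwoTerminalGraph.graph G))))
  (Expectation.𝔼-listSum (seq ρ i) (edgeCount (TwoTerminalGraph.graph G)) λ S → ⟦ does (isPathset? 3 G S) ⟧)

-- The interval is [-2,2] rather than [0,1], because the terms of a sequence that represents a real
-- in [0,1] may lie outside [0,1]. The bound `B` serves the product rule.
record Lipschitz (f : ℚ → ℚ) : Set where
  field
    B K   : ℚ
    0<B   : 0ℚ < B
    0<K   : 0ℚ < K
    bound : ∀ x → ∣ x ∣ ≤ 2ℚ → ∣ f x ∣ ≤ B
    close : ∀ x y → ∣ x ∣ ≤ 2ℚ → ∣ y ∣ ≤ 2ℚ → ∣ f x - f y ∣ ≤ K * ∣ x - y ∣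

open Lipschitz

0<1ℚ : 0ℚ < 1ℚ
0<1ℚ = positive⁻¹ 1ℚ

lipschitz-const : ∀ c → Lipschitz λ _ → c
lipschitz-const c .B           = 1ℚ + ∣ c ∣
lipschitz-const c .K           = 1ℚ
lipschitz-const c .0<B         = +-mono-<-≤ 0<1ℚ (0≤∣p∣ c)
lipschitz-const c .0<K         = 0<1ℚ
lipschitz-const c .bound x _   = ≤-of-sum 1ℚ (<⇒≤ 0<1ℚ) (+-comm 1ℚ ∣ c ∣)
lipschitz-const c .close x y _ _ = subst (_≤ 1ℚ * ∣ x - y ∣) (cong ∣_∣ (sym (+-inverseʳ c)))
  (*-nonneg (<⇒≤ 0<1ℚ) (0≤∣p∣ (x - y)))

lipschitz-id : Lipschitz λ x → x
lipschitz-id .B             = 2ℚ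
lipschitz-id .K             = 1ℚ
lipschitz-id .0<B           = positive⁻¹ 2ℚ
lipschitz-id .0<K           = 0<1ℚ
lipschitz-id .bound x x≤2   = x≤2
lipschitz-id .close x y _ _ = ≤-reflexive (sym (*-identityˡ ∣ x - y ∣))

lipschitz-+ : ∀ {f h} → Lipschitz f → Lipschitz h → Lipschitz λ x → f x + h x
lipschitz-+ F H .B             = F .B + H .B
lipschitz-+ F H .K             = F .K + H .K
lipschitz-+ F H .0<B           = +-mono-< (F .0<B) (H .0<B)
lipschitz-+ F H .0<K           = +-mono-< (F .0<K) (H .0<K)
lipschitz-+ F H .bound x x≤2   = triangle _ refl (F .bound x x≤2) (H .bound x x≤2)
lipschitz-+ {f} {h} F H .close x y x≤2 y≤2 = subst (∣ (f x + h x) - (f y + h y) ∣ ≤_)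
  (sym (*-distribʳ-+ ∣ x - y ∣ (F .K) (H .K)))
  (triangle _ (+-rearrange (f x) (h x) (f y) (h y)) (F .close x y x≤2 y≤2) (H .close x y x≤2 y≤2))

lipschitz-* : ∀ {f h} → Lipschitz f → Lipschitz h → Lipschitz λ x → f x * h x
lipschitz-* F H .B             = F .B * H .B
lipschitz-* F H .K             = F .B * H .K + H .B * F .K
lipschitz-* F H .0<B           = *-pos (F .0<B) (H .0<B)
lipschitz-* F H .0<K           = +-mono-< (*-pos (F .0<B) (H .0<K)) (*-pos (H .0<B) (F .0<K))
lipschitz-* F H .bound x x≤2   = ∣*∣-mono (F .0<B) (F .bound x x≤2) (H .bound x x≤2)
lipschitz-* {f} {h} F H .close x y x≤2 y≤2 = subst (∣ f x * h x - f y * h y ∣ ≤_)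
  (identity (F .B) (H .K) (H .B) (F .K) ∣ x - y ∣)
  (triangle _ (*-rearrange (f x) (h x) (f y) (h y))
    (∣*∣-mono (F .0<B) (F .bound x x≤2) (H .close x y x≤2 y≤2))
    (∣*∣-mono (H .0<B) (H .bound y y≤2) (F .close x y x≤2 y≤2)))
  where
  identity : ∀ a b c d z → a * (b * z) + c * (d * z) ≡ (a * b + c * d) * z
  identity = solve-∀ ring

lipschitz-complement : Lipschitz λ x → 1ℚ - x
lipschitz-complement .B           = 1ℚ + 2ℚ
lipschitz-complement .K           = 1ℚ
lipschitz-complement .0<B         = positive⁻¹ (1ℚ + 2ℚ)
lipschitz-complement .0<K         = 0<1ℚ
lipschitz-complement .bound x x≤2 =
  triangle {1ℚ} { - x} (1ℚ - x) refl ≤-refl (subst (_≤ 2ℚ) (sym (∣-p∣≡∣p∣ x)) x≤2)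
lipschitz-complement .close x y _ _ = ≤-reflexive (begin
  ∣ (1ℚ - x) - (1ℚ - y) ∣  ≡⟨ cong ∣_∣ (identity x y) ⟩
  ∣ - (x - y) ∣            ≡⟨ ∣-p∣≡∣p∣ (x - y) ⟩
  ∣ x - y ∣                ≡⟨ *-identityˡ ∣ x - y ∣ ⟨
  1ℚ * ∣ x - y ∣           ∎)
  where
  open ≡-Reasoning
  identity : ∀ x y → (1ℚ - x) - (1ℚ - y) ≡ - (x - y)
  identity = solve-∀ ring

lipschitz-𝔼 : ∀ m (f : Subset m → ℚ) → Lipschitz λ ρ → Expectation.𝔼 ρ m f
lipschitz-𝔼 zero    f = lipschitz-const (f [])
lipschitz-𝔼 (suc m) f = lipschitz-+
  (lipschitz-* lipschitz-complement (lipschitz-𝔼 m λ S → f (inside ∷ S)))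
  (lipschitz-* lipschitz-id (lipschitz-𝔼 m λ S → f (outside ∷ S)))

∣∣≤ : ∀ {x δ} → x ≤ δ → - x ≤ δ → ∣ x ∣ ≤ δ
∣∣≤ {x} {δ} x≤δ -x≤δ with ∣p∣≡p∨∣p∣≡-p x
... | inj₁ eq = subst (_≤ δ) (sym eq) x≤δ
... | inj₂ eq = subst (_≤ δ) (sym eq) -x≤δ

≤∣∣ : ∀ x → x ≤ ∣ x ∣
≤∣∣ x with ≤-total 0ℚ x
... | inj₁ 0≤x = ≤-reflexive (sym (0≤p⇒∣p∣≡p 0≤x))
... | inj₂ x≤0 = ≤-trans x≤0 (0≤∣p∣ x)

nearest : ∀ {x δ} → 0ℚ ≤ δ → 0ℚ ≤ x + δ → x ≤ 1ℚ + δ →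
          ∃ λ y → 0ℚ ≤ y × y ≤ 1ℚ × ∣ x - y ∣ ≤ δ
nearest {x} {δ} 0≤δ 0≤x+δ x≤1+δ with ≤-total 0ℚ x | ≤-total x 1ℚ
... | inj₂ x≤0 | _        = 0ℚ , ≤-refl , <⇒≤ 0<1ℚ ,
  ∣∣≤ (≤-trans (≤-reflexive (+-identityʳ x)) (≤-trans x≤0 0≤δ)) (≤-of-diff (subst (0ℚ ≤_) (identity x δ) 0≤x+δ))
  where
  identity : ∀ x δ → x + δ ≡ δ - (- (x - 0ℚ))
  identity = solve-∀ ring
... | inj₁ _   | inj₂ 1≤x = 1ℚ , <⇒≤ 0<1ℚ , ≤-refl ,
  ∣∣≤ (≤-of-diff (subst (0ℚ ≤_) (identity x δ) (0≤- x≤1+δ)))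
      (≤-trans (≤-of-diff (subst (0ℚ ≤_) (identity′ x) (0≤- 1≤x))) 0≤δ)
  where
  identity : ∀ x δ → (1ℚ + δ) - x ≡ δ - (x - 1ℚ)
  identity = solve-∀ ring
  identity′ : ∀ x → x - 1ℚ ≡ 0ℚ - - (x - 1ℚ)
  identity′ = solve-∀ ring
... | inj₁ 0≤x | inj₁ x≤1 = x , 0≤x , x≤1 ,
  subst (_≤ δ) (cong ∣_∣ (sym (+-inverseʳ x))) 0≤δ

smaller : ∀ {a} → 0ℚ < a → ∃ λ δ → 0ℚ < δ × δ ≤ a × δ ≤ 1ℚ
smaller {a} 0<a with ≤-total a 1ℚ
... | inj₁ a≤1 = a , 0<a , ≤-refl , a≤1
... | inj₂ 1≤a = 1ℚ , 0<1ℚ , 1≤a , ≤-refl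

-- The hypothesis covers rationals in [0,1] only, so a term outside is compared through the nearest
-- point of [0,1]. Moving there and back costs at most the sum of the two Lipschitz constants times
-- the distance.
lipschitz-mono-ℝ : ∀ {f h} → Lipschitz f → Lipschitz h →
  (∀ x → 0ℚ ≤ x → x ≤ 1ℚ → f x ≤ h x) →
  ∀ ρ → 0ℝ ≤ℝ ρ → ρ ≤ℝ 1ℝ → ∀ ε → 0ℚ < ε → ∃ λ N → ∀ i → N ℕ.≤ i → f (seq ρ i) ≤ h (seq ρ i) + ε
lipschitz-mono-ℝ {f} {h} F H f≤h ρ 0≤ρ ρ≤1 ε 0<ε
  with δ₀ , 0<δ₀ , Kδ₀≡ε ← rescale (+-mono-< (F .0<K) (H .0<K)) 0<ε
  -- The bound by `δ₀` makes the total error at most ε; the bound by 1 keeps the terms inside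
  -- [-2,2].
  with δ , 0<δ , δ≤δ₀ , δ≤1 ← smaller 0<δ₀
  with M , below ← 0≤ρ δ 0<δ | N , above ← ρ≤1 δ 0<δ = M ℕ.⊔ N , λ i i≥ →
    near (seq ρ i) (below i (ℕ.m⊔n≤o⇒m≤o M N i≥)) (above i (ℕ.m⊔n≤o⇒n≤o M N i≥)) δ≤δ₀ δ≤1 0<δ Kδ₀≡ε
  where
  near : ∀ x {δ δ₀} → 0ℚ ≤ x + δ → x ≤ 1ℚ + δ → δ ≤ δ₀ → δ ≤ 1ℚ → 0ℚ < δ →
         (F .K + H .K) * δ₀ ≡ ε → f x ≤ h x + ε
  near x {δ} {δ₀} 0≤x+δ x≤1+δ δ≤δ₀ δ≤1 0<δ Kδ₀≡ε with nearest (<⇒≤ 0<δ) 0≤x+δ x≤1+δ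
  ... | y , 0≤y , y≤1 , x-y≤δ = begin
    f x                                        ≡⟨ split (f x) (f y) ⟩
    (f x - f y) + f y                          ≤⟨ +-mono-≤ (≤-trans (≤∣∣ (f x - f y)) (F .close x y x≤2 y≤2))
                                                   (f≤h y 0≤y y≤1) ⟩
    F .K * ∣ x - y ∣ + h y                     ≡⟨ cong (F .K * ∣ x - y ∣ +_) (split (h y) (h x)) ⟩
    F .K * ∣ x - y ∣ + ((h y - h x) + h x)     ≤⟨ +-monoʳ-≤ (F .K * ∣ x - y ∣) (+-monoˡ-≤ (h x)
                                                   (≤-trans (≤∣∣ (h y - h x)) (H .close y x y≤2 x≤2))) ⟩
    F .K * ∣ x - y ∣ + (H .K * ∣ y - x ∣ + h x) ≡⟨ cong (λ d → F .K * ∣ x - y ∣ + (H .K * d + h x)) (∣∣-sym y x) ⟩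
    F .K * ∣ x - y ∣ + (H .K * ∣ x - y ∣ + h x) ≡⟨ collect (F .K) (H .K) ∣ x - y ∣ (h x) ⟩
    h x + (F .K + H .K) * ∣ x - y ∣            ≤⟨ +-monoʳ-≤ (h x) (*-monoˡ (<⇒≤ (+-mono-< (F .0<K) (H .0<K)))
                                                   (≤-trans x-y≤δ δ≤δ₀)) ⟩
    h x + (F .K + H .K) * δ₀                   ≡⟨ cong (h x +_) Kδ₀≡ε ⟩
    h x + ε                                    ∎
    where
    open ≤-Reasoning
    split : ∀ a b → a ≡ (a - b) + b
    split = solve-∀ ring
    collect : ∀ a b d z → a * d + (b * d + z) ≡ z + (a + b) * d
    collect = solve-∀ ring
    ∣∣-sym : ∀ a b → ∣ a - b ∣ ≡ ∣ b - a ∣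
    ∣∣-sym a b = trans (sym (∣-p∣≡∣p∣ (a - b))) (cong ∣_∣ (identity a b))
      where
      identity : ∀ a b → - (a - b) ≡ b - a
      identity = solve-∀ ring
    y≤2 : ∣ y ∣ ≤ 2ℚ
    y≤2 = ≤-trans (≤-reflexive (0≤p⇒∣p∣≡p 0≤y)) (≤-trans y≤1 (≤-of-sum 1ℚ (<⇒≤ 0<1ℚ) refl))
    x≤2 : ∣ x ∣ ≤ 2ℚ
    x≤2 = ∣∣≤ (≤-trans x≤1+δ (+-monoʳ-≤ 1ℚ δ≤1))
      (≤-of-diff (subst (0ℚ ≤_) (identity x δ)
        (+-nonneg 0≤x+δ (+-nonneg (<⇒≤ 0<1ℚ) (0≤- δ≤1)))))
      where
      identity : ∀ x δ → (x + δ) + (1ℚ + (1ℚ - δ)) ≡ 2ℚ - - x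
      identity = solve-∀ ring

lipschitz-reliability : ∀ {n} (G : TwoTerminalGraph n) → Lipschitz λ ρ → reliabilityℚ ρ G
lipschitz-reliability G =
  lipschitz-𝔼 (edgeCount (TwoTerminalGraph.graph G)) λ S → ⟦ does (isPathset? 3 G S) ⟧

reliability-mono : ∀ {n} (G H : TwoTerminalGraph n) →
  (∀ ρ → 0ℚ ≤ ρ → ρ ≤ 1ℚ → reliabilityℚ ρ G ≤ reliabilityℚ ρ H) →
  ∀ ρ → 0ℝ ≤ℝ ρ → ρ ≤ℝ 1ℝ → reliability 3 G ρ ≤ℝ reliability 3 H ρ
reliability-mono G H G≤H ρ 0≤ρ ρ≤1 ε 0<ε = proj₁ bound-ℚ , λ i i≥N →
  subst₂ (λ x y → x ≤ y + ε) (sym (seq-reliability G ρ i)) (sym (seq-reliability H ρ i))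
    (proj₂ bound-ℚ i i≥N)
  where
  bound-ℚ : ∃ λ N → ∀ i → N ℕ.≤ i → reliabilityℚ (seq ρ i) G ≤ reliabilityℚ (seq ρ i) H + ε
  bound-ℚ = lipschitz-mono-ℝ {λ ρ → reliabilityℚ ρ G} {λ ρ → reliabilityℚ ρ H}
    (lipschitz-reliability G) (lipschitz-reliability H) G≤H ρ 0≤ρ ρ≤1 ε 0<ε

fromℚ-mono : ∀ {x y} → x ≤ y → fromℚ x ≤ℝ fromℚ y
fromℚ-mono {x} {y} x≤y ε 0<ε = 0 , λ _ _ → ≤-trans x≤y (≤-of-sum ε (<⇒≤ 0<ε) refl)

≤-limit : ∀ g h → (∀ ε → 0ℚ < ε → g ≤ h + ε) → g ≤ h
≤-limit g h g≤h+ with g ≤? h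
... | yes g≤h = g≤h
... | no  g≰h = contradiction (<-≤-trans gap (g≤h+ ε (½ε>0 0<g-h))) (<-irrefl refl)
  where
  ε : ℚ
  ε = ½ * (g - h)
  0<g-h : 0ℚ < g - h
  0<g-h = subst (_< g - h) (+-inverseʳ h) (+-monoˡ-< (- h) (≰⇒> g≰h))
  gap : h + ε < g
  gap = subst₂ _<_ (+-identityʳ (h + ε)) (identity g h) (+-monoʳ-< (h + ε) (½ε>0 0<g-h))
    where
    identity : ∀ g h → (h + ½ * (g - h)) + ½ * (g - h) ≡ g
    identity = solve-∀ ring

reliability-fromℚ : ∀ {n} (G H : TwoTerminalGraph n) ρ →
  reliability 3 G (fromℚ ρ) ≤ℝ reliability 3 H (fromℚ ρ) → reliabilityℚ ρ G ≤ reliabilityℚ ρ H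
reliability-fromℚ G H ρ G≤H = ≤-limit (reliabilityℚ ρ G) (reliabilityℚ ρ H) λ ε 0<ε →
  subst₂ (λ x y → x ≤ y + ε)
    (seq-reliability G (fromℚ ρ) (proj₁ (G≤H ε 0<ε))) (seq-reliability H (fromℚ ρ) (proj₁ (G≤H ε 0<ε)))
    (proj₂ (G≤H ε 0<ε) (proj₁ (G≤H ε 0<ε)) ℕ.≤-refl)

-- Extremal graphs

record Extremal {n} (G : TwoTerminalGraph n) : Set where
  open TwoTerminalGraph G
  open Structure G
  field
    adjacent : Adj s t
    twoSided : AllTwoSided types
    shape    : Shape types middle

module _ {n} (G : TwoTerminalGraph n) where

  open TwoTerminalGraph G using (s; t; Adj; Adj?)
  open Structure G using (types; middle; edgeCount-split)

  innerCount : ℕ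
  innerCount = length middle ℕ.+ cost types

  extremal-edgeCount : Extremal G → edgeCount (TwoTerminalGraph.graph G) ≡ suc innerCount
  extremal-edgeCount ext = trans edgeCount-split
    (cong (ℕ._+ innerCount) (adjacent-side (Adj? s t) (Extremal.adjacent ext)))
    where
    adjacent-side : (st? : Dec (Adj s t)) → Adj s t → side (does st?) ≡ 1
    adjacent-side (yes _)  st = refl
    adjacent-side (no ¬st) st = contradiction st ¬st

  module _ (ρ : ℚ) (0≤ρ : 0ℚ ≤ ρ) (ρ≤1 : ρ ≤ 1ℚ) where
    open Bound ρ 0≤ρ ρ≤1
    open Model ρ 0≤ρ ρ≤1

    failureℚ : ℚ
    failureℚ = (if does (Adj? s t) then ρ else 1ℚ) * Z types middle

    extremal-failure : Extremal G → failureℚ ≡ ρ * F innerCount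
    extremal-failure ext = cong₂ _*_ (adjacent-factor (Adj? s t) (Extremal.adjacent ext))
      (Z-shape types (Extremal.twoSided ext) (Extremal.shape ext))
      where
      adjacent-factor : (st? : Dec (Adj s t)) → Adj s t → (if does st? then ρ else 1ℚ) ≡ ρ
      adjacent-factor (yes _)  st = refl
      adjacent-factor (no ¬st) st = contradiction st ¬st

    ρ*F≤failure : ∀ {M} → edgeCount (TwoTerminalGraph.graph G) ≡ suc M → ρ * F M ≤ failureℚ
    ρ*F≤failure {M} count = compare (Adj? s t) (trans (sym edgeCount-split) count)
      where
      compare : (st? : Dec (Adj s t)) → side (does st?) ℕ.+ innerCount ≡ suc M →
                ρ * F M ≤ (if does st? then ρ else 1ℚ) * Z types middle
      compare (yes _) refl = *-monoˡ 0≤ρ (F≤Z types middle)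
      compare (no _)  eq   = begin
        ρ * F M              ≤⟨ ρ*F≤F M ⟩
        F (suc M)            ≡⟨ cong F eq ⟨
        F innerCount         ≤⟨ F≤Z types middle ⟩
        Z types middle       ≡⟨ *-identityˡ (Z types middle) ⟨
        1ℚ * Z types middle  ∎
        where open ≤-Reasoning

complement-≤ : ∀ {a b x y} → a + x ≡ 1ℚ → b + y ≡ 1ℚ → y ≤ x → a ≤ b
complement-≤ {a} {b} {x} {y} a+x b+y y≤x = ≤-of-diff (subst (0ℚ ≤_) (begin
  x - y                            ≡⟨ identity a b x y ⟩
  (b - a) + ((a + x) - (b + y))    ≡⟨ cong₂ (λ u v → (b - a) + (u - v)) a+x b+y ⟩
  (b - a) + (1ℚ - 1ℚ)              ≡⟨ +-identityʳ (b - a) ⟩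
  b - a                            ∎) (0≤- y≤x))
  where
  open ≡-Reasoning
  identity : ∀ a b x y → x - y ≡ (b - a) + ((a + x) - (b + y))
  identity = solve-∀ ring

complement-≤⁻ : ∀ {a b x y} → a + x ≡ 1ℚ → b + y ≡ 1ℚ → a ≤ b → y ≤ x
complement-≤⁻ {a} {b} {x} {y} a+x b+y = complement-≤ {y} {x} {b} {a}
  (trans (+-comm y b) b+y) (trans (+-comm x a) a+x)

extremal-best : ∀ {n} (G H : TwoTerminalGraph n) → Extremal H →
  edgeCount (TwoTerminalGraph.graph G) ≡ edgeCount (TwoTerminalGraph.graph H) →
  ∀ ρ → 0ℚ ≤ ρ → ρ ≤ 1ℚ → reliabilityℚ ρ G ≤ reliabilityℚ ρ H
extremal-best G H ext count ρ 0≤ρ ρ≤1 = complement-≤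
  (Unreliability.reliability+failure G ρ 0≤ρ ρ≤1) (Unreliability.reliability+failure H ρ 0≤ρ ρ≤1)
  (subst (_≤ failureℚ G ρ 0≤ρ ρ≤1) (sym (extremal-failure H ρ 0≤ρ ρ≤1 ext))
    (ρ*F≤failure G ρ 0≤ρ ρ≤1 (trans count (extremal-edgeCount H ext))))

extremal-unique : ∀ {n} (G H : TwoTerminalGraph n) → Extremal H →
  edgeCount (TwoTerminalGraph.graph G) ≡ edgeCount (TwoTerminalGraph.graph H) →
  reliabilityℚ ½ H ≤ reliabilityℚ ½ G → Extremal G
extremal-unique G H ext count H≤G = conclude (Adj? s t)
  (trans (sym edgeCount-split) (trans count (extremal-edgeCount H ext)))
  (subst (failureℚ G ½ 0≤½ ½≤1 ≤_) (extremal-failure H ½ 0≤½ ½≤1 ext)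
    (complement-≤⁻ (Unreliability.reliability+failure H ½ 0≤½ ½≤1)
                   (Unreliability.reliability+failure G ½ 0≤½ ½≤1) H≤G))
  where
  open TwoTerminalGraph G using (s; t; Adj; Adj?; irrefl)
  open Structure G using (es; types; middle; edgeCount-split; middle?; ∈-edges⁻; ∈-middle⁻)
  open Half
  open Model ½ 0≤½ ½≤1
  distinct-ends : ∀ {x y} → middle ≡ (x , y) ∷ [] → x ≢ y
  distinct-ends {x} {y} eq x≡y = irrefl x≡y
    (proj₂ (∈-edges⁻ (proj₁ (∈-middle⁻ (subst ((x , y) ∈_) (sym eq) (here refl))))))
  conclude : (st? : Dec (Adj s t)) → side (does st?) ℕ.+ innerCount G ≡ suc (innerCount H) →
             (if does st? then ½ else 1ℚ) * Z types middle ≤ ½ * F (innerCount H) → Extremal G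
  conclude (yes st) eq Z≤F = record
    { adjacent = st
    ; twoSided = Strict.tight-twoSided types middle tight
    ; shape    = Strict.tight-shape types middle distinct-ends tight
    }
    where
    tight : Z types middle ≤ F (innerCount G)
    tight = subst (λ k → Z types middle ≤ F k) (sym (ℕ.suc-injective eq)) (*-cancelˡ-≤-pos ½ Z≤F)
  conclude (no _)   eq Z≤F = contradiction (begin-strict
    F (innerCount G)        ≤⟨ F≤Z types middle ⟩
    Z types middle          ≡⟨ *-identityˡ (Z types middle) ⟨
    1ℚ * Z types middle     ≤⟨ Z≤F ⟩
    ½ * F (innerCount H)    <⟨ ½*F<F (innerCount H) ⟩
    F (suc (innerCount H))  ≡⟨ cong F eq ⟨
    F (innerCount G)        ∎) (<-irrefl refl)
    where open ≤-Reasoning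

-- Isomorphism of extremal graphs

module Counting {C : Set} (_≟_ : DecidableEquality C) where

  hit : C → C → ℕ
  hit c c′ = side (does (c ≟ c′))

  count : C → ∀ {n} → (Fin n → C) → ℕ
  count c f = sum λ v → hit c (f v)

  hit-refl : ∀ c → hit c c ≡ 1
  hit-refl c with c ≟ c
  ... | yes _   = refl
  ... | no  c≢c = contradiction refl c≢c

  hit-≢ : ∀ {c c′} → c ≢ c′ → hit c c′ ≡ 0
  hit-≢ {c} {c′} c≢c′ with c ≟ c′
  ... | yes c≡c′ = contradiction c≡c′ c≢c′
  ... | no  _    = refl

  count-occurs : ∀ c {n} (f : Fin n → C) {k} → count c f ≡ suc k → ∃ λ v → f v ≡ c
  count-occurs c {suc n} f eq with c ≟ f zero
  ... | yes c≡f0 = zero , sym c≡f0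
  ... | no  _    with v , fv≡c ← count-occurs c (λ v → f (suc v)) eq = suc v , fv≡c

  count-none : ∀ c {n} (f : Fin n → C) → (∀ v → f v ≢ c) → count c f ≡ 0
  count-none c {zero}  f none = refl
  count-none c {suc n} f none = cong₂ ℕ._+_ (hit-≢ (none zero ∘ sym))
    (count-none c (λ v → f (suc v)) λ v → none (suc v))

  count-once : ∀ c {n} (f : Fin n → C) v → f v ≡ c → (∀ w → f w ≡ c → w ≡ v) → count c f ≡ 1
  count-once c {suc n} f v refl once = trans (sum-remove {i = v} (λ w → hit c (f w)))
    (cong₂ ℕ._+_ (hit-refl (f v)) (count-none c (λ w → f (punchIn v w)) λ w eq → Fin.punchInᵢ≢i v w (once _ eq)))

  -- Send `zero` to any `j` of the same colour and delete both; the remaining counts still agree.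
  match-colours : ∀ {n} (f g : Fin n → C) → (∀ c → count c f ≡ count c g) →
                  ∃ λ (π : Permutation n n) → ∀ v → g (π ⟨$⟩ʳ v) ≡ f v
  match-colours {zero}  f g same = Permutation.id , λ ()
  match-colours {suc n} f g same
    with j , gj ← count-occurs (f zero) g
           (trans (sym (same (f zero))) (cong (ℕ._+ count (f zero) (λ v → f (suc v))) (hit-refl (f zero))))
    with π , eq ← match-colours (λ v → f (suc v)) (λ v → g (punchIn j v)) (λ c →
           ℕ.+-cancelˡ-≡ (hit c (f zero)) _ _ (trans (same c) (trans (sum-remove {i = j} (λ w → hit c (g w)))
             (cong (λ d → hit c d ℕ.+ count c (λ v → g (punchIn j v))) gj))))
    = Permutation.insert zero j π , λ where
        zero    → gj
        (suc v) → trans (cong g (Permutation.insert-punchIn zero j π v)) (eq v)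

-- The two terminals, the two ends of the middle edge, the other neighbours of
-- the terminals, and the isolated vertices.
data Colour : Set where
  sᶜ tᶜ xᶜ yᶜ joinedᶜ isolatedᶜ : Colour

-- Decidable equality is pulled back along this injection, which avoids the 36 pairs of
-- constructors.
code : Colour → ℕ
code sᶜ        = 0
code tᶜ        = 1
code xᶜ        = 2
code yᶜ        = 3
code joinedᶜ   = 4
code isolatedᶜ = 5

decode : ℕ → Colour
decode 0 = sᶜ
decode 1 = tᶜ
decode 2 = xᶜ
decode 3 = yᶜ
decode 4 = joinedᶜ
decode _ = isolatedᶜ

decode-code : ∀ c → decode (code c) ≡ c
decode-code sᶜ        = refl
decode-code tᶜ        = refl
decode-code xᶜ        = refl
decode-code yᶜ        = refl
decode-code joinedᶜ   = refl
decode-code isolatedᶜ = refl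

_≟ᶜ_ : DecidableEquality Colour
c ≟ᶜ d = Dec.map′ (λ eq → trans (sym (decode-code c)) (trans (cong decode eq) (decode-code d))) (cong code)
  (code c ℕ.≟ code d)

open Counting _≟ᶜ_

isJoined : Colour → Bool
isJoined xᶜ      = true
isJoined yᶜ      = true
isJoined joinedᶜ = true
isJoined _       = false

arc : Colour → Colour → Bool
arc sᶜ tᶜ = true
arc sᶜ c  = isJoined c
arc tᶜ c  = isJoined c
arc xᶜ yᶜ = true
arc _  _  = false

-- In an extremal graph adjacency depends on the two colours only, so a bijection that preserves
-- colours is an isomorphism, and it remains to compare the sizes of the colour classes.
related : Colour → Colour → Bool
related c d = arc c d ∨ arc d c

joined-count : ∀ {n} (f : Fin n → Colour) →
  sum (λ v → side (isJoined (f v))) ≡ count xᶜ f ℕ.+ (count yᶜ f ℕ.+ count joinedᶜ f)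
joined-count f = trans (sum-cong-≗ λ v → pointwise (f v)) (trans
  (∑-distrib-+ (λ v → hit xᶜ (f v)) (λ v → hit yᶜ (f v) ℕ.+ hit joinedᶜ (f v)))
  (cong (count xᶜ f ℕ.+_) (∑-distrib-+ (λ v → hit yᶜ (f v)) (λ v → hit joinedᶜ (f v)))))
  where
  pointwise : ∀ c → side (isJoined c) ≡ hit xᶜ c ℕ.+ (hit yᶜ c ℕ.+ hit joinedᶜ c)
  pointwise sᶜ        = refl
  pointwise tᶜ        = refl
  pointwise xᶜ        = refl
  pointwise yᶜ        = refl
  pointwise joinedᶜ   = refl
  pointwise isolatedᶜ = refl

total-count : ∀ {n} (f : Fin n → Colour) →
  n ≡ count sᶜ f ℕ.+ (count tᶜ f ℕ.+ (sum (λ v → side (isJoined (f v))) ℕ.+ count isolatedᶜ f))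
total-count {n} f = trans (ones n) (trans (sum-cong-≗ λ v → pointwise (f v)) (trans
  (∑-distrib-+ (λ v → hit sᶜ (f v)) (λ v → hit tᶜ (f v) ℕ.+ (side (isJoined (f v)) ℕ.+ hit isolatedᶜ (f v))))
  (cong (count sᶜ f ℕ.+_) (trans
    (∑-distrib-+ (λ v → hit tᶜ (f v)) (λ v → side (isJoined (f v)) ℕ.+ hit isolatedᶜ (f v)))
    (cong (count tᶜ f ℕ.+_) (∑-distrib-+ (λ v → side (isJoined (f v))) (λ v → hit isolatedᶜ (f v))))))))
  where
  ones : ∀ n → n ≡ sum {n} (λ _ → 1)
  ones zero    = refl
  ones (suc n) = cong suc (ones n)
  pointwise : ∀ c → 1 ≡ hit sᶜ c ℕ.+ (hit tᶜ c ℕ.+ (side (isJoined c) ℕ.+ hit isolatedᶜ c))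
  pointwise sᶜ        = refl
  pointwise tᶜ        = refl
  pointwise xᶜ        = refl
  pointwise yᶜ        = refl
  pointwise joinedᶜ   = refl
  pointwise isolatedᶜ = refl

base : Type → Colour
base (a , _) = if a then joinedᶜ else isolatedᶜ

tag : ∀ {n} → List (Fin n × Fin n) → Fin n → Colour → Colour
tag []            v c = c
tag ((x , y) ∷ _) v c = if does (v Fin.≟ x) then xᶜ else if does (v Fin.≟ y) then yᶜ else c

module _ {n} (ts : Vec Type n) where

  tagged : List (Fin n × Fin n) → Fin n → Colour
  tagged D v = tag D v (base (lookup ts v))

  base-isJoined : ∀ t → isJoined (base t) ≡ proj₁ t
  base-isJoined (true  , _) = refl
  base-isJoined (false , _) = refl

  tagged-isJoined : ∀ {D} → Shape ts D → ∀ v → isJoined (tagged D v) ≡ proj₁ (lookup ts v)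
  tagged-isJoined no-edge v = base-isJoined (lookup ts v)
  tagged-isJoined (one-edge {x} {y} _ tx ty) v with v Fin.≟ x | v Fin.≟ y
  ... | yes refl | _        = sym (cong proj₁ tx)
  ... | no _     | yes refl = sym (cong proj₁ ty)
  ... | no _     | no _     = base-isJoined (lookup ts v)

  base-unrelated : ∀ t t′ → related (base t) (base t′) ≡ false
  base-unrelated (true  , _) (true  , _) = refl
  base-unrelated (true  , _) (false , _) = refl
  base-unrelated (false , _) (true  , _) = refl
  base-unrelated (false , _) (false , _) = refl

  tagged-related⁻ : ∀ {D} → Shape ts D → ∀ u v → related (tagged D u) (tagged D v) ≡ true →
                    (u , v) ∈ D ⊎ (v , u) ∈ D
  tagged-related⁻ no-edge u v eq = contradiction (trans (sym eq) (base-unrelated (lookup ts u) (lookup ts v))) λ ()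
  tagged-related⁻ (one-edge {x} {y} _ _ _) u v eq
    with u Fin.≟ x | u Fin.≟ y | v Fin.≟ x | v Fin.≟ y
  ... | yes refl | _        | no _     | yes refl = inj₁ (here refl)
  ... | no _     | yes refl | yes refl | _        = inj₂ (here refl)
  ... | yes refl | _        | yes refl | _        = contradiction eq λ ()
  ... | no _     | yes refl | no _     | yes refl = contradiction eq λ ()
  ... | no _     | no _     | no _     | no _     =
    contradiction (trans (sym eq) (base-unrelated (lookup ts u) (lookup ts v))) λ ()
  ... | yes refl | _        | no _     | no _     = contradiction (trans (sym eq) (x-base (lookup ts v))) λ ()
    where
    x-base : ∀ t → related xᶜ (base t) ≡ false
    x-base (true  , _) = refl
    x-base (false , _) = refl
  ... | no _     | yes refl | no _     | no _     = contradiction (trans (sym eq) (y-base (lookup ts v))) λ ()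
    where
    y-base : ∀ t → related yᶜ (base t) ≡ false
    y-base (true  , _) = refl
    y-base (false , _) = refl
  ... | no _     | no _     | yes refl | _        = contradiction (trans (sym eq) (base-x (lookup ts u))) λ ()
    where
    base-x : ∀ t → related (base t) xᶜ ≡ false
    base-x (true  , _) = refl
    base-x (false , _) = refl
  ... | no _     | no _     | no _     | yes refl = contradiction (trans (sym eq) (base-y (lookup ts u))) λ ()
    where
    base-y : ∀ t → related (base t) yᶜ ≡ false
    base-y (true  , _) = refl
    base-y (false , _) = refl

  tagged-x : ∀ {x y} → tagged ((x , y) ∷ []) x ≡ xᶜ
  tagged-x {x} with x Fin.≟ x
  ... | yes _   = refl
  ... | no  x≢x = contradiction refl x≢x

  tagged-y : ∀ {x y} → x ≢ y → tagged ((x , y) ∷ []) y ≡ yᶜ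
  tagged-y {x} {y} x≢y with y Fin.≟ x | y Fin.≟ y
  ... | yes y≡x | _       = contradiction (sym y≡x) x≢y
  ... | no _    | yes _   = refl
  ... | no _    | no  y≢y = contradiction refl y≢y

  tagged-related⁺ : ∀ {D} → Shape ts D → ∀ {u v} → (u , v) ∈ D ⊎ (v , u) ∈ D →
                    related (tagged D u) (tagged D v) ≡ true
  tagged-related⁺ (one-edge {x} {y} x≢y _ _) (inj₁ (here refl)) =
    cong₂ related (tagged-x {x} {y}) (tagged-y x≢y)
  tagged-related⁺ (one-edge {x} {y} x≢y _ _) (inj₂ (here refl)) =
    cong₂ related (tagged-y x≢y) (tagged-x {x} {y})

  base-not : ∀ {c} t → isJoined c ≡ true → c ≢ joinedᶜ → base t ≢ c
  base-not (true  , _) _ c≢j refl = c≢j refl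
  base-not (false , _) ()  _   refl

  tagged-x⁻ : ∀ {D v} → tagged D v ≡ xᶜ → ∃₂ λ y D′ → D ≡ (v , y) ∷ D′
  tagged-x⁻ {[]}          {v} eq = contradiction eq (base-not (lookup ts v) refl λ ())
  tagged-x⁻ {(x , y) ∷ D} {v} eq with v Fin.≟ x | v Fin.≟ y
  ... | yes refl | _     = y , D , refl
  ... | no _     | yes _ = contradiction eq λ ()
  ... | no _     | no _  = contradiction eq (base-not (lookup ts v) refl λ ())

  tagged-y⁻ : ∀ {D v} → tagged D v ≡ yᶜ → ∃₂ λ x D′ → D ≡ (x , v) ∷ D′
  tagged-y⁻ {[]}          {v} eq = contradiction eq (base-not (lookup ts v) refl λ ())
  tagged-y⁻ {(x , y) ∷ D} {v} eq with v Fin.≟ x | v Fin.≟ y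
  ... | yes _ | _        = contradiction eq λ ()
  ... | no _  | yes refl = x , D , refl
  ... | no _  | no _     = contradiction eq (base-not (lookup ts v) refl λ ())

  tagged-inner : ∀ D v → tagged D v ≢ sᶜ × tagged D v ≢ tᶜ
  tagged-inner [] v = base-inner (lookup ts v)
    where
    base-inner : ∀ t → base t ≢ sᶜ × base t ≢ tᶜ
    base-inner (true  , _) = (λ ()) , λ ()
    base-inner (false , _) = (λ ()) , λ ()
  tagged-inner ((x , y) ∷ D) v with does (v Fin.≟ x) | does (v Fin.≟ y)
  ... | true  | _     = (λ ()) , λ ()
  ... | false | true  = (λ ()) , λ ()
  ... | false | false = tagged-inner [] v

related-s : ∀ {c} → c ≢ tᶜ → related sᶜ c ≡ isJoined c
related-s {sᶜ}        c≢t = refl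
related-s {tᶜ}        c≢t = contradiction refl c≢t
related-s {xᶜ}        c≢t = refl
related-s {yᶜ}        c≢t = refl
related-s {joinedᶜ}   c≢t = refl
related-s {isolatedᶜ} c≢t = refl

related-t : ∀ {c} → c ≢ sᶜ → related tᶜ c ≡ isJoined c
related-t {sᶜ}        c≢s = contradiction refl c≢s
related-t {tᶜ}        c≢s = refl
related-t {xᶜ}        c≢s = refl
related-t {yᶜ}        c≢s = refl
related-t {joinedᶜ}   c≢s = refl
related-t {isolatedᶜ} c≢s = refl

related-comm : ∀ c d → related c d ≡ related d c
related-comm c d = Bool.∨-comm (arc c d) (arc d c)

cost-twoSided : ∀ {n} (ts : Vec Type n) → AllTwoSided ts →
                cost ts ≡ 2 ℕ.* sum (λ v → side (proj₁ (lookup ts v)))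
cost-twoSided []             two = refl
cost-twoSided ((a , b) ∷ ts) two = begin
  side a ℕ.+ side b ℕ.+ cost ts    ≡⟨ cong₂ (λ b c → side a ℕ.+ side b ℕ.+ c) (sym (two zero))
                                             (cost-twoSided ts λ v → two (suc v)) ⟩
  side a ℕ.+ side a ℕ.+ 2 ℕ.* k    ≡⟨ cong (ℕ._+ 2 ℕ.* k) (cong (side a ℕ.+_) (sym (ℕ.+-identityʳ (side a)))) ⟩
  2 ℕ.* side a ℕ.+ 2 ℕ.* k         ≡⟨ ℕ.*-distribˡ-+ 2 (side a) k ⟨
  2 ℕ.* (side a ℕ.+ k)             ∎
  where
  open ≡-Reasoning
  k = sum (λ v → side (proj₁ (lookup ts v)))

shape-length : ∀ {n} {ts : Vec Type n} {D} → Shape ts D → length D ≡ 0 ⊎ length D ≡ 1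
shape-length no-edge          = inj₁ refl
shape-length (one-edge _ _ _) = inj₂ refl

-- The edges at the terminals other than st come in pairs, so the parity of the number of edges
-- decides whether there is a middle edge.
split-parity : ∀ {a b j k} → a ≡ 0 ⊎ a ≡ 1 → b ≡ 0 ⊎ b ≡ 1 → a ℕ.+ 2 ℕ.* j ≡ b ℕ.+ 2 ℕ.* k → a ≡ b × j ≡ k
split-parity {j = j} {k} (inj₁ refl) (inj₁ refl) eq = refl , ℕ.*-cancelˡ-≡ j k 2 eq
split-parity {j = j} {k} (inj₁ refl) (inj₂ refl) eq = contradiction eq (ℕ.even≢odd j k)
split-parity {j = j} {k} (inj₂ refl) (inj₁ refl) eq = contradiction (sym eq) (ℕ.even≢odd k j)
split-parity {j = j} {k} (inj₂ refl) (inj₂ refl) eq = refl , ℕ.*-cancelˡ-≡ j k 2 (ℕ.suc-injective eq)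

module Colouring {n} (G : TwoTerminalGraph n) (ext : Extremal G) where

  open TwoTerminalGraph G
  open Structure G
  open Extremal ext
  open Unreliability G using (Place; at-s; at-t; mid; place; lookup-types; does-true)

  colour : Fin n → Colour
  colour v with v Fin.≟ s | v Fin.≟ t
  ... | yes _ | _     = sᶜ
  ... | no  _ | yes _ = tᶜ
  ... | no  _ | no  _ = tagged types middle v

  colour-s : colour s ≡ sᶜ
  colour-s with s Fin.≟ s
  ... | yes _   = refl
  ... | no  s≢s = contradiction refl s≢s

  colour-t : colour t ≡ tᶜ
  colour-t with t Fin.≟ s | t Fin.≟ t
  ... | yes t≡s | _       = contradiction (sym t≡s) s≢t
  ... | no  _   | yes _   = refl
  ... | no  _   | no  t≢t = contradiction refl t≢t

  colour-inner : ∀ {v} → Inner v → colour v ≡ tagged types middle v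
  colour-inner {v} (v≢s , v≢t) with v Fin.≟ s | v Fin.≟ t
  ... | yes v≡s | _       = contradiction v≡s v≢s
  ... | no  _   | yes v≡t = contradiction v≡t v≢t
  ... | no  _   | no  _   = refl

  colour-isJoined : ∀ {v} → Inner v → isJoined (colour v) ≡ does (source? v)
  colour-isJoined {v} iv = trans (cong isJoined (colour-inner iv))
    (trans (tagged-isJoined types shape v) (cong proj₁ (lookup-types v)))

  sink-source : ∀ v → does (sink? v) ≡ does (source? v)
  sink-source v = trans (sym (cong proj₂ (lookup-types v))) (trans (sym (twoSided v)) (cong proj₁ (lookup-types v)))

  colour-s⁻ : ∀ v → colour v ≡ sᶜ → v ≡ s
  colour-s⁻ v eq with place v
  ... | at-s   = refl
  ... | at-t   = contradiction (trans (sym colour-t) eq) λ ()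
  ... | mid iv = contradiction (trans (sym (colour-inner iv)) eq) (proj₁ (tagged-inner types middle v))

  colour-t⁻ : ∀ v → colour v ≡ tᶜ → v ≡ t
  colour-t⁻ v eq with place v
  ... | at-s   = contradiction (trans (sym colour-s) eq) λ ()
  ... | at-t   = refl
  ... | mid iv = contradiction (trans (sym (colour-inner iv)) eq) (proj₂ (tagged-inner types middle v))

  ∈-middle⁺ : ∀ {u v} → Inner u → Inner v → Adj u v → (u , v) ∈ middle ⊎ (v , u) ∈ middle
  ∈-middle⁺ {u} {v} iu iv uv = Sum.map (λ e → collect iu iv (subst (_∈ es) e (edge-∈ uv)))
    (λ e → collect iv iu (subst (_∈ es) e (edge-∈ uv))) (edge-ends u v)
    where
    collect : ∀ {u v} → Inner u → Inner v → (u , v) ∈ es → (u , v) ∈ middle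
    collect iu iv e∈ = ∈-filter⁺ middle? e∈ (iu , iv)

  ∈-middle-adj : ∀ {u v} → (u , v) ∈ middle ⊎ (v , u) ∈ middle → Adj u v
  ∈-middle-adj (inj₁ e∈) = proj₂ (∈-edges⁻ (proj₁ (∈-middle⁻ e∈)))
  ∈-middle-adj (inj₂ e∈) = symm (proj₂ (∈-edges⁻ (proj₁ (∈-middle⁻ e∈))))

  related-inner : ∀ u v → Inner u → Inner v →
    related (colour u) (colour v) ≡ related (tagged types middle u) (tagged types middle v)
  related-inner u v iu iv = cong₂ related (colour-inner iu) (colour-inner iv)

  related-s-inner : ∀ v → Inner v → related (colour s) (colour v) ≡ does (source? v)
  related-s-inner v iv = trans (cong (λ c → related c (colour v)) colour-s)
    (trans (related-s λ eq → proj₂ iv (colour-t⁻ v eq)) (colour-isJoined iv))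

  related-t-inner : ∀ v → Inner v → related (colour t) (colour v) ≡ does (sink? v)
  related-t-inner v iv = trans (cong (λ c → related c (colour v)) colour-t)
    (trans (related-t λ eq → proj₁ iv (colour-s⁻ v eq)) (trans (colour-isJoined iv) (sym (sink-source v))))

  adj⇒related : ∀ u v → Adj u v → related (colour u) (colour v) ≡ true
  adj⇒related u v uv with place u | place v
  ... | at-s   | at-s   = contradiction uv (irrefl refl)
  ... | at-s   | at-t   = cong₂ related colour-s colour-t
  ... | at-t   | at-s   = cong₂ related colour-t colour-s
  ... | at-t   | at-t   = contradiction uv (irrefl refl)
  ... | at-s   | mid iv = trans (related-s-inner v iv) (dec-true (source? v) (uv , proj₂ iv))
  ... | at-t   | mid iv = trans (related-t-inner v iv) (dec-true (sink? v) (uv , proj₁ iv))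
  ... | mid iu | at-s   = trans (related-comm (colour u) (colour s))
    (trans (related-s-inner u iu) (dec-true (source? u) (symm uv , proj₂ iu)))
  ... | mid iu | at-t   = trans (related-comm (colour u) (colour t))
    (trans (related-t-inner u iu) (dec-true (sink? u) (symm uv , proj₁ iu)))
  ... | mid iu | mid iv = trans (related-inner u v iu iv)
    (tagged-related⁺ types shape (∈-middle⁺ iu iv uv))

  related⇒adj : ∀ u v → related (colour u) (colour v) ≡ true → Adj u v
  related⇒adj u v eq with place u | place v
  ... | at-s   | at-s   = contradiction (trans (sym eq) (cong₂ related colour-s colour-s)) λ ()
  ... | at-s   | at-t   = adjacent
  ... | at-t   | at-s   = symm adjacent
  ... | at-t   | at-t   = contradiction (trans (sym eq) (cong₂ related colour-t colour-t)) λ ()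
  ... | at-s   | mid iv = proj₁ (does-true (source? v) (trans (sym (related-s-inner v iv)) eq))
  ... | at-t   | mid iv = proj₁ (does-true (sink? v) (trans (sym (related-t-inner v iv)) eq))
  ... | mid iu | at-s   = symm (proj₁ (does-true (source? u)
    (trans (sym (related-s-inner u iu)) (trans (related-comm (colour s) (colour u)) eq))))
  ... | mid iu | at-t   = symm (proj₁ (does-true (sink? u)
    (trans (sym (related-t-inner u iu)) (trans (related-comm (colour t) (colour u)) eq))))
  ... | mid iu | mid iv = ∈-middle-adj (tagged-related⁻ types shape u v (trans (sym (related-inner u v iu iv)) eq))

  joined-inner : ∀ {v} → lookup types v ≡ joined → Inner v
  joined-inner {v} eq
    with sv , v≢t ← does-true (source? v) (trans (sym (cong proj₁ (lookup-types v))) (cong proj₁ eq)) =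
    (λ v≡s → irrefl (sym v≡s) sv) , v≢t

  colour-x⁻ : ∀ v → colour v ≡ xᶜ → ∃₂ λ y D → middle ≡ (v , y) ∷ D
  colour-x⁻ v eq with place v
  ... | at-s   = contradiction (trans (sym colour-s) eq) λ ()
  ... | at-t   = contradiction (trans (sym colour-t) eq) λ ()
  ... | mid iv = tagged-x⁻ types (trans (sym (colour-inner iv)) eq)

  colour-y⁻ : ∀ v → colour v ≡ yᶜ → ∃₂ λ x D → middle ≡ (x , v) ∷ D
  colour-y⁻ v eq with place v
  ... | at-s   = contradiction (trans (sym colour-s) eq) λ ()
  ... | at-t   = contradiction (trans (sym colour-t) eq) λ ()
  ... | mid iv = tagged-y⁻ types (trans (sym (colour-inner iv)) eq)

  -- The list is abstracted as `D`, since `middle` is a computed list on which `Shape` could not be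
  -- matched.
  count-x : ∀ {D} → D ≡ middle → Shape types D → count xᶜ colour ≡ length D
  count-x eq no-edge = count-none xᶜ colour λ v cv → case (trans eq (proj₂ (proj₂ (colour-x⁻ v cv))))
    where
    case : ∀ {e : Fin n × Fin n} {D : List (Fin n × Fin n)} → [] ≡ e ∷ D → ⊥
    case ()
  count-x eq (one-edge {x} {y} x≢y tx ty) = count-once xᶜ colour x
    (trans (colour-inner (joined-inner tx)) (trans (cong (λ D → tagged types D x) (sym eq)) (tagged-x types {x} {y})))
    λ v cv → case (trans eq (proj₂ (proj₂ (colour-x⁻ v cv))))
    where
    case : ∀ {v y′ : Fin n} {D : List (Fin n × Fin n)} → (x , y) ∷ [] ≡ (v , y′) ∷ D → v ≡ x
    case refl = refl

  count-y : ∀ {D} → D ≡ middle → Shape types D → count yᶜ colour ≡ length D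
  count-y eq no-edge = count-none yᶜ colour λ v cv → case (trans eq (proj₂ (proj₂ (colour-y⁻ v cv))))
    where
    case : ∀ {e : Fin n × Fin n} {D : List (Fin n × Fin n)} → [] ≡ e ∷ D → ⊥
    case ()
  count-y eq (one-edge {x} {y} x≢y tx ty) = count-once yᶜ colour y
    (trans (colour-inner (joined-inner ty)) (trans (cong (λ D → tagged types D y) (sym eq)) (tagged-y types x≢y)))
    λ v cv → case (trans eq (proj₂ (proj₂ (colour-y⁻ v cv))))
    where
    case : ∀ {v x′ : Fin n} {D : List (Fin n × Fin n)} → (x , y) ∷ [] ≡ (x′ , v) ∷ D → v ≡ y
    case refl = refl

  count-s : count sᶜ colour ≡ 1
  count-s = count-once sᶜ colour s colour-s colour-s⁻

  count-t : count tᶜ colour ≡ 1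
  count-t = count-once tᶜ colour t colour-t colour-t⁻

  joinedCount : ℕ
  joinedCount = sum λ v → side (proj₁ (lookup types v))

  sum-isJoined : sum (λ v → side (isJoined (colour v))) ≡ joinedCount
  sum-isJoined = sum-cong-≗ λ v → cong side (at (place v))
    where
    terminal : ∀ {u} → ¬ Source u → does (source? u) ≡ false
    terminal {u} ¬u with does (source? u) in eq
    ... | true  = contradiction (does-true (source? u) eq) ¬u
    ... | false = refl
    at : ∀ {v} → Place v → isJoined (colour v) ≡ proj₁ (lookup types v)
    at at-s = trans (cong isJoined colour-s)
      (sym (trans (cong proj₁ (lookup-types s)) (terminal λ (ss , _) → irrefl refl ss)))
    at at-t = trans (cong isJoined colour-t)
      (sym (trans (cong proj₁ (lookup-types t)) (terminal λ (_ , t≢t) → t≢t refl)))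
    at {v} (mid iv) = trans (colour-isJoined iv) (sym (cong proj₁ (lookup-types v)))

  innerCount-joined : innerCount G ≡ length middle ℕ.+ 2 ℕ.* joinedCount
  innerCount-joined = cong (length middle ℕ.+_) (cost-twoSided types twoSided)

  -- The summand `length middle` occurs twice, for the colours `xᶜ` and `yᶜ`, each used once per
  -- middle edge.
  joinedCount-split : joinedCount ≡ length middle ℕ.+ (length middle ℕ.+ count joinedᶜ colour)
  joinedCount-split = trans (sym sum-isJoined) (trans (joined-count colour)
    (cong₂ (λ a b → a ℕ.+ (b ℕ.+ count joinedᶜ colour)) (count-x refl shape) (count-y refl shape)))

  order-split : n ≡ 2 ℕ.+ (joinedCount ℕ.+ count isolatedᶜ colour)
  order-split = trans (total-count colour) (trans
    (cong₂ (λ a b → a ℕ.+ (b ℕ.+ (sum (λ v → side (isJoined (colour v))) ℕ.+ count isolatedᶜ colour)))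
      count-s count-t)
    (cong (λ j → 2 ℕ.+ (j ℕ.+ count isolatedᶜ colour)) sum-isJoined))

extremal-≅ : ∀ {n} (G H : TwoTerminalGraph n) → Extremal G → Extremal H →
             edgeCount (TwoTerminalGraph.graph G) ≡ edgeCount (TwoTerminalGraph.graph H) → G ≅ H
extremal-≅ {n} G H extG extH same = record
  { bij       = π
  ; adj       = λ u v → mk⇔
      (λ uv → B.related⇒adj _ _ (trans (cong₂ related (π-colour u) (π-colour v)) (A.adj⇒related u v uv)))
      (λ uv → A.related⇒adj u v (trans (sym (cong₂ related (π-colour u) (π-colour v))) (B.adj⇒related _ _ uv)))
  ; terminals = λ v → mk⇔
      (Sum.map (λ { refl → B.colour-s⁻ _ (trans (π-colour _) A.colour-s) })
               (λ { refl → B.colour-t⁻ _ (trans (π-colour _) A.colour-t) }))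
      (Sum.map (λ eq → A.colour-s⁻ v (trans (sym (π-colour v)) (trans (cong B.colour eq) B.colour-s)))
               (λ eq → A.colour-t⁻ v (trans (sym (π-colour v)) (trans (cong B.colour eq) B.colour-t))))
  }
  where
  module A = Colouring G extG
  module B = Colouring H extH
  lengths : length (Structure.middle G) ≡ length (Structure.middle H) × A.joinedCount ≡ B.joinedCount
  lengths = split-parity (shape-length (Extremal.shape extG)) (shape-length (Extremal.shape extH))
    (trans (sym A.innerCount-joined) (trans (ℕ.suc-injective (trans (sym (extremal-edgeCount G extG))
      (trans same (extremal-edgeCount H extH)))) B.innerCount-joined))
  m≡ = proj₁ lengths
  j≡ = proj₂ lengths
  same-count : ∀ c → count c A.colour ≡ count c B.colour
  same-count sᶜ = trans A.count-s (sym B.count-s)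
  same-count tᶜ = trans A.count-t (sym B.count-t)
  same-count xᶜ = trans (A.count-x refl (Extremal.shape extG)) (trans m≡ (sym (B.count-x refl (Extremal.shape extH))))
  same-count yᶜ = trans (A.count-y refl (Extremal.shape extG)) (trans m≡ (sym (B.count-y refl (Extremal.shape extH))))
  same-count joinedᶜ = ℕ.+-cancelˡ-≡ l _ _ (ℕ.+-cancelˡ-≡ l _ _ (trans (sym A.joinedCount-split)
    (trans j≡ (trans B.joinedCount-split (cong (λ l → l ℕ.+ (l ℕ.+ count joinedᶜ B.colour)) (sym m≡))))))
    where l = length (Structure.middle G)
  same-count isolatedᶜ = ℕ.+-cancelˡ-≡ A.joinedCount _ _ (ℕ.+-cancelˡ-≡ 2 _ _ (trans (sym A.order-split)
    (trans B.order-split (cong (λ j → 2 ℕ.+ (j ℕ.+ count isolatedᶜ B.colour)) (sym j≡)))))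
  matching = match-colours A.colour B.colour same-count
  π = proj₁ matching
  π-colour = proj₂ matching

-- The graphs H

empty-list : ∀ {A : Set} (xs : List A) → (∀ {x} → ¬ x ∈ xs) → xs ≡ []
empty-list []       none = refl
empty-list (x ∷ xs) none = contradiction (here refl) none

singleton-list : ∀ {A : Set} {xs : List A} {a} → Unique xs → a ∈ xs → (∀ {x} → x ∈ xs → x ≡ a) → xs ≡ a ∷ []
singleton-list {xs = x ∷ []}     _ _ only = cong (_∷ []) (only (here refl))
singleton-list {xs = x ∷ y ∷ xs} ((x≢y ∷ _) ∷ _) _ only =
  contradiction (trans (only (here refl)) (sym (only (there (here refl))))) x≢y

-- The lower end `lo` is arbitrary so that the induction can shift both ends of the range; the
-- application has lo = 2.
cost-range : ∀ n lo k → lo ℕ.≤ k → k ℕ.≤ n → (a b : Fin n → Bool) →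
  (∀ v → lo ℕ.≤ Fin.toℕ v → Fin.toℕ v ℕ.< k → a v ≡ true × b v ≡ true) →
  (∀ v → Fin.toℕ v ℕ.< lo ⊎ k ℕ.≤ Fin.toℕ v → a v ≡ false × b v ≡ false) →
  cost (Vec.tabulate λ v → a v , b v) ≡ 2 ℕ.* (k ℕ.∸ lo)
cost-range zero    zero     zero    lo≤k k≤n a b in-range out-of-range = refl
cost-range (suc n) zero     zero    lo≤k k≤n a b in-range out-of-range
  rewrite proj₁ (out-of-range zero (inj₂ ℕ.z≤n)) | proj₂ (out-of-range zero (inj₂ ℕ.z≤n)) =
  cost-range n 0 0 ℕ.z≤n ℕ.z≤n (λ v → a (suc v)) (λ v → b (suc v)) 
    (λ v _ ()) (λ v _ → out-of-range (suc v) (inj₂ ℕ.z≤n))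
cost-range (suc n) zero     (suc k) lo≤k (ℕ.s≤s k≤n) a b in-range out-of-range
  rewrite proj₁ (in-range zero ℕ.z≤n (ℕ.s≤s ℕ.z≤n)) | proj₂ (in-range zero ℕ.z≤n (ℕ.s≤s ℕ.z≤n)) =
  trans (cong (λ c → suc (suc c)) (cost-range n 0 k ℕ.z≤n k≤n (λ v → a (suc v)) (λ v → b (suc v))
    (λ v _ v<k → in-range (suc v) ℕ.z≤n (ℕ.s≤s v<k))
    (λ v → λ { (inj₂ k≤v) → out-of-range (suc v) (inj₂ (ℕ.s≤s k≤v)) })))
    (sym (ℕ.*-suc 2 k))
cost-range (suc n) (suc lo) (suc k) (ℕ.s≤s lo≤k) (ℕ.s≤s k≤n) a b in-range out-of-range
  rewrite proj₁ (out-of-range zero (inj₁ (ℕ.s≤s ℕ.z≤n))) | proj₂ (out-of-range zero (inj₁ (ℕ.s≤s ℕ.z≤n))) =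
  cost-range n lo k lo≤k k≤n (λ v → a (suc v)) (λ v → b (suc v))
    (λ v lo≤v v<k → in-range (suc v) (ℕ.s≤s lo≤v) (ℕ.s≤s v<k))
    (λ v → out-of-range (suc v) ∘ Sum.map ℕ.s≤s ℕ.s≤s)

module Fan {k n} (k≤n : k ℕ.≤ n) (r : ℕ) (3≤k : 3 ℕ.≤ k) (r≤k-3 : r ℕ.≤ k ℕ.∸ 3) where

  fan : TwoTerminalGraph n
  fan = addIsolated k≤n (A k r 3≤k r≤k-3)

  open TwoTerminalGraph fan
  open Structure fan
  open Unreliability fan using (lookup-types; does-true)

  label : Fin n → ℕ
  label v = suc (Fin.toℕ v)

  toℕ-s : Fin.toℕ s ≡ 0
  toℕ-s = trans (Fin.toℕ-inject≤ _ k≤n) (Fin.toℕ-fromℕ< _)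

  toℕ-t : Fin.toℕ t ≡ 1
  toℕ-t = trans (Fin.toℕ-inject≤ _ k≤n) (Fin.toℕ-fromℕ< _)

  adj⁻ : ∀ {u v} → Adj u v → Fin.toℕ u ℕ.< k × Fin.toℕ v ℕ.< k ×
         (AEdge r (label u) (label v) ⊎ AEdge r (label v) (label u))
  adj⁻ (a , b , refl , refl , ab) rewrite Fin.toℕ-inject≤ a k≤n | Fin.toℕ-inject≤ b k≤n =
    Fin.toℕ<n a , Fin.toℕ<n b , ab

  adj⁺ : ∀ {u v} → Fin.toℕ u ℕ.< k → Fin.toℕ v ℕ.< k → AEdge r (label u) (label v) → Adj u v
  adj⁺ {u} {v} u<k v<k uv = Fin.fromℕ< u<k , Fin.fromℕ< v<k , embed u<k , embed v<k ,
    inj₁ (subst₂ (AEdge r) (cong suc (sym (Fin.toℕ-fromℕ< u<k))) (cong suc (sym (Fin.toℕ-fromℕ< v<k))) uv)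
    where
    embed : ∀ {w} (w<k : Fin.toℕ w ℕ.< k) → Fin.inject≤ (Fin.fromℕ< w<k) k≤n ≡ w
    embed w<k = Fin.toℕ-injective (trans (Fin.toℕ-inject≤ (Fin.fromℕ< w<k) k≤n) (Fin.toℕ-fromℕ< w<k))

  s<k : Fin.toℕ s ℕ.< k
  s<k = subst (ℕ._< k) (sym toℕ-s) (ℕ.≤-trans (ℕ.s≤s ℕ.z≤n) 3≤k)

  t<k : Fin.toℕ t ℕ.< k
  t<k = subst (ℕ._< k) (sym toℕ-t) (ℕ.≤-trans (ℕ.s≤s (ℕ.s≤s ℕ.z≤n)) 3≤k)

  adjacent : Adj s t
  adjacent = adj⁺ s<k t<k (inj₁ (cong suc toℕ-s , cong suc toℕ-t))

  -- Labels start at 1, so the vertices labelled 3 to k are those with values 2 to k - 1.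
  InRange : Fin n → Set
  InRange v = 2 ℕ.≤ Fin.toℕ v × Fin.toℕ v ℕ.< k

  source⁺ : ∀ v → InRange v → Source v
  source⁺ v (2≤v , v<k) = adj⁺ s<k v<k (inj₂ (inj₁ (cong suc toℕ-s , ℕ.s≤s 2≤v))) ,
    λ { refl → ℕ.<-irrefl (sym toℕ-t) 2≤v }

  sink⁺ : ∀ v → InRange v → Sink v
  sink⁺ v (2≤v , v<k) = adj⁺ t<k v<k (inj₂ (inj₂ (inj₁ (cong suc toℕ-t , ℕ.s≤s 2≤v)))) ,
    λ { refl → contradiction (subst (2 ℕ.≤_) toℕ-s 2≤v) λ () }

  inner≥2 : ∀ {v} → Inner v → 2 ℕ.≤ Fin.toℕ v
  inner≥2 {v} (v≢s , v≢t) = ℕ.≤∧≢⇒< (ℕ.n≢0⇒n>0 λ v≡0 → v≢s (Fin.toℕ-injective (trans v≡0 (sym toℕ-s))))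
    λ 1≡v → v≢t (Fin.toℕ-injective (trans (sym 1≡v) (sym toℕ-t)))

  source⁻ : ∀ v → Source v → InRange v
  source⁻ v (sv , v≢t) = inner≥2 ((λ v≡s → irrefl (sym v≡s) sv) , v≢t) , proj₁ (proj₂ (adj⁻ sv))

  sink⁻ : ∀ v → Sink v → InRange v
  sink⁻ v (tv , v≢s) = inner≥2 (v≢s , (λ v≡t → irrefl (sym v≡t) tv)) , proj₁ (proj₂ (adj⁻ tv))

  twoSided : AllTwoSided types
  twoSided v = subst TwoSided (sym (lookup-types v)) (Dec.does-⇔
    (mk⇔ (λ a → sink⁺ v (source⁻ v a)) (λ b → source⁺ v (sink⁻ v b))) (source? v) (sink? v))

  cost-types : cost types ≡ 2 ℕ.* (k ℕ.∸ 2)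
  cost-types = cost-range n 2 k (ℕ.≤-trans (ℕ.n≤1+n 2) 3≤k) k≤n (λ v → does (source? v)) (λ v → does (sink? v))
    (λ v 2≤v v<k → dec-true (source? v) (source⁺ v (2≤v , v<k)) , dec-true (sink? v) (sink⁺ v (2≤v , v<k)))
    (λ v out → dec-false (source? v) (λ a → out-of-range v out (source⁻ v a)) ,
               dec-false (sink? v) (λ b → out-of-range v out (sink⁻ v b)))
    where
    out-of-range : ∀ v → Fin.toℕ v ℕ.< 2 ⊎ k ℕ.≤ Fin.toℕ v → ¬ InRange v
    out-of-range v (inj₁ v<2) (2≤v , _) = ℕ.<⇒≱ v<2 2≤v
    out-of-range v (inj₂ k≤v) (_ , v<k) = ℕ.<⇒≱ v<k k≤v

  inner-edge : ∀ {u v} → 2 ℕ.≤ Fin.toℕ u → AEdge r (label u) (label v) →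
               Fin.toℕ u ≡ 2 × 3 ℕ.≤ Fin.toℕ v × Fin.toℕ v ℕ.≤ 2 ℕ.+ r
  inner-edge 2≤u (inj₁ (eq , _)) =
    contradiction (subst (2 ℕ.≤_) (ℕ.suc-injective eq) 2≤u) λ ()
  inner-edge 2≤u (inj₂ (inj₁ (eq , _))) =
    contradiction (subst (2 ℕ.≤_) (ℕ.suc-injective eq) 2≤u) λ ()
  inner-edge 2≤u (inj₂ (inj₂ (inj₁ (eq , _)))) =
    contradiction (subst (2 ℕ.≤_) (ℕ.suc-injective eq) 2≤u) λ { (ℕ.s≤s ()) }
  inner-edge 2≤u (inj₂ (inj₂ (inj₂ (eq , ℕ.s≤s 3≤v , ℕ.s≤s v≤)))) = ℕ.suc-injective eq , 3≤v , v≤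

  middle⁻ : ∀ {u v} → (u , v) ∈ middle → Fin.toℕ u ≡ 2 × 3 ℕ.≤ Fin.toℕ v × Fin.toℕ v ℕ.≤ 2 ℕ.+ r
  middle⁻ {u} {v} e∈ with ∈-middle⁻ e∈
  ... | e∈es , iu , iv with ∈-edges⁻ e∈es
  ... | u<v , uv with adj⁻ uv
  ... | _ , _ , inj₁ e = inner-edge {u} {v} (inner≥2 iu) e
  ... | _ , _ , inj₂ e = contradiction u<v (ℕ.<⇒≯ (subst (ℕ._< Fin.toℕ u) (sym (proj₁ back)) (proj₁ (proj₂ back))))
    where back = inner-edge {v} {u} (inner≥2 iv) e

  shape₀ : r ≡ 0 → Shape types middle × length middle ≡ r
  shape₀ refl = subst (λ D → Shape types D × length D ≡ 0) (sym (empty-list middle none)) (no-edge , refl)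
    where
    none : ∀ {e} → ¬ e ∈ middle
    none e∈ with _ , 3≤v , v≤2 ← middle⁻ e∈ = ℕ.<⇒≱ 3≤v v≤2

  shape₁ : r ≡ 1 → Shape types middle × length middle ≡ r
  shape₁ refl = subst (λ D → Shape types D × length D ≡ 1) (sym middle≡)
    (one-edge v₃≢v₄ (joined-at v₃ v₃-range) (joined-at v₄ v₄-range) , refl)
    where
    4≤k : 4 ℕ.≤ k
    4≤k = ℕ.≤-trans (ℕ.+-monoʳ-≤ 3 r≤k-3) (ℕ.≤-reflexive (ℕ.m+[n∸m]≡n 3≤k))
    v₃ v₄ : Fin n
    v₃ = Fin.fromℕ< {2} (ℕ.≤-trans 3≤k k≤n)
    v₄ = Fin.fromℕ< {3} (ℕ.≤-trans 4≤k k≤n)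
    toℕ-v₃ : Fin.toℕ v₃ ≡ 2
    toℕ-v₃ = Fin.toℕ-fromℕ< _
    toℕ-v₄ : Fin.toℕ v₄ ≡ 3
    toℕ-v₄ = Fin.toℕ-fromℕ< _
    v₃<k : Fin.toℕ v₃ ℕ.< k
    v₃<k = subst (ℕ._< k) (sym toℕ-v₃) 3≤k
    v₄<k : Fin.toℕ v₄ ℕ.< k
    v₄<k = subst (ℕ._< k) (sym toℕ-v₄) 4≤k
    v₃-range : InRange v₃
    v₃-range = subst (2 ℕ.≤_) (sym toℕ-v₃) ℕ.≤-refl , v₃<k
    v₄-range : InRange v₄
    v₄-range = subst (2 ℕ.≤_) (sym toℕ-v₄) (ℕ.n≤1+n 2) , v₄<k
    v₃≢v₄ : v₃ ≢ v₄
    v₃≢v₄ eq = contradiction (trans (sym toℕ-v₃) (trans (cong Fin.toℕ eq) toℕ-v₄)) λ ()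
    joined-at : ∀ v → InRange v → lookup types v ≡ joined
    joined-at v range = trans (lookup-types v)
      (cong₂ _,_ (dec-true (source? v) (source⁺ v range)) (dec-true (sink? v) (sink⁺ v range)))
    range-inner : ∀ {v} → InRange v → Inner v
    range-inner (2≤v , _) = (λ { refl → contradiction (subst (2 ℕ.≤_) toℕ-s 2≤v) λ () }) ,
                            (λ { refl → ℕ.<-irrefl (sym toℕ-t) 2≤v })
    edge∈ : (v₃ , v₄) ∈ middle
    edge∈ = ∈-filter⁺ middle? (∈-edges⁺ (subst₂ ℕ._<_ (sym toℕ-v₃) (sym toℕ-v₄) ℕ.≤-refl)
      (adj⁺ v₃<k v₄<k (inj₂ (inj₂ (inj₂ (cong suc toℕ-v₃ ,
        ℕ.≤-reflexive (cong suc (sym toℕ-v₄)) , ℕ.≤-reflexive (cong suc toℕ-v₄)))))))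
      (range-inner v₃-range , range-inner v₄-range)
    only : ∀ {e} → e ∈ middle → e ≡ (v₃ , v₄)
    only e∈ with u≡2 , 3≤v , v≤3 ← middle⁻ e∈ = cong₂ _,_
      (Fin.toℕ-injective (trans u≡2 (sym toℕ-v₃)))
      (Fin.toℕ-injective (trans (ℕ.≤-antisym v≤3 3≤v) (sym toℕ-v₄)))
    middle≡ : middle ≡ (v₃ , v₄) ∷ []
    middle≡ = singleton-list (Unique.filter⁺ middle? unique-edges) edge∈ only

  extremal : Shape types middle → Extremal fan
  extremal shape = record { adjacent = adjacent ; twoSided = twoSided ; shape = shape }

  size : (shape : Shape types middle) → length middle ≡ r → edgeCount graph ≡ suc (r ℕ.+ 2 ℕ.* (k ℕ.∸ 2))
  size shape len = trans (extremal-edgeCount fan (extremal shape)) (cong suc (cong₂ ℕ._+_ len cost-types))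

  fan-extremal : r ≡ 0 ⊎ r ≡ 1 → Extremal fan × edgeCount graph ≡ suc (r ℕ.+ 2 ℕ.* (k ℕ.∸ 2))
  fan-extremal (inj₁ r≡0) with shape , len ← shape₀ r≡0 = extremal shape , size shape len
  fan-extremal (inj₂ r≡1) with shape , len ← shape₁ r≡1 = extremal shape , size shape len

module _ {n m} (5≤m : 5 ℕ.≤ m) (m≤2n-3 : m ℕ.≤ 2 ℕ.* n ℕ.∸ 3) where

  even-size : 2 ∣ m → suc (1 ℕ.+ 2 ℕ.* ((m ℕ.+ 2) / 2 ℕ.∸ 2)) ≡ m
  even-size (divides zero    refl) = contradiction 5≤m λ ()
  even-size (divides (suc j) refl) = begin
    2 ℕ.+ 2 ℕ.* ((suc j ℕ.* 2 ℕ.+ 2) / 2 ℕ.∸ 2)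
      ≡⟨ cong (λ x → 2 ℕ.+ 2 ℕ.* (x / 2 ℕ.∸ 2)) (ℕ.+-comm (suc j ℕ.* 2) 2) ⟩
    2 ℕ.+ 2 ℕ.* ((suc (suc j) ℕ.* 2) / 2 ℕ.∸ 2)
      ≡⟨ cong (λ x → 2 ℕ.+ 2 ℕ.* (x ℕ.∸ 2)) (m*n/n≡m (suc (suc j)) 2) ⟩
    2 ℕ.+ 2 ℕ.* j
      ≡⟨ cong (2 ℕ.+_) (ℕ.*-comm 2 j) ⟩
    suc j ℕ.* 2 ∎
    where open ≡-Reasoning

  odd-half : ¬ 2 ∣ m → m ≡ 1 ℕ.+ (m / 2) ℕ.* 2
  odd-half ¬2∣m with m % 2 | m%n<n m 2 | m≡m%n+[m/n]*n m 2
  ... | 0           | _ | eq = contradiction (divides (m / 2) eq) ¬2∣m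
  ... | 1           | _ | eq = eq
  ... | suc (suc _) | ℕ.s≤s (ℕ.s≤s ()) | _

  odd-size : ¬ 2 ∣ m → suc (0 ℕ.+ 2 ℕ.* ((m ℕ.+ 3) / 2 ℕ.∸ 2)) ≡ m
  odd-size ¬2∣m = begin
    1 ℕ.+ 2 ℕ.* ((m ℕ.+ 3) / 2 ℕ.∸ 2)
      ≡⟨ cong (λ x → 1 ℕ.+ 2 ℕ.* ((x ℕ.+ 3) / 2 ℕ.∸ 2)) (odd-half ¬2∣m) ⟩
    1 ℕ.+ 2 ℕ.* ((1 ℕ.+ j ℕ.* 2 ℕ.+ 3) / 2 ℕ.∸ 2)
      ≡⟨ cong (λ x → 1 ℕ.+ 2 ℕ.* (suc x / 2 ℕ.∸ 2)) (ℕ.+-comm (j ℕ.* 2) 3) ⟩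
    1 ℕ.+ 2 ℕ.* ((suc (suc j) ℕ.* 2) / 2 ℕ.∸ 2)
      ≡⟨ cong (λ x → 1 ℕ.+ 2 ℕ.* (x ℕ.∸ 2)) (m*n/n≡m (suc (suc j)) 2) ⟩
    1 ℕ.+ 2 ℕ.* j
      ≡⟨ cong suc (ℕ.*-comm 2 j) ⟩
    1 ℕ.+ j ℕ.* 2
      ≡⟨ odd-half ¬2∣m ⟨
    m ∎
    where
    open ≡-Reasoning
    j = m / 2

  H-extremal : Extremal (H n m 5≤m m≤2n-3) × H n m 5≤m m≤2n-3 ∈T[ m ]
  H-extremal with 2 ∣? m
  ... | yes 2∣m = let ext , size = Fan.fan-extremal (even-k≤n n m 5≤m m≤2n-3) 1
                                     (even-k≥3 n m 5≤m m≤2n-3) (even-r≤ n m 5≤m m≤2n-3 2∣m) (inj₂ refl)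
                  in ext , trans size (even-size 2∣m)
  ... | no ¬2∣m = let ext , size = Fan.fan-extremal (odd-k≤n n m 5≤m m≤2n-3) 0
                                     (odd-k≥3 n m 5≤m m≤2n-3) ℕ.z≤n (inj₁ refl)
                  in ext , trans size (odd-size ¬2∣m)

-- Optimality and uniqueness.

extremal-UMRTTG : ∀ {n m} (H : TwoTerminalGraph n) → Extremal H → H ∈T[ m ] → IsUMRTTG 3 m H
extremal-UMRTTG H ext size = size , λ G sizeG →
  reliability-mono G H (extremal-best G H ext (trans sizeG (sym size)))

UMRTTG-≅-extremal : ∀ {n m} (G H : TwoTerminalGraph n) → Extremal H → H ∈T[ m ] → IsUMRTTG 3 m G → G ≅ H
UMRTTG-≅-extremal G H ext size (sizeG , best) =
  extremal-≅ G H (extremal-unique G H ext same H≤G) ext same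
  where
  same = trans sizeG (sym size)
  H≤G : reliabilityℚ ½ H ≤ reliabilityℚ ½ G
  H≤G = reliability-fromℚ H G ½ (best H size (fromℚ ½) (fromℚ-mono 0≤½) (fromℚ-mono ½≤1))

theorem3 : (n m : ℕ) → 6 ℕ.≤ n → (5≤m : 5 ℕ.≤ m) → (m≤2n-3 : m ℕ.≤ 2 ℕ.* n ℕ.∸ 3) →
    IsUMRTTG 3 m (H n m 5≤m m≤2n-3) ×
    (∀ (G : TwoTerminalGraph n) → IsUMRTTG 3 m G → G ≅ H n m 5≤m m≤2n-3)
theorem3 n m _ 5≤m m≤2n-3 =
  let ext , size = H-extremal 5≤m m≤2n-3
  in extremal-UMRTTG (H n m 5≤m m≤2n-3) ext size ,
     λ G → UMRTTG-≅-extremal G (H n m 5≤m m≤2n-3) ext size
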